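{- Let $i\in\mathbb{Z}^+$. A type-two functional $F$ is basic $i$-feasible space (i.e. $F\in\mathrm{BFSF}_i(\varnothing)$) if and only if $F$ is quasi$^i$-polynomial space.
   Context: Strings are elements of $\{0,1\}^*$, $|w|$ is the length of $w$, $\lambda$ is the empty string. A type-two functional $F$ maps tuples $(\vec f,\vec x)$ of functions $f_1,\dots,f_k:\{0,1\}^*\to\{0,1\}^*$ and strings $x_1,\dots,x_l$ to strings; type-one functions are the case with no function arguments. Strings are identified with natural numbers via the standard enumeration (increasing length, lexicographic within a length, $\lambda\leftrightarrow 0$), and $\le$ on strings is the corresponding order. Growth rates: $g_0(n)=2n$ and $g_i(n)=2^{g_{i-1}(\log n)}$ for $i\ge 1$ (so $g_1(n)=n^2$, $g_2(n)=n^{\log n}$); logs are base 2, values are rounded up to integers where an integer is needed, and the finitely many small arguments at which the expression is undefined are assigned arbitrary fixed values. Operations on functionals. Functional composition: $F(\vec f,\vec x)=H(\vec f,G_1(\vec f,\vec x),\dots,G_l(\vec f,\vec x))$. Expansion: $F(\vec f,\vec g,\vec x,\vec y)=G(\vec f,\vec x)$. Bounded recursion (from $G,H,K$): $F(\vec f,\vec x,0)=G(\vec f,\vec x)$; $F(\vec f,\vec x,n+1)=H(\vec f,\vec x,n,F(\vec f,\vec x,n))$; and $F(\vec f,\vec x,n)\le K(\vec f,\vec x,n)$. For a set $X$ of type-two functionals, $\mathrm{BFSF}_i(X)$ is the smallest class of functionals containing $X$, all polynomial-time computable type-one functions, the function $x\mapsto 1^{g_i(|x|)}$, and the application functional $\mathrm{Ap}(f,x)=f(x)$,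 and closed under functional composition, expansion, and bounded recursion. The basic $i$-feasible space functionals are the elements of $\mathrm{BFSF}_i(\varnothing)$. The length of $f:\{0,1\}^*\to\{0,1\}^*$ is $|f|:\mathbb{N}\to\mathbb{N}$, $|f|(n)=\max_{|w|\le n}|f(w)|$. Second-order quasi$^i$-polynomials are defined inductively over first-order variables (ranging over $\mathbb N$) and second-order variables (ranging over functions $\mathbb N\to\mathbb N$): every $c\in\mathbb{N}$ and every first-order variable is one; if $P,Q$ are and $L$ is a second-order variable, then so are $P+Q$, $P\cdot Q$, $L(P)$ and $g_i(P)$. $F$ is quasi$^i$-polynomial space if there are an oracle Turing machine $M$ and a second-order quasi$^i$-polynomial $P$ such that $M$ computes $F$ and, for all $\vec f,\vec x$, the running space $S_M(\vec f,\vec x)$ used by $M$ on input $\vec f,\vec x$ is bounded by $P(|f_1|,\dots,|f_k|,|x_1|,\dots,|x_l|)$. All tapes (including output and oracle tapes) are charged for space.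
   Formalization: Expansion is taken to allow dummy function and string arguments in any positions (injective renaming), since with F(f,g,x,y)=G(f,x) read literally no basic feasible functional depends on f_2, so F(f_1,f_2,x)=f_2(x) would refute the claim. -}

module Defs where

open import Data.Bool.Base using (Bool; true; false)
open import Data.Empty using (⊥)
open import Data.Fin.Base using (Fin)
open import Data.List.Base using (List; []; _∷_; _++_; _∷ʳ_; foldl; foldr; length; map; replicate)
open import Data.List.Extrema.Nat using (max)
open import Data.List.Properties using (foldl-∷ʳ)
open import Data.List.Reverse using (Reverse; reverseView; []; _∶_∶ʳ_)
open import Data.Nat.Base using (ℕ; zero; suc; _+_; _*_; _^_; _≤_)
open import Data.Nat.Binary.Base using (ℕᵇ; 2[1+_]; 1+[2_])
import Data.Nat.Binary.Base as ℕᵇ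
open import Data.Nat.Logarithm using (⌈log₂_⌉)
open import Data.Product.Base using (∃; _×_; _,_)
open import Data.Vec.Base as Vec using (Vec; []; _∷_)
open import Function.Bundles using (_↣_; Injection)
open import Relation.Binary.PropositionalEquality using (_≡_; refl; cong; trans)

Str : Set
Str = List Bool

-- In the enumeration λ, 0, 1, 00, 01, … the string w0 has number 2n+1 and
-- w1 has number 2n+2, where n is the number of w: this is the bijective
-- binary numeration of ℕᵇ, whose outermost constructor is the last bit.

snocBit : ℕᵇ → Bool → ℕᵇ
snocBit n false = 1+[2 n ]
snocBit n true  = 2[1+ n ]

toℕᵇ : Str → ℕᵇ
toℕᵇ = foldl snocBit ℕᵇ.zero

fromℕᵇ : ℕᵇ → Str
fromℕᵇ ℕᵇ.zero  = []
fromℕᵇ 1+[2 n ] = fromℕᵇ n ∷ʳ false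
fromℕᵇ 2[1+ n ] = fromℕᵇ n ∷ʳ true

toℕᵇ-fromℕᵇ : ∀ n → toℕᵇ (fromℕᵇ n) ≡ n
toℕᵇ-fromℕᵇ ℕᵇ.zero  = refl
toℕᵇ-fromℕᵇ 1+[2 n ] = trans (foldl-∷ʳ snocBit ℕᵇ.zero false (fromℕᵇ n)) (cong 1+[2_] (toℕᵇ-fromℕᵇ n))
toℕᵇ-fromℕᵇ 2[1+ n ] = trans (foldl-∷ʳ snocBit ℕᵇ.zero true (fromℕᵇ n)) (cong 2[1+_] (toℕᵇ-fromℕᵇ n))

fromℕᵇ-snocBit : ∀ n b → fromℕᵇ (snocBit n b) ≡ fromℕᵇ n ∷ʳ b
fromℕᵇ-snocBit n false = refl
fromℕᵇ-snocBit n true  = refl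

fromℕᵇ-toℕᵇ : ∀ w → fromℕᵇ (toℕᵇ w) ≡ w
fromℕᵇ-toℕᵇ w = go (reverseView w)
  where
  go : ∀ {w} → Reverse w → fromℕᵇ (toℕᵇ w) ≡ w
  go []             = refl
  go (w ∶ ws ∶ʳ b) =
    trans (cong fromℕᵇ (foldl-∷ʳ snocBit ℕᵇ.zero b w))
      (trans (fromℕᵇ-snocBit (toℕᵇ w) b) (cong (_∷ʳ b) (go ws)))

number : Str → ℕ
number w = ℕᵇ.toℕ (toℕᵇ w)

next : Str → Str
next w = fromℕᵇ (ℕᵇ.suc (toℕᵇ w))

infix 4 _≤ₛ_

_≤ₛ_ : Str → Str → Set
v ≤ₛ w = number v ≤ number w

StrFun : Set
StrFun = Str → Str

Functional : ℕ → ℕ → Set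
Functional k l = Vec StrFun k → Vec Str l → Str

Class : Set₁
Class = ∀ {k l} → Functional k l → Set

∅ : Class
∅ _ = ⊥

-- g₁(n) = 2^(2 log n) is the integer n², so it is taken exactly.  From g₂ on,
-- the argument log n is rounded up to an integer before g_{i-1} is applied.
-- At the points where log is undefined, ⌈log₂ 0 ⌉ = 0 fixes the value.

g : ℕ → ℕ → ℕ
g zero          n = 2 * n
g (suc zero)    n = n * n
g (suc (suc i)) n = 2 ^ g (suc i) ⌈log₂ n ⌉

data Symbol (marks : ℕ) : Set where
  blank : Symbol marks
  bit   : Bool → Symbol marks
  mark  : Fin marks → Symbol marks

data Move : Set where
  goLeft stay goRight : Move

-- A two-way infinite tape, restricted to the interval of cells that held the
-- initial word or have been scanned; `left` lists the nearest cell first.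
-- Cells are never dropped, so `cells` counts all the cells used so far.

record Tape (marks : ℕ) : Set where
  constructor ⟨_,_,_⟩
  field
    left  : List (Symbol marks)
    head  : Symbol marks
    right : List (Symbol marks)

module _ {marks : ℕ} where

  load : Str → Tape marks
  load []      = ⟨ [] , blank , [] ⟩
  load (b ∷ w) = ⟨ [] , bit b , map bit w ⟩

  bitPrefix : List (Symbol marks) → Str
  bitPrefix (bit b ∷ ss) = b ∷ bitPrefix ss
  bitPrefix _            = []

  -- The word on a tape starts at the head and extends rightwards up to the
  -- first cell that does not hold a bit.
  word : Tape marks → Str
  word ⟨ _ , h , rs ⟩ = bitPrefix (h ∷ rs)

  cells : Tape marks → ℕ
  cells ⟨ ls , _ , rs ⟩ = length ls + suc (length rs)

  moveHead : Move → Tape marks → Tape marks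
  moveHead goLeft  ⟨ []     , h , rs     ⟩ = ⟨ []     , blank , h ∷ rs ⟩
  moveHead goLeft  ⟨ l ∷ ls , h , rs     ⟩ = ⟨ ls     , l     , h ∷ rs ⟩
  moveHead stay    t                       = t
  moveHead goRight ⟨ ls     , h , []     ⟩ = ⟨ h ∷ ls , blank , []     ⟩
  moveHead goRight ⟨ ls     , h , r ∷ rs ⟩ = ⟨ h ∷ ls , r     , rs     ⟩

  writeMove : Symbol marks × Move → Tape marks → Tape marks
  writeMove (s , m) ⟨ ls , _ , rs ⟩ = moveHead m ⟨ ls , s , rs ⟩

-- One A for each tape of a machine with k oracles, l inputs and the given
-- number of work tapes.

record Tapes (k l works : ℕ) (A : Set) : Set where
  field
    inputs  : Vec A l
    output  : A
    queries : Vec A k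
    answers : Vec A k
    work    : Vec A works

module _ {k l works : ℕ} where

  mapTapes : {A B : Set} → (A → B) → Tapes k l works A → Tapes k l works B
  mapTapes f t = record
    { inputs  = Vec.map f inputs
    ; output  = f output
    ; queries = Vec.map f queries
    ; answers = Vec.map f answers
    ; work    = Vec.map f work
    } where open Tapes t

  zipTapes : {A B C : Set} → (A → B → C) → Tapes k l works A → Tapes k l works B → Tapes k l works C
  zipTapes f t u = record
    { inputs  = Vec.zipWith f T.inputs U.inputs
    ; output  = f T.output U.output
    ; queries = Vec.zipWith f T.queries U.queries
    ; answers = Vec.zipWith f T.answers U.answers
    ; work    = Vec.zipWith f T.work U.work
    } where
      module T = Tapes t
      module U = Tapes u

  totalTapes : Tapes k l works ℕ → ℕ
  totalTapes t = Vec.sum inputs + output + Vec.sum queries + Vec.sum answers + Vec.sum work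
    where open Tapes t

data Action (k l works marks states : ℕ) : Set where
  halt  : Action k l works marks states
  go    : Fin states → Tapes k l works (Symbol marks × Move) → Action k l works marks states
  query : Fin k → Fin states → Action k l works marks states

record OTM (k l : ℕ) : Set where
  field
    states works marks : ℕ
    start              : Fin states
    action             : Fin states → Tapes k l works (Symbol marks) → Action k l works marks states

module _ {k l : ℕ} (M : OTM k l) where
  open OTM M

  record Config : Set where
    constructor _▸_
    field
      state : Fin states
      tapes : Tapes k l works (Tape marks)
  open Config

  nextAction : Config → Action k l works marks states
  nextAction (q ▸ t) = action q (mapTapes Tape.head t)

  Halted : Config → Set
  Halted c = nextAction c ≡ halt

  result : Config → Str
  result c = word (Tapes.output (tapes c))

  space : Config → ℕ
  space c = totalTapes (mapTapes cells (tapes c))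

  initial : Vec Str l → Config
  initial xs = start ▸ record
    { inputs  = Vec.map load xs
    ; output  = load []
    ; queries = Vec.replicate k (load [])
    ; answers = Vec.replicate k (load [])
    ; work    = Vec.replicate works (load [])
    }

  -- A query to the j-th oracle replaces the contents of the j-th answer tape
  -- in a single step, leaving the query tape unchanged.
  ask : Vec StrFun k → Fin k → Tapes k l works (Tape marks) → Tapes k l works (Tape marks)
  ask fs j t = record t
    { answers = answers Vec.[ j ]≔ load (Vec.lookup fs j (word (Vec.lookup queries j))) }
    where open Tapes t

  perform : Vec StrFun k → Config → Action k l works marks states → Config
  perform fs c halt        = c
  perform fs c (go q ws)   = q ▸ zipTapes writeMove ws (tapes c)
  perform fs c (query j q) = q ▸ ask fs j (tapes c)

  configAt : Vec StrFun k → Vec Str l → ℕ → Config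
  configAt fs xs zero    = initial xs
  configAt fs xs (suc n) = perform fs c (nextAction c)
    where c = configAt fs xs n

  HaltsWithin : ℕ → Vec StrFun k → Vec Str l → Str → Set
  HaltsWithin T fs xs y =
    ∃ λ n → n ≤ T × Halted (configAt fs xs n) × result (configAt fs xs n) ≡ y

  Computes : Functional k l → Set
  Computes F = ∀ fs xs → ∃ λ T → HaltsWithin T fs xs (F fs xs)

  RunsInSpace : (Vec StrFun k → Vec Str l → ℕ) → Set
  RunsInSpace S = ∀ fs xs n → space (configAt fs xs n) ≤ S fs xs

evalPoly : List ℕ → ℕ → ℕ
evalPoly p n = foldr (λ c r → c + n * r) 0 p

PolyTime : ∀ {l} → Functional 0 l → Set
PolyTime {l} F = ∃ λ (M : OTM 0 l) → ∃ λ (p : List ℕ) → ∀ xs →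
  HaltsWithin M (evalPoly p (Vec.sum (Vec.map length xs))) [] xs (F [] xs)

unaryGrowth : ℕ → Functional 0 1
unaryGrowth i _ (x ∷ []) = replicate (g i (length x)) true

Ap : Functional 1 1
Ap (f ∷ []) (x ∷ []) = f x

select : ∀ {A : Set} {m n} → Fin m ↣ Fin n → Vec A n → Vec A m
select σ v = Vec.tabulate λ j → Vec.lookup v (Injection.to σ j)

-- In `expansion` the arguments of G may stand anywhere among those of F.  If
-- they had to come first, no member would depend on an oracle other than the
-- first, since Ap is the only initial functional with an oracle.

data BFSF (i : ℕ) (X : Class) : Class where

  member : ∀ {k l} {F : Functional k l} → X F → BFSF i X F

  polyTime : ∀ {l} {F : Functional 0 l} → PolyTime F → BFSF i X F

  growth : BFSF i X (unaryGrowth i)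

  application : BFSF i X Ap

  composition : ∀ {k l m} {F : Functional k l}
    (H : Functional k m) (Gs : Fin m → Functional k l) →
    BFSF i X H → (∀ j → BFSF i X (Gs j)) →
    (∀ fs xs → F fs xs ≡ H fs (Vec.tabulate λ j → Gs j fs xs)) →
    BFSF i X F

  expansion : ∀ {k k′ l l′} {F : Functional k′ l′}
    (G : Functional k l) (σ : Fin k ↣ Fin k′) (τ : Fin l ↣ Fin l′) →
    BFSF i X G →
    (∀ fs xs → F fs xs ≡ G (select σ fs) (select τ xs)) →
    BFSF i X F

  boundedRecursion : ∀ {k l} {F : Functional k (suc l)}
    (G : Functional k l) (H : Functional k (suc (suc l))) (K : Functional k (suc l)) →
    BFSF i X G → BFSF i X H → BFSF i X K →
    (∀ fs xs → F fs (xs Vec.∷ʳ []) ≡ G fs xs) →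
    (∀ fs xs n → F fs (xs Vec.∷ʳ next n) ≡ H fs (xs Vec.∷ʳ n Vec.∷ʳ F fs (xs Vec.∷ʳ n))) →
    (∀ fs xs n → F fs (xs Vec.∷ʳ n) ≤ₛ K fs (xs Vec.∷ʳ n)) →
    BFSF i X F

BasicFeasibleSpace : ℕ → Class
BasicFeasibleSpace i = BFSF i ∅

strings≤ : ℕ → List Str
strings≤ zero    = [] ∷ []
strings≤ (suc n) = [] ∷ map (false ∷_) (strings≤ n) ++ map (true ∷_) (strings≤ n)

funLength : StrFun → ℕ → ℕ
funLength f n = max 0 (map (λ w → length (f w)) (strings≤ n))

data QuasiPoly (k l : ℕ) : Set where
  const     : ℕ → QuasiPoly k l
  var       : Fin l → QuasiPoly k l
  _⊕_ _⊗_   : QuasiPoly k l → QuasiPoly k l → QuasiPoly k l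
  app       : Fin k → QuasiPoly k l → QuasiPoly k l
  grow      : QuasiPoly k l → QuasiPoly k l

eval : ∀ {k l} → ℕ → QuasiPoly k l → Vec (ℕ → ℕ) k → Vec ℕ l → ℕ
eval i (const c) Ls ns = c
eval i (var j)   Ls ns = Vec.lookup ns j
eval i (P ⊕ Q)   Ls ns = eval i P Ls ns + eval i Q Ls ns
eval i (P ⊗ Q)   Ls ns = eval i P Ls ns * eval i Q Ls ns
eval i (app j P) Ls ns = Vec.lookup Ls j (eval i P Ls ns)
eval i (grow P)  Ls ns = g i (eval i P Ls ns)

QuasiPolySpace : ℕ → Class
QuasiPolySpace i {k} {l} F = ∃ λ (M : OTM k l) → ∃ λ (P : QuasiPoly k l) →
  Computes M F ×
  RunsInSpace M (λ fs xs → eval i P (Vec.map funLength fs) (Vec.map length xs))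

-- Words are identified with their numbers, and both notions are compared with
-- an algebra Core of numerical functionals with bounded recursion on numbers,
-- whose only initial functions are zero, successor, projections, a function
-- pad majorizing sum and product, the growth function and application.
--
-- From machines to Core: a configuration of a machine in quasi-polynomial
-- space is a tuple of numbers below a bound that Core can compute (|f|(n) is
-- the length of f at the argument maximizing it, found by recursion bounded by
-- its own argument).  One step is a finite case distinction and arithmetic on
-- digits, and since a halting run does not need to repeat a configuration, it
-- suffices to iterate as often as there are codes.
--
-- From Core to machines: functionals are computed by structured programs over
-- registers, which are compiled to machines.  Bounded recursion is a loop with
-- two counters, whose registers stay short because the values are majorized.
--
-- A polynomial-time machine runs in polynomial space, so the first direction
-- also disposes of the polynomial-time initial functions; conversely those of
-- Core are computed by three small machines.

module Submission where

open import Defs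
open import Data.Bool.Base using (Bool; true; false; not)
open import Data.Empty using (⊥)
open import Data.Fin.Base as Fin using (Fin; zero; suc; toℕ; fromℕ<; _↑ˡ_; _↑ʳ_; splitAt)
open import Data.Fin.Properties as Finₚ using (toℕ-fromℕ<; toℕ<n; toℕ-injective; pigeonhole; splitAt-↑ˡ; splitAt-↑ʳ)
open import Data.List.Base as List using (List; []; _∷_; _++_; _∷ʳ_; length; map; replicate)
open import Data.List.Properties as Listₚ using (length-++; length-replicate; length-map; ++-assoc; ++-identityʳ)
open import Data.List.Extrema.Nat using (max; max≤v⁺; xs≤max)
open import Data.List.Membership.Propositional using (_∈_)
open import Data.List.Membership.Propositional.Properties using (∈-map⁺; ∈-++⁺ˡ; ∈-++⁺ʳ)
open import Data.List.Relation.Unary.Any as Any using (here; there)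
open import Data.List.Relation.Unary.Any.Properties using (lookup-index)
open import Data.List.Relation.Unary.All as All using (All; []; _∷_)
import Data.List.Relation.Unary.All.Properties as Allₚ
open import Data.List.Reverse using (Reverse; reverseView; []; _∶_∶ʳ_)
open import Data.Maybe.Base using (Maybe; just; nothing)
open import Data.Nat.Base
open import Data.Nat.Properties
import Data.Nat.Binary.Base as ℕᵇ
import Data.Nat.Binary.Properties as ℕᵇₚ
open import Data.Nat.Induction using (<-wellFounded)
open import Data.Nat.Logarithm using (⌈log₂_⌉; ⌈log₂⌉-mono-≤; ⌈log₂2^n⌉≡n; ⌈log₂⌈n/2⌉⌉≡⌈log₂n⌉∸1)
open import Data.Nat.Tactic.RingSolver using (solve-∀)
open import Data.Product.Base using (∃; _×_; _,_; proj₁; proj₂)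
open import Data.Sum.Base using (_⊎_; inj₁; inj₂; [_,_]′)
open import Data.Unit.Base using (⊤; tt)
open import Data.Vec.Base as Vec using (Vec; []; _∷_; lookup; tabulate)
open import Data.Vec.Properties as Vecₚ using (lookup∘tabulate; tabulate∘lookup; tabulate-cong; lookup-map; lookup-zipWith; lookup-replicate)
open import Function.Base using (_∘_; id)
open import Function.Bundles using (_⇔_; mk⇔; _↣_; mk↣; Injection)
open import Induction.WellFounded using (Acc; acc)
open import Relation.Binary.PropositionalEquality
open import Relation.Nullary using (Dec; yes; no; contradiction)

-- Words and numbers

-- Numbers and lengths play different roles. The number of a word is about 2 to its length, so space
-- is compared with lengths, and recursion on numbers supplies the exponentially many rounds that a
-- run in bounded space may take. Iterating `pad` yields only linear functions of lengths; products
-- of lengths come from the growth function, which dominates squares because i is positive. The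
-- constructor `recur` demands a majorant valid for all oracles and arguments. Simulations are
-- therefore cut off at their bound in every round, so that the majorant holds by construction; the
-- space bound of the machine then shows that the cut never takes effect. In the other direction the
-- growth function is the obstacle: its program needs logarithms and concatenation in unary, which
-- should come from the very translation that is being built. Hence the index of `Core`: the
-- growth-free part is translated before, and supplies these ingredients.

bitℕ : Bool → ℕ
bitℕ false = 0
bitℕ true  = 1

bitℕ≤1 : ∀ b → bitℕ b ≤ 1
bitℕ≤1 false = z≤n
bitℕ≤1 true  = s≤s z≤n

abstract

  num : Str → ℕ
  num = number

  str : ℕ → Str
  str n = fromℕᵇ (ℕᵇ.fromℕ n)

  num-str : ∀ n → num (str n) ≡ n
  num-str n = trans (cong ℕᵇ.toℕ (toℕᵇ-fromℕᵇ (ℕᵇ.fromℕ n))) (ℕᵇₚ.toℕ-fromℕ n)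

  str-num : ∀ w → str (num w) ≡ w
  str-num w = trans (cong fromℕᵇ (ℕᵇₚ.fromℕ-toℕ (toℕᵇ w))) (fromℕᵇ-toℕᵇ w)

  num≡number : ∀ w → num w ≡ number w
  num≡number w = refl

  num-[] : num [] ≡ 0
  num-[] = refl

  num-next : ∀ w → num (next w) ≡ suc (num w)
  num-next w = trans (cong ℕᵇ.toℕ (toℕᵇ-fromℕᵇ (ℕᵇ.suc (toℕᵇ w)))) (ℕᵇₚ.toℕ-suc (toℕᵇ w))

  num-∷ʳ : ∀ w b → num (w ∷ʳ b) ≡ suc (bitℕ b + 2 * num w)
  num-∷ʳ w b = trans (cong ℕᵇ.toℕ (Listₚ.foldl-∷ʳ snocBit ℕᵇ.zero b w)) (aux b)
    where
    aux : ∀ b → ℕᵇ.toℕ (snocBit (toℕᵇ w) b) ≡ suc (bitℕ b + 2 * num w)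
    aux false = refl
    aux true  = lem (num w)
      where
      lem : ∀ n → 2 * suc n ≡ suc (suc (2 * n))
      lem = solve-∀

num-injective : ∀ {v w} → num v ≡ num w → v ≡ w
num-injective {v} {w} eq = trans (sym (str-num v)) (trans (cong str eq) (str-num w))

next-str : ∀ n → next (str n) ≡ str (suc n)
next-str n = num-injective (trans (num-next (str n)) (trans (cong suc (num-str n)) (sym (num-str (suc n)))))

length-∷ʳ : ∀ {A : Set} (w : List A) b → length (w ∷ʳ b) ≡ suc (length w)
length-∷ʳ w b = trans (length-++ w) (+-comm (length w) 1)

len : ℕ → ℕ
len n = length (str n)

-- In bijective numeration the words of length n carry the numbers from 2^n - 1 to 2^(n+1) - 2. This
-- lemma and the next are the two ends of that range.
2^length≤num : ∀ w → 2 ^ length w ≤ suc (num w)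
2^length≤num w = aux (reverseView w)
  where
  aux : ∀ {w} → Reverse w → 2 ^ length w ≤ suc (num w)
  aux [] = subst (λ n → 1 ≤ suc n) (sym num-[]) ≤-refl
  aux (w ∶ r ∶ʳ b) = begin
    2 ^ length (w ∷ʳ b)            ≡⟨ cong (2 ^_) (length-∷ʳ w b) ⟩
    2 * 2 ^ length w               ≤⟨ *-monoʳ-≤ 2 (aux r) ⟩
    2 * suc (num w)                ≡⟨ *-suc 2 (num w) ⟩
    2 + 2 * num w                  ≤⟨ s≤s (s≤s (m≤n+m (2 * num w) (bitℕ b))) ⟩
    suc (suc (bitℕ b + 2 * num w)) ≡⟨ cong suc (sym (num-∷ʳ w b)) ⟩
    suc (num (w ∷ʳ b))             ∎
    where open ≤-Reasoning

num<2^length : ∀ w → 2 + num w ≤ 2 ^ suc (length w)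
num<2^length w = aux (reverseView w)
  where
  lem : ∀ n → 3 + (1 + 2 * n) ≡ 2 * (2 + n)
  lem = solve-∀
  aux : ∀ {w} → Reverse w → 2 + num w ≤ 2 ^ suc (length w)
  aux [] = ≤-reflexive (cong (2 +_) num-[])
  aux (w ∶ r ∶ʳ b) = begin
    2 + num (w ∷ʳ b)                ≡⟨ cong (2 +_) (num-∷ʳ w b) ⟩
    3 + (bitℕ b + 2 * num w)        ≤⟨ +-monoʳ-≤ 3 (+-monoˡ-≤ _ (bitℕ≤1 b)) ⟩
    3 + (1 + 2 * num w)             ≡⟨ lem (num w) ⟩
    2 * (2 + num w)                 ≤⟨ *-monoʳ-≤ 2 (aux r) ⟩
    2 * 2 ^ suc (length w)          ≡⟨ cong (λ n → 2 ^ suc n) (sym (length-∷ʳ w b)) ⟩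
    2 ^ suc (length (w ∷ʳ b))       ∎
    where open ≤-Reasoning

2^-cancel-< : ∀ {m n} → 2 ^ m < 2 ^ n → m < n
2^-cancel-< {m} {n} p = ≰⇒> λ n≤m → <⇒≱ p (^-monoʳ-≤ 2 n≤m)

length-mono : ∀ {v w} → num v ≤ num w → length v ≤ length w
length-mono {v} {w} p = s≤s⁻¹ (2^-cancel-< (begin-strict
  2 ^ length v       ≤⟨ 2^length≤num v ⟩
  suc (num v)        <⟨ s≤s (s≤s p) ⟩
  2 + num w          ≤⟨ num<2^length w ⟩
  2 ^ suc (length w) ∎))
  where open ≤-Reasoning

len-mono : ∀ {m n} → m ≤ n → len m ≤ len n
len-mono {m} {n} p = length-mono {str m} {str n} (subst₂ _≤_ (sym (num-str m)) (sym (num-str n)) p)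

2^len≤ : ∀ n → 2 ^ len n ≤ suc n
2^len≤ n = subst (λ m → 2 ^ len n ≤ suc m) (num-str n) (2^length≤num (str n))

<2^len : ∀ n → 2 + n ≤ 2 ^ suc (len n)
<2^len n = subst (λ m → 2 + m ≤ 2 ^ suc (len n)) (num-str n) (num<2^length (str n))

length<⇒num≤ : ∀ w n → length w < len n → num w ≤ n
length<⇒num≤ w n p = s≤s⁻¹ (begin
  suc (num w)        ≤⟨ n≤1+n _ ⟩
  2 + num w          ≤⟨ num<2^length w ⟩
  2 ^ suc (length w) ≤⟨ ^-monoʳ-≤ 2 p ⟩
  2 ^ len n          ≤⟨ 2^len≤ n ⟩
  suc n              ∎)
  where open ≤-Reasoning

ones : ℕ → Str
ones n = replicate n true

-- A word of ones has the greatest number among the words of its length. The extra letter is for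
-- products: the number 6 has length 2, and four ones carry only the number 30, less than 6 * 6.
padS : Str → Str → Str
padS v w = ones (suc (length v + length w))

pad : ℕ → ℕ → ℕ
pad m n = num (padS (str m) (str n))

len-num-ones : ∀ n → len (num (ones n)) ≡ n
len-num-ones n = trans (cong length (str-num (ones n))) (length-replicate n)

len-pad : ∀ m n → len (pad m n) ≡ suc (len m + len n)
len-pad m n = len-num-ones _

ones-∷ʳ : ∀ n → ones n ∷ʳ true ≡ ones (suc n)
ones-∷ʳ zero    = refl
ones-∷ʳ (suc n) = cong (true ∷_) (ones-∷ʳ n)

num-ones : ∀ n → 2 ^ suc n ≡ 2 + num (ones n)
num-ones zero    = cong (2 +_) (sym num-[])
num-ones (suc n) = begin
  2 * 2 ^ suc n            ≡⟨ cong (2 *_) (num-ones n) ⟩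
  2 * (2 + num (ones n))   ≡⟨ lem (num (ones n)) ⟩
  3 + (1 + 2 * num (ones n)) ≡⟨ cong (2 +_) (sym (num-∷ʳ (ones n) true)) ⟩
  2 + num (ones n ∷ʳ true) ≡⟨ cong (λ w → 2 + num w) (ones-∷ʳ n) ⟩
  2 + num (ones (suc n))   ∎
  where
  open ≡-Reasoning
  lem : ∀ n → 2 * (2 + n) ≡ 3 + (1 + 2 * n)
  lem = solve-∀

-- (m + 2)(n + 2) ≤ 2^{|m|+1} 2^{|n|+1} = pad m n + 2
*≤pad : ∀ m n → (2 + m) * (2 + n) ≤ 2 + pad m n
*≤pad m n = begin
  (2 + m) * (2 + n)                     ≤⟨ *-mono-≤ (<2^len m) (<2^len n) ⟩
  2 ^ suc (len m) * 2 ^ suc (len n)     ≡⟨ sym (^-distribˡ-+-* 2 (suc (len m)) (suc (len n))) ⟩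
  2 ^ (suc (len m) + suc (len n))       ≡⟨ cong (λ a → 2 ^ suc a) (+-suc (len m) (len n)) ⟩
  2 ^ suc (suc (len m + len n))         ≡⟨ num-ones (suc (len m + len n)) ⟩
  2 + pad m n                           ∎
  where open ≤-Reasoning

m*n≤pad : ∀ m n → m * n ≤ pad m n
m*n≤pad m n = +-cancelˡ-≤ 2 _ _ (≤-trans (subst (2 + m * n ≤_) (sym (lem m n)) (s≤s (s≤s (≤-trans (m≤m+n (m * n) _) (m≤n+m _ 2))))) (*≤pad m n))
  where
  lem : ∀ m n → (2 + m) * (2 + n) ≡ 2 + (2 + (m * n + 2 * (m + n)))
  lem = solve-∀

m+n≤pad : ∀ m n → m + n ≤ pad m n
m+n≤pad m n = +-cancelˡ-≤ 2 _ _ (≤-trans (subst (2 + (m + n) ≤_) (sym (lem m n)) (s≤s (s≤s (m≤m+n _ _)))) (*≤pad m n))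
  where
  lem : ∀ m n → (2 + m) * (2 + n) ≡ 2 + ((m + n) + (2 + m * n + (m + n)))
  lem = solve-∀

m≤pad : ∀ m n → m ≤ pad m n
m≤pad m n = ≤-trans (m≤m+n m n) (m+n≤pad m n)

n≤pad : ∀ m n → n ≤ pad m n
n≤pad m n = ≤-trans (m≤n+m n m) (m+n≤pad m n)

-- Functionals on numbers

Fn : ℕ → ℕ → Set
Fn k l = Vec StrFun k → Vec ℕ l → ℕ

rec : ℕ → (ℕ → ℕ → ℕ) → ℕ → ℕ
rec z s zero    = z
rec z s (suc n) = s n (rec z s n)

growN : ℕ → ℕ → ℕ
growN i n = num (ones (g i (len n)))

apN : StrFun → ℕ → ℕ
apN f n = num (f (str n))

-- The growth function is available only if the index names its exponent.

data Core (i : Maybe ℕ) (k : ℕ) : ∀ {l} → Fn k l → Set where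
  zeroC : Core i k {0} (λ fs ns → 0)
  sucC  : Core i k {1} (λ fs ns → suc (lookup ns zero))
  padC  : Core i k {2} (λ fs ns → pad (lookup ns zero) (lookup ns (suc zero)))
  growC : ∀ {n} → i ≡ just n → Core i k {1} (λ fs ns → growN n (lookup ns zero))
  apC   : ∀ j → Core i k {1} (λ fs ns → apN (lookup fs j) (lookup ns zero))
  proj  : ∀ {l} (j : Fin l) → Core i k (λ fs ns → lookup ns j)
  comp  : ∀ {l m} {H : Fn k m} {Gs : Fin m → Fn k l} → Core i k H → (∀ j → Core i k (Gs j)) →
          Core i k (λ fs ns → H fs (tabulate λ j → Gs j fs ns))
  recur : ∀ {l} {G : Fn k l} {H : Fn k (2 + l)} {K : Fn k (suc l)} →
          Core i k G → Core i k H → Core i k K →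
          (∀ fs n ns → rec (G fs ns) (λ m a → H fs (m ∷ a ∷ ns)) n ≤ K fs (n ∷ ns)) →
          Core i k (λ fs ns → rec (G fs (Vec.tail ns)) (λ m a → H fs (m ∷ a ∷ Vec.tail ns)) (Vec.head ns))
  ext   : ∀ {l} {F G : Fn k l} → (∀ fs ns → F fs ns ≡ G fs ns) → Core i k G → Core i k F

-- Conditionals, inverses of increasing functions, and pairing

if0 : ℕ → ℕ → ℕ → ℕ
if0 zero    y z = y
if0 (suc _) y z = z

if0-≤ : ∀ {m n} → m ≤ n → ∀ y z → if0 (m ∸ n) y z ≡ y
if0-≤ p y z = cong (λ d → if0 d y z) (m≤n⇒m∸n≡0 p)

if0-> : ∀ {m n} → n < m → ∀ y z → if0 (m ∸ n) y z ≡ z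
if0-> {m} {n} p y z with m ∸ n | m<n⇒0<n∸m p
... | suc _ | _ = refl

-- The step of a search for the greatest r with φ r ≤ n. If φ is strictly increasing, raising n by
-- one raises r by at most one, so one comparison per round suffices; and as r ≤ n, the argument is
-- a majorant. Roots, halves and the removal of digits are all instances.
invStep : (ℕ → ℕ) → ℕ → ℕ → ℕ
invStep φ m r = if0 (φ (suc r) ∸ suc m) (suc r) r

inv : (ℕ → ℕ) → ℕ → ℕ
inv φ = rec 0 (invStep φ)

if0-rec : ∀ n y z → rec y (λ _ _ → z) n ≡ if0 n y z
if0-rec zero    y z = refl
if0-rec (suc n) y z = refl

inv≤ : ∀ φ n → inv φ n ≤ n
inv≤ φ zero    = ≤-refl
inv≤ φ (suc n) with φ (suc (inv φ n)) ∸ suc n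
... | zero  = s≤s (inv≤ φ n)
... | suc _ = m≤n⇒m≤1+n (inv≤ φ n)

module _ {φ : ℕ → ℕ} (φ0 : φ 0 ≡ 0) (φ< : ∀ r → φ r < φ (suc r)) where

  φ-mono : ∀ {r s} → r ≤ s → φ r ≤ φ s
  φ-mono {r} p = mono (≤⇒≤′ p)
    where
    mono : ∀ {s} → r ≤′ s → φ r ≤ φ s
    mono ≤′-refl     = ≤-refl
    mono (≤′-step q) = ≤-trans (mono q) (<⇒≤ (φ< _))

  inv-spec : ∀ n → φ (inv φ n) ≤ n × n < φ (suc (inv φ n))
  inv-spec zero    = ≤-reflexive φ0 , ≤-trans (s≤s z≤n) (φ< 0)
  inv-spec (suc n) with inv-spec n | φ (suc (inv φ n)) ≤? suc n
  ... | lo , hi | yes p = subst (λ r → φ r ≤ suc n × suc n < φ (suc r)) (sym (if0-≤ p _ _))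
                            (p , ≤-trans (s≤s hi) (φ< _))
  ... | lo , hi | no ¬p = subst (λ r → φ r ≤ suc n × suc n < φ (suc r)) (sym (if0-> (≰⇒> ¬p) _ _))
                            (m≤n⇒m≤1+n lo , ≰⇒> ¬p)

  inv-unique : ∀ {n r} → φ r ≤ n → n < φ (suc r) → inv φ n ≡ r
  inv-unique {n} {r} lo hi with inv-spec n
  ... | lo′ , hi′ = ≤-antisym (s≤s⁻¹ (≰⇒> λ p → <⇒≱ hi (≤-trans (φ-mono p) lo′)))
                              (s≤s⁻¹ (≰⇒> λ p → <⇒≱ hi′ (≤-trans (φ-mono p) lo)))

root : ℕ → ℕ
root = inv (λ r → r * r)

-- As x ≤ x + y, the value lies between the square of x + y and the next square, so an integer root
-- recovers the sum. The code is monotone in both components, which turns bounds on components into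
-- bounds on codes.
pr : ℕ → ℕ → ℕ
pr x y = (x + y) * (x + y) + x

π₁ π₂ : ℕ → ℕ
π₁ z = z ∸ root z * root z
π₂ z = root z ∸ π₁ z

square< : ∀ r → r * r < suc r * suc r
square< r = s≤s (≤-trans (*-monoʳ-≤ r (n≤1+n r)) (m≤n+m (r * suc r) r))

root-pr : ∀ x y → root (pr x y) ≡ x + y
root-pr x y = inv-unique refl square< (m≤m+n _ x) (s≤s (begin
  (x + y) * (x + y) + x               ≤⟨ +-monoʳ-≤ _ (m≤m+n x y) ⟩
  (x + y) * (x + y) + (x + y)         ≡⟨ +-comm _ (x + y) ⟩
  (x + y) + (x + y) * (x + y)         ≡⟨ sym (*-suc (x + y) (x + y)) ⟩
  (x + y) * suc (x + y)               ≤⟨ m≤n+m _ (x + y) ⟩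
  x + y + (x + y) * suc (x + y)       ∎))
  where open ≤-Reasoning

π₁-pr : ∀ x y → π₁ (pr x y) ≡ x
π₁-pr x y = trans (cong (λ r → pr x y ∸ r * r) (root-pr x y)) (m+n∸m≡n ((x + y) * (x + y)) x)

π₂-pr : ∀ x y → π₂ (pr x y) ≡ y
π₂-pr x y = trans (cong₂ _∸_ (root-pr x y) (π₁-pr x y)) (m+n∸m≡n x y)

pr-mono : ∀ {x x′ y y′} → x ≤ x′ → y ≤ y′ → pr x y ≤ pr x′ y′
pr-mono p q = +-mono-≤ (*-mono-≤ (+-mono-≤ p q) (+-mono-≤ p q)) p

encVec : ∀ {d} → Vec ℕ d → ℕ
encVec []      = 0
encVec (x ∷ v) = pr x (encVec v)

dec : ∀ {d} → Fin d → ℕ → ℕ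
dec zero    z = π₁ z
dec (suc j) z = dec j (π₂ z)

dec-encVec : ∀ {d} (v : Vec ℕ d) j → dec j (encVec v) ≡ lookup v j
dec-encVec (x ∷ v) zero    = π₁-pr x (encVec v)
dec-encVec (x ∷ v) (suc j) = trans (cong (dec j) (π₂-pr x (encVec v))) (dec-encVec v j)

decVec : ∀ {d} → ℕ → Vec ℕ d
decVec z = tabulate (λ j → dec j z)

decVec-encVec : ∀ {d} (v : Vec ℕ d) → decVec (encVec v) ≡ v
decVec-encVec v = trans (tabulate-cong (dec-encVec v)) (tabulate∘lookup v)

encVec-mono : ∀ {d} (v w : Vec ℕ d) → (∀ j → lookup v j ≤ lookup w j) → encVec v ≤ encVec w
encVec-mono []      []      p = ≤-refl
encVec-mono (x ∷ v) (y ∷ w) p = pr-mono (p zero) (encVec-mono v w (p ∘ suc))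

at : ∀ {m} → ℕ → (Fin m → ℕ) → ℕ → ℕ
at {zero}  d h n       = d
at {suc m} d h zero    = h zero
at {suc m} d h (suc n) = at d (h ∘ suc) n

at-toℕ : ∀ {m} d (h : Fin m → ℕ) j → at d h (toℕ j) ≡ h j
at-toℕ d h zero    = refl
at-toℕ d h (suc j) = at-toℕ d (h ∘ suc) j

at-suc : ∀ {m} d (h : Fin (suc m) → ℕ) n → at d h n ≡ if0 n (h zero) (at d (h ∘ suc) (pred n))
at-suc d h zero    = refl
at-suc d h (suc n) = refl

-- A finite function, such as a transition table, extended to all tuples of numbers with the default
-- 0. It is a case distinction of fixed depth, hence in `Core` whatever `h` is.
table : ∀ {β n} → (Vec (Fin β) n → ℕ) → Vec ℕ n → ℕ
table h []       = h []
table h (x ∷ xs) = at 0 (λ d → table (λ ds → h (d ∷ ds)) xs) x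

table-toℕ : ∀ {β n} (h : Vec (Fin β) n → ℕ) ds → table h (Vec.map toℕ ds) ≡ h ds
table-toℕ h []       = refl
table-toℕ h (d ∷ ds) = trans (at-toℕ 0 (λ d → table (λ ds → h (d ∷ ds)) (Vec.map toℕ ds)) d) (table-toℕ (λ ds → h (d ∷ ds)) ds)

-- Arithmetic, coding and case distinction in Core

module _ {i : Maybe ℕ} {k : ℕ} where

  private
    C : ∀ {l} → Fn k l → Set
    C = Core i k

  app₁ : ∀ {l} {h : Fn k 1} {f : Fn k l} → C h → C f → C (λ fs ns → h fs (f fs ns ∷ []))
  app₁ {f = f} h p = comp {Gs = λ _ → f} h (λ _ → p)

  app₂ : ∀ {l} {h : Fn k 2} {f₁ f₂ : Fn k l} → C h → C f₁ → C f₂ → C (λ fs ns → h fs (f₁ fs ns ∷ f₂ fs ns ∷ []))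
  app₂ {f₁ = f₁} {f₂} h p q = comp {Gs = lookup (f₁ ∷ f₂ ∷ [])} h λ { zero → p ; (suc zero) → q }

  consC : ∀ {l m} {n : Fn k l} {Gs : Fin m → Fn k l} {H : Fn k (suc m)} → C H → C n → (∀ j → C (Gs j)) →
          C (λ fs ns → H fs (n fs ns ∷ tabulate (λ j → Gs j fs ns)))
  consC {l} {m} {n} {Gs} h p q = comp {Gs = Gs′} h λ { zero → p ; (suc j) → q j }
    where
    Gs′ : Fin (suc m) → Fn k l
    Gs′ zero    = n
    Gs′ (suc j) = Gs j

  rename : ∀ {l m} {f : Fn k l} (ρ : Fin l → Fin m) → C f → C (λ fs ns → f fs (tabulate λ j → lookup ns (ρ j)))
  rename ρ p = comp p (λ j → proj (ρ j))

  drop₁ : ∀ {l} {f : Fn k l} → C f → C (λ fs (ns : Vec ℕ (suc l)) → f fs (Vec.tail ns))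
  drop₁ {f = f} p = ext (λ { fs (n ∷ ns) → cong (f fs) (sym (tabulate∘lookup ns)) }) (rename suc p)

  drop₂ : ∀ {l} {f : Fn k l} → C f → C (λ fs (ns : Vec ℕ (2 + l)) → f fs (Vec.tail (Vec.tail ns)))
  drop₂ p = drop₁ (drop₁ p)

  sucC₁ : ∀ {l} {f : Fn k l} → C f → C (λ fs ns → suc (f fs ns))
  sucC₁ p = app₁ sucC p

  padC₂ : ∀ {l} {f₁ f₂ : Fn k l} → C f₁ → C f₂ → C (λ fs ns → pad (f₁ fs ns) (f₂ fs ns))
  padC₂ p q = app₂ padC p q

  growC₁ : ∀ {l n} {f : Fn k l} → i ≡ just n → C f → C (λ fs ns → growN n (f fs ns))
  growC₁ e p = app₁ (growC e) p

  apC₁ : ∀ {l} j {f : Fn k l} → C f → C (λ fs ns → apN (lookup fs j) (f fs ns))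
  apC₁ j p = app₁ (apC j) p

  constC : ∀ {l} c → C {l} (λ fs ns → c)
  constC zero    = comp {Gs = λ ()} zeroC λ ()
  constC (suc c) = sucC₁ (constC c)

  recC : ∀ {l} {G n : Fn k l} {H : Fn k (2 + l)} {K : Fn k (suc l)} → C G → C H → C K →
         (∀ fs n ns → rec (G fs ns) (λ m a → H fs (m ∷ a ∷ ns)) n ≤ K fs (n ∷ ns)) → C n →
         C (λ fs ns → rec (G fs ns) (λ m a → H fs (m ∷ a ∷ ns)) (n fs ns))
  recC {G = G} {n} {H} p q r b s =
    ext (λ fs ns → cong (λ v → rec (G fs v) (λ m a → H fs (m ∷ a ∷ v)) (n fs ns)) (sym (tabulate∘lookup ns)))
      (consC {Gs = λ j fs ns → lookup ns j} (recur p q r b) s proj)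

  predC : ∀ {l} {f : Fn k l} → C f → C (λ fs ns → pred (f fs ns))
  predC {f = f} p = ext (λ fs ns → lem (f fs ns))
      (recC (constC 0) (proj zero) (proj zero) (λ fs n ns → bound n) p)
    where
    lem : ∀ n → pred n ≡ rec 0 (λ m a → m) n
    lem zero    = refl
    lem (suc n) = refl
    bound : ∀ n → rec 0 (λ m a → m) n ≤ n
    bound zero    = ≤-refl
    bound (suc n) = n≤1+n n

  ∸C : ∀ {l} {f h : Fn k l} → C f → C h → C (λ fs ns → f fs ns ∸ h fs ns)
  ∸C {f = f} {h} p q = ext (λ fs ns → lem (f fs ns) (h fs ns))
      (recC p (predC (proj (suc zero))) (drop₁ p)
        (λ fs n ns → subst (_≤ f fs ns) (lem (f fs ns) n) (m∸n≤m (f fs ns) n)) q)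
    where
    lem : ∀ m n → m ∸ n ≡ rec m (λ _ a → pred a) n
    lem m zero    = refl
    lem m (suc n) = trans (sym (pred[m∸n]≡m∸[1+n] m n)) (cong pred (lem m n))

  if0C : ∀ {l} {n f h : Fn k l} → C n → C f → C h → C (λ fs ns → if0 (n fs ns) (f fs ns) (h fs ns))
  if0C {n = n} {f} {h} r p q = ext (λ fs ns → sym (if0-rec (n fs ns) _ _))
      (recC p (drop₂ q) (drop₁ (padC₂ p q)) (λ fs n ns → bound (f fs ns) (h fs ns) n) r)
    where
    bound : ∀ x y n → rec x (λ _ _ → y) n ≤ pad x y
    bound x y zero    = m≤pad x y
    bound x y (suc n) = n≤pad x y

  +C : ∀ {l} {f h : Fn k l} → C f → C h → C (λ fs ns → f fs ns + h fs ns)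
  +C {f = f} {h} p q = ext (λ fs ns → lem (f fs ns) (h fs ns))
      (recC p (sucC₁ (proj (suc zero))) (padC₂ (drop₁ p) (proj zero))
        (λ fs n ns → subst (_≤ pad (f fs ns) n) (lem (f fs ns) n) (m+n≤pad (f fs ns) n)) q)
    where
    lem : ∀ m n → m + n ≡ rec m (λ _ a → suc a) n
    lem m zero    = +-identityʳ m
    lem m (suc n) = trans (+-suc m n) (cong suc (lem m n))

  *C : ∀ {l} {f h : Fn k l} → C f → C h → C (λ fs ns → f fs ns * h fs ns)
  *C {f = f} {h} p q = ext (λ fs ns → lem (f fs ns) (h fs ns))
      (recC (constC 0) (+C (drop₂ p) (proj (suc zero))) (padC₂ (drop₁ p) (proj zero))
        (λ fs n ns → subst (_≤ pad (f fs ns) n) (lem (f fs ns) n) (m*n≤pad (f fs ns) n)) q)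
    where
    lem : ∀ m n → m * n ≡ rec 0 (λ _ a → m + a) n
    lem m zero    = *-zeroʳ m
    lem m (suc n) = trans (*-suc m n) (cong (m +_) (lem m n))

  ^C : ∀ {l} {f : Fn k l} → C f → ∀ n → C (λ fs ns → f fs ns ^ n)
  ^C p zero    = constC 1
  ^C p (suc n) = *C p (^C p n)

  ⊓C : ∀ {l} {f h : Fn k l} → C f → C h → C (λ fs ns → f fs ns ⊓ h fs ns)
  ⊓C {f = f} {h} p q = ext (λ fs ns → lem (f fs ns) (h fs ns)) (∸C p (∸C p q))
    where
    lem : ∀ m n → m ⊓ n ≡ m ∸ (m ∸ n)
    lem m n with ≤-total m n
    ... | inj₁ m≤n = trans (m≤n⇒m⊓n≡m m≤n) (cong (m ∸_) (sym (m≤n⇒m∸n≡0 m≤n)))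
    ... | inj₂ n≤m = trans (m≥n⇒m⊓n≡n n≤m) (sym (m∸[m∸n]≡n n≤m))

  invC : ∀ {l} {φ : ℕ → ℕ} {f : Fn k l} → (∀ {l} {h : Fn k l} → C h → C (λ fs ns → φ (h fs ns))) →
         C f → C (λ fs ns → inv φ (f fs ns))
  invC {φ = φ} Φ p = recC (constC 0)
    (if0C (∸C (Φ (sucC₁ (proj (suc zero)))) (sucC₁ (proj zero))) (sucC₁ (proj (suc zero))) (proj (suc zero)))
    (proj zero) (λ fs n ns → inv≤ φ n) p

  rootC : ∀ {l} {f : Fn k l} → C f → C (λ fs ns → root (f fs ns))
  rootC = invC {φ = λ r → r * r} (λ p → *C p p)

  prC : ∀ {l} {f h : Fn k l} → C f → C h → C (λ fs ns → pr (f fs ns) (h fs ns))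
  prC p q = +C (*C (+C p q) (+C p q)) p

  π₁C : ∀ {l} {f : Fn k l} → C f → C (λ fs ns → π₁ (f fs ns))
  π₁C p = ∸C p (*C (rootC p) (rootC p))

  π₂C : ∀ {l} {f : Fn k l} → C f → C (λ fs ns → π₂ (f fs ns))
  π₂C p = ∸C (rootC p) (π₁C p)

  encVecC : ∀ {l d} {f : Fin d → Fn k l} → (∀ j → C (f j)) → C (λ fs ns → encVec (tabulate λ j → f j fs ns))
  encVecC {d = zero}  p = constC 0
  encVecC {d = suc d} p = prC (p zero) (encVecC (p ∘ suc))

  decC : ∀ {l d} (j : Fin d) {f : Fn k l} → C f → C (λ fs ns → dec j (f fs ns))
  decC zero    p = π₁C p
  decC (suc j) p = decC j (π₂C p)

  atC : ∀ {l m} {d t : Fn k l} {f : Fin m → Fn k l} → C d → C t → (∀ j → C (f j)) →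
        C (λ fs ns → at (d fs ns) (λ j → f j fs ns) (t fs ns))
  atC {m = zero}  p r q = p
  atC {m = suc m} {d} {t} {f} p r q = ext (λ fs ns → at-suc (d fs ns) (λ j → f j fs ns) (t fs ns))
    (if0C r (q zero) (atC p (predC r) (q ∘ suc)))

  tableC : ∀ {l β n} (h : Vec (Fin β) n → ℕ) {x : Fin n → Fn k l} → (∀ j → C (x j)) →
           C (λ fs ns → table h (tabulate λ j → x j fs ns))
  tableC {n = zero}  h p = constC (h [])
  tableC {n = suc n} h p = atC (constC 0) (p zero) (λ d → tableC (λ ds → h (d ∷ ds)) (p ∘ suc))

-- Simultaneous recursion, cut off at `b` in every round and component. The cut makes the bound
-- `encVec-run≤` unconditional, as `recur` requires; `run-exact` removes it along any trajectory
-- that never exceeds `b`.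
run : ∀ {d} → ℕ → (Fin d → ℕ) → (Fin d → Vec ℕ d → ℕ) → ℕ → Vec ℕ d
run b z s zero    = tabulate λ j → z j ⊓ b
run b z s (suc t) = tabulate λ j → s j (run b z s t) ⊓ b

run-exact : ∀ {d} {b} {z : Fin d → ℕ} {s : Fin d → Vec ℕ d → ℕ} (u : ℕ → Vec ℕ d) →
            (∀ j → z j ≡ lookup (u 0) j) → (∀ t j → s j (u t) ≡ lookup (u (suc t)) j) →
            (∀ t j → lookup (u t) j ≤ b) → ∀ t → run b z s t ≡ u t
run-exact u p q r zero    = trans (tabulate-cong λ j → trans (cong (_⊓ _) (p j)) (m≤n⇒m⊓n≡m (r 0 j))) (tabulate∘lookup (u 0))
run-exact {b = b} {s = s} u p q r (suc t) = trans (tabulate-cong λ j →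
    trans (cong (_⊓ _) (trans (cong (s j) (run-exact u p q r t)) (q t j))) (m≤n⇒m⊓n≡m (r (suc t) j)))
  (tabulate∘lookup (u (suc t)))

lookup-run≤ : ∀ {d} b z (s : Fin d → Vec ℕ d → ℕ) t j → lookup (run b z s t) j ≤ b
lookup-run≤ b z s zero    j = subst (_≤ b) (sym (lookup∘tabulate (λ j → z j ⊓ b) j)) (m⊓n≤n _ b)
lookup-run≤ b z s (suc t) j = subst (_≤ b) (sym (lookup∘tabulate (λ j → s j (run b z s t) ⊓ b) j)) (m⊓n≤n _ b)

encVec-run≤ : ∀ {d} b z (s : Fin d → Vec ℕ d → ℕ) t → encVec (run b z s t) ≤ encVec (tabulate {n = d} λ _ → b)
encVec-run≤ b z s t = encVec-mono (run b z s t) (tabulate λ _ → b) λ j →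
  subst (lookup (run b z s t) j ≤_) (sym (lookup∘tabulate (λ _ → b) j)) (lookup-run≤ b z s t j)

run-rec : ∀ {d} b z (s : Fin d → Vec ℕ d → ℕ) t →
          rec (encVec (tabulate λ j → z j ⊓ b)) (λ _ a → encVec (tabulate λ j → s j (decVec a) ⊓ b)) t ≡ encVec (run b z s t)
run-rec b z s zero    = refl
run-rec b z s (suc t) = trans (cong (λ a → encVec (tabulate λ j → s j (decVec a) ⊓ b)) (run-rec b z s t))
  (cong encVec (tabulate-cong λ j → cong (λ v → s j v ⊓ b) (decVec-encVec (run b z s t))))

-- Simultaneous recursion is single recursion on codes of d-tuples. Since coding is monotone, the
-- code of the tuple (b, ..., b) is a majorant.
runC : ∀ {i k l d} {z : Fin d → Fn k l} {s : Fin d → Fn k d} {b n : Fn k l} →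
       (∀ j → Core i k (z j)) → (∀ j → Core i k (s j)) → Core i k b → Core i k n →
       ∀ j → Core i k (λ fs ns → lookup (run (b fs ns) (λ j → z j fs ns) (λ j → s j fs) (n fs ns)) j)
runC {i} {k} {l} {d} {z} {s} {b} {n} p q r t j = ext
    (λ fs ns → sym (trans (cong (dec j) (run-rec (b fs ns) (λ j → z j fs ns) (λ j → s j fs) (n fs ns)))
                          (dec-encVec (run (b fs ns) (λ j → z j fs ns) (λ j → s j fs) (n fs ns)) j)))
    (decC j (recC {H = H} (encVecC (λ j → ⊓C (p j) r))
      (ext (λ { fs (m ∷ a ∷ ns) → refl }) (encVecC (λ j → ⊓C (comp (q j) (λ j → decC j (proj {l = 2 + l} (suc zero)))) (drop₂ r))))
      (encVecC {d = d} (λ _ → drop₁ r))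
      (λ fs n ns → subst (_≤ encVec (tabulate {n = d} λ _ → b fs ns)) (sym (run-rec (b fs ns) (λ j → z j fs ns) (λ j → s j fs) n))
                     (encVec-run≤ (b fs ns) (λ j → z j fs ns) (λ j → s j fs) n)) t))
  where
  H : Fn k (2 + l)
  H fs (m ∷ a ∷ ns) = encVec (tabulate λ j → s j fs (decVec a) ⊓ b fs ns)

-- Tape contents as numbers

iter : {A : Set} → (A → A) → ℕ → A → A
iter f zero    x = x
iter f (suc t) x = f (iter f t x)

iter-shift : ∀ {A : Set} (f : A → A) t x → iter f (suc t) x ≡ iter f t (f x)
iter-shift f zero    x = refl
iter-shift f (suc t) x = cong f (iter-shift f t x)

iter-inv : ∀ {A : Set} (P : A → Set) {f : A → A} → (∀ x → P x → P (f x)) → ∀ t {x} → P x → P (iter f t x)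
iter-inv P h zero    p = p
iter-inv P h (suc t) p = h _ (iter-inv P h t p)

half : ℕ → ℕ
half = inv (2 *_)

scale< : ∀ c r → suc c * r < suc c * suc r
scale< c r = *-monoʳ-< (suc c) ≤-refl

inv-scale : ∀ c d e → d < suc c → inv (suc c *_) (d + suc c * e) ≡ e
inv-scale c d e p = inv-unique (*-zeroʳ (suc c)) (scale< c) (m≤n+m _ d)
  (subst (d + suc c * e <_) (sym (*-suc (suc c) e)) (+-monoˡ-< (suc c * e) p))

half-snoc : ∀ w b → half (pred (num (w ∷ʳ b))) ≡ num w
half-snoc w b = trans (cong (half ∘ pred) (num-∷ʳ w b)) (inv-scale 1 (bitℕ b) (num w) (s≤s (bitℕ≤1 b)))

n<2^n : ∀ n → n < 2 ^ n
n<2^n zero    = s≤s z≤n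
n<2^n (suc n) = begin-strict
  suc n             ≤⟨ n<2^n n ⟩
  2 ^ n             <⟨ m<m+n (2 ^ n) (m^n>0 2 n) ⟩
  2 ^ n + 2 ^ n     ≡⟨ cong (2 ^ n +_) (sym (+-identityʳ _)) ⟩
  2 ^ suc n         ∎
  where open ≤-Reasoning

module _ {μ : ℕ} where

  -- The blank must be the digit 0: blanks at the far end of a list of cells then do not affect its
  -- code, and the empty list behaves as an endless supply of blanks.
  code : Symbol μ → Fin (3 + μ)
  code blank       = zero
  code (bit false) = suc zero
  code (bit true)  = suc (suc zero)
  code (mark j)    = suc (suc (suc j))

  symOf : Fin (3 + μ) → Symbol μ
  symOf zero                = blank
  symOf (suc zero)          = bit false
  symOf (suc (suc zero))    = bit true
  symOf (suc (suc (suc j))) = mark j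

  symOf-code : ∀ s → symOf (code s) ≡ s
  symOf-code blank       = refl
  symOf-code (bit false) = refl
  symOf-code (bit true)  = refl
  symOf-code (mark j)    = refl

  enc : List (Symbol μ) → ℕ
  enc []      = 0
  enc (s ∷ l) = toℕ (code s) + (3 + μ) * enc l

  code-bit : ∀ b → toℕ (code (bit b)) ≡ suc (bitℕ b)
  code-bit false = refl
  code-bit true  = refl

  enc<^ : ∀ l → enc l < (3 + μ) ^ length l
  enc<^ []      = ≤-refl
  enc<^ (s ∷ l) = begin-strict
    toℕ (code s) + (3 + μ) * enc l       <⟨ +-monoˡ-< _ (toℕ<n (code s)) ⟩
    (3 + μ) + (3 + μ) * enc l            ≡⟨ sym (*-suc (3 + μ) (enc l)) ⟩
    (3 + μ) * suc (enc l)                ≤⟨ *-monoʳ-≤ (3 + μ) (enc<^ l) ⟩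
    (3 + μ) ^ suc (length l)             ∎
    where open ≤-Reasoning

  enc-tail≤ : ∀ s l → enc l ≤ enc (s ∷ l)
  enc-tail≤ s l = ≤-trans (m≤n*m (enc l) (3 + μ)) (m≤n+m _ (toℕ (code s)))

  -- Bits are nonzero digits in a base greater than 2, so each bit of the prefix at least doubles
  -- the code. Hence the word on a tape has a length logarithmic in the code, and its number can be
  -- bounded linearly.
  2^prefix≤ : ∀ l → 2 ^ length (bitPrefix l) ≤ suc (2 * enc l)
  2^prefix≤ []            = ≤-refl
  2^prefix≤ (blank ∷ l)   = s≤s z≤n
  2^prefix≤ (mark j ∷ l)  = s≤s z≤n
  2^prefix≤ (bit b ∷ l)   = begin
    2 * 2 ^ length (bitPrefix l)                     ≤⟨ *-monoʳ-≤ 2 (2^prefix≤ l) ⟩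
    2 * suc (2 * enc l)                              ≤⟨ *-monoʳ-≤ 2 (s≤s (m≤n+m _ (bitℕ b))) ⟩
    2 * (suc (bitℕ b) + 2 * enc l)                   ≡⟨ cong (λ d → 2 * (d + 2 * enc l)) (sym (code-bit b)) ⟩
    2 * (toℕ (code (bit b)) + 2 * enc l)             ≤⟨ *-monoʳ-≤ 2 (+-monoʳ-≤ (toℕ (code (bit b))) (*-monoˡ-≤ (enc l) {2} {3 + μ} (m≤m+n 2 (suc μ)))) ⟩
    2 * enc (bit b ∷ l)                              ≤⟨ n≤1+n _ ⟩
    suc (2 * enc (bit b ∷ l))                        ∎
    where open ≤-Reasoning

  popN topN : ℕ → ℕ
  popN = inv ((3 + μ) *_)
  topN e = e ∸ (3 + μ) * popN e

  pushN : ℕ → ℕ → ℕ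
  pushN d e = d + (3 + μ) * e

  popN-push : ∀ s e → popN (pushN (toℕ (code s)) e) ≡ e
  popN-push s e = inv-scale (2 + μ) (toℕ (code s)) e (toℕ<n (code s))

  topN-push : ∀ s e → topN (pushN (toℕ (code s)) e) ≡ toℕ (code s)
  topN-push s e = trans (cong (λ r → pushN (toℕ (code s)) e ∸ (3 + μ) * r) (popN-push s e)) (m+n∸n≡m (toℕ (code s)) ((3 + μ) * e))

  topN-0 : topN 0 ≡ 0
  topN-0 = 0∸n≡0 ((3 + μ) * 0)

  module _ {i : Maybe ℕ} {k : ℕ} where

    popC : ∀ {l} {f : Fn k l} → Core i k f → Core i k (λ fs ns → popN (f fs ns))
    popC = invC {φ = (3 + μ) *_} (λ p → *C (constC (3 + μ)) p)

    topC : ∀ {l} {f : Fn k l} → Core i k f → Core i k (λ fs ns → topN (f fs ns))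
    topC p = ∸C p (*C (constC (3 + μ)) (popC p))

    pushC : ∀ {l} {f h : Fn k l} → Core i k f → Core i k h → Core i k (λ fs ns → pushN (f fs ns) (h fs ns))
    pushC p q = +C p (*C (constC (3 + μ)) q)

    halfC : ∀ {l} {f : Fn k l} → Core i k f → Core i k (λ fs ns → half (f fs ns))
    halfC = invC {φ = 2 *_} (λ p → *C (constC 2) p)

  -- The first symbol other than a bit makes the remainder vanish, so that reading is idle from then
  -- on and the number of rounds may exceed the length of the word.
  readStep : Str × List (Symbol μ) → Str × List (Symbol μ)
  readStep (u , bit b ∷ l) = u ∷ʳ b , l
  readStep (u , _)         = u , []

  read-prefix : ∀ {x} → proj₁ (readStep x) ++ bitPrefix (proj₂ (readStep x)) ≡ proj₁ x ++ bitPrefix (proj₂ x)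
  read-prefix {u , bit b ∷ l}  = ++-assoc u (b ∷ []) (bitPrefix l)
  read-prefix {u , []}         = refl
  read-prefix {u , blank ∷ l}  = refl
  read-prefix {u , mark j ∷ l} = refl

  read-enc : ∀ x → enc (proj₂ (readStep x)) ≤ enc (proj₂ x)
  read-enc (u , bit b ∷ l)  = enc-tail≤ (bit b) l
  read-enc (u , [])         = z≤n
  read-enc (u , blank ∷ l)  = z≤n
  read-enc (u , mark j ∷ l) = z≤n

  read-all : ∀ t u l → length (bitPrefix l) ≤ t → proj₁ (iter readStep t (u , l)) ≡ u ++ bitPrefix l
  read-all zero u [] p = sym (++-identityʳ u)
  read-all zero u (blank ∷ l) p = sym (++-identityʳ u)
  read-all zero u (mark j ∷ l) p = sym (++-identityʳ u)
  read-all (suc t) u l p = trans (cong proj₁ (iter-shift readStep t (u , l))) (aux l p)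
    where
    aux : ∀ l → length (bitPrefix l) ≤ suc t → proj₁ (iter readStep t (readStep (u , l))) ≡ u ++ bitPrefix l
    aux [] p            = trans (read-all t u [] z≤n) refl
    aux (blank ∷ l) p   = trans (read-all t u [] z≤n) refl
    aux (mark j ∷ l) p  = trans (read-all t u [] z≤n) refl
    aux (bit b ∷ l) p   = trans (read-all t (u ∷ʳ b) l (s≤s⁻¹ p)) (++-assoc u (b ∷ []) (bitPrefix l))

  readAcc readRest : Fin 3 → ℕ → ℕ
  readAcc zero             a = a
  readAcc (suc zero)       a = suc (2 * a)
  readAcc (suc (suc zero)) a = suc (suc (2 * a))
  readRest zero    e = 0
  readRest (suc _) e = e

  readN : Fin 2 → Vec ℕ 2 → ℕ
  readN zero       (a ∷ e ∷ []) = at a (λ j → readAcc j a) (topN e)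
  readN (suc zero) (a ∷ e ∷ []) = at 0 (λ j → readRest j (popN e)) (topN e)

  readView : Str × List (Symbol μ) → Vec ℕ 2
  readView (u , l) = num u ∷ enc l ∷ []

  readN-step : ∀ x j → readN j (readView x) ≡ lookup (readView (readStep x)) j
  readN-step (u , []) zero             = cong (at (num u) λ j → readAcc j (num u)) topN-0
  readN-step (u , []) (suc zero)       = cong (at 0 λ j → readRest j (popN 0)) topN-0
  readN-step (u , s ∷ l) zero          = trans (cong (at (num u) λ j → readAcc j (num u)) (topN-push s (enc l))) (aux s)
    where
    aux : ∀ s → at (num u) (λ j → readAcc j (num u)) (toℕ (code s)) ≡ num (proj₁ (readStep (u , s ∷ l)))
    aux blank       = refl
    aux (bit false) = sym (num-∷ʳ u false)
    aux (bit true)  = sym (num-∷ʳ u true)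
    aux (mark j)    = refl
  readN-step (u , s ∷ l) (suc zero)    = trans (cong₂ (λ d e → at 0 (λ j → readRest j e) d) (topN-push s (enc l)) (popN-push s (enc l))) (aux s)
    where
    aux : ∀ s → at 0 (λ j → readRest j (enc l)) (toℕ (code s)) ≡ enc (proj₂ (readStep (u , s ∷ l)))
    aux blank       = refl
    aux (bit false) = refl
    aux (bit true)  = refl
    aux (mark j)    = refl

  wordInit : ℕ → Fin 2 → ℕ
  wordInit e zero       = 0
  wordInit e (suc zero) = e

  -- By `2^prefix≤`, 4e + 2 = 2 (2e + 1) is at least 2 to the length of the word plus one. It
  -- therefore serves both as the number of rounds and as the cut-off.
  wordN : ℕ → ℕ
  wordN e = lookup (run (4 * e + 2) (wordInit e) readN (4 * e + 2)) zero

  wordN-correct : ∀ l → wordN (enc l) ≡ num (bitPrefix l)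
  wordN-correct l = trans (cong (λ v → lookup v zero) (run-exact u init (λ t → readN-step (iter readStep t ([] , l))) bound T))
    (cong num (read-all T [] l (<⇒≤ (<-≤-trans (n<2^n _) (≤-trans (2^prefix≤ l) (lem₁ (enc l)))))))
    where
    T = 4 * enc l + 2
    u : ℕ → Vec ℕ 2
    u t = readView (iter readStep t ([] , l))
    lem₁ : ∀ e → suc (2 * e) ≤ 4 * e + 2
    lem₁ e = ≤-trans (n≤1+n _) (≤-trans (m≤m+n (2 + 2 * e) (2 * e)) (≤-reflexive (eq e)))
      where
      eq : ∀ e → 2 + 2 * e + 2 * e ≡ 4 * e + 2
      eq = solve-∀
    lem₂ : ∀ e → 2 * suc (2 * e) ≡ 4 * e + 2
    lem₂ = solve-∀
    init : ∀ j → wordInit (enc l) j ≡ lookup (u 0) j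
    init zero       = sym num-[]
    init (suc zero) = refl
    Inv : Str × List (Symbol μ) → Set
    Inv x = (proj₁ x ++ bitPrefix (proj₂ x) ≡ bitPrefix l) × (enc (proj₂ x) ≤ enc l)
    inv-iter : ∀ t → Inv (iter readStep t ([] , l))
    inv-iter t = iter-inv Inv (λ { x (p , q) → trans (read-prefix {x}) p , ≤-trans (read-enc x) q }) t (refl , ≤-refl)
    bound : ∀ t j → lookup (u t) j ≤ T
    bound t j with iter readStep t ([] , l) | inv-iter t
    bound t zero       | v , r | p , q = begin
      num v                                ≤⟨ m≤n+m (num v) 2 ⟩
      2 + num v                            ≤⟨ num<2^length v ⟩
      2 ^ suc (length v)                   ≤⟨ ^-monoʳ-≤ 2 (s≤s (subst (length v ≤_) (trans (sym (length-++ v)) (cong length p)) (m≤m+n _ _))) ⟩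
      2 * 2 ^ length (bitPrefix l)         ≤⟨ *-monoʳ-≤ 2 (2^prefix≤ l) ⟩
      2 * suc (2 * enc l)                  ≡⟨ lem₂ (enc l) ⟩
      T                                    ∎
      where open ≤-Reasoning
    bound t (suc zero) | v , r | p , q = ≤-trans q (≤-trans (m≤n*m (enc l) 4) (m≤m+n _ 2))

  loadStep : Str × Str → Str × Str
  loadStep ([] , l)    = [] , l
  loadStep (b ∷ r , l) = r , b ∷ l

  loadN-step : Fin 2 → Vec ℕ 2 → ℕ
  loadN-step zero       v = half (pred (lookup v zero))
  loadN-step (suc zero) v = if0 (lookup v zero) (lookup v (suc zero))
    (pushN (suc (pred (lookup v zero) ∸ 2 * half (pred (lookup v zero)))) (lookup v (suc zero)))

  -- Arithmetic reaches the last bit of a number, so words are taken apart from the end; consing the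
  -- bits then restores their order. The list in the state is the reversal of what remains.
  loadView : Str × Str → Vec ℕ 2
  loadView (r , l) = num (List.reverse r) ∷ enc (map bit l) ∷ []

  load-view : ∀ x j → loadN-step j (loadView x) ≡ lookup (loadView (loadStep x)) j
  load-view ([] , l) zero       = cong (half ∘ pred) num-[] ■ sym num-[]
    where
    infixr 5 _■_
    _■_ = trans
  load-view ([] , l) (suc zero) = cong (λ n → if0 n (enc (map bit l))
    (pushN (suc (pred n ∸ 2 * half (pred n))) (enc (map bit l)))) num-[]
  load-view (b ∷ r , l) j rewrite Listₚ.unfold-reverse b r | num-∷ʳ (List.reverse r) b = aux j
    where
    w = List.reverse r
    h : half (bitℕ b + 2 * num w) ≡ num w
    h = inv-scale 1 (bitℕ b) (num w) (s≤s (bitℕ≤1 b))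
    aux : ∀ j → loadN-step j (suc (bitℕ b + 2 * num w) ∷ enc (map bit l) ∷ []) ≡ lookup (loadView (r , b ∷ l)) j
    aux zero       = h
    aux (suc zero) = cong (_+ (3 + μ) * enc (map bit l)) (trans
      (cong suc (trans (cong (λ e → bitℕ b + 2 * num w ∸ 2 * e) h) (m+n∸n≡m (bitℕ b) (2 * num w)))) (sym (code-bit b)))

  load-all : ∀ t r l → length r ≤ t → proj₂ (iter loadStep t (r , l)) ≡ List.reverse r ++ l
  load-all zero [] l p = refl
  load-all (suc t) r l p = trans (cong proj₂ (iter-shift loadStep t (r , l))) (aux r p)
    where
    aux : ∀ r → length r ≤ suc t → proj₂ (iter loadStep t (loadStep (r , l))) ≡ List.reverse r ++ l
    aux [] p      = load-all t [] l z≤n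
    aux (b ∷ r) p = trans (load-all t r (b ∷ l) (s≤s⁻¹ p))
      (trans (sym (++-assoc (List.reverse r) (b ∷ []) l)) (cong (_++ l) (sym (Listₚ.unfold-reverse b r))))

  loadInit : ℕ → Fin 2 → ℕ
  loadInit w zero       = w
  loadInit w (suc zero) = 0

  -- With β = 3 + μ, β^n ≤ 2^(β n) = (2^n)^β, and 2^n ≤ w + 1 for n up to the length of w. An
  -- exponential in the length is thus a polynomial of fixed degree in the number. The same bound
  -- serves for the tape codes of whole runs.
  loadBound : ℕ → ℕ
  loadBound w = suc w ^ (3 + μ)

  loadN : ℕ → ℕ
  loadN w = lookup (run (loadBound w) (loadInit w) loadN-step w) (suc zero)

  β^≤ : ∀ {n w} → n ≤ len w → (3 + μ) ^ n ≤ loadBound w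
  β^≤ {n} {w} p = begin
    (3 + μ) ^ n             ≤⟨ ^-monoˡ-≤ n (<⇒≤ (n<2^n (3 + μ))) ⟩
    (2 ^ (3 + μ)) ^ n       ≡⟨ ^-*-assoc 2 (3 + μ) n ⟩
    2 ^ ((3 + μ) * n)       ≡⟨ cong (2 ^_) (*-comm (3 + μ) n) ⟩
    2 ^ (n * (3 + μ))       ≡⟨ sym (^-*-assoc 2 n (3 + μ)) ⟩
    (2 ^ n) ^ (3 + μ)       ≤⟨ ^-monoˡ-≤ (3 + μ) (≤-trans (^-monoʳ-≤ 2 p) (2^len≤ w)) ⟩
    suc w ^ (3 + μ)         ∎
    where open ≤-Reasoning

  loadN-correct : ∀ w → loadN (num w) ≡ enc (map bit w)
  loadN-correct w = trans (cong (λ v → lookup v (suc zero)) (run-exact u init (λ t → load-view (iter loadStep t (List.reverse w , []))) bound T))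
      (cong (λ l → enc (map bit l)) (trans (load-all T (List.reverse w) [] (≤-trans (≤-reflexive (Listₚ.length-reverse w)) length≤num))
         (trans (++-identityʳ _) (Listₚ.reverse-involutive w))))
    where
    T = num w
    length≤num : length w ≤ num w
    length≤num = s≤s⁻¹ (≤-trans (n<2^n (length w)) (2^length≤num w))
    u : ℕ → Vec ℕ 2
    u t = loadView (iter loadStep t (List.reverse w , []))
    init : ∀ j → loadInit (num w) j ≡ lookup (u 0) j
    init zero       = cong num (sym (Listₚ.reverse-involutive w))
    init (suc zero) = refl
    Inv : Str × Str → Set
    Inv (r , l) = length r + length l ≡ length w × num (List.reverse r) ≤ num w
    pres : ∀ x → Inv x → Inv (loadStep x)
    pres ([] , l) p          = p
    pres (b ∷ r , l) (p , q) = trans (+-suc (length r) (length l)) p ,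
      ≤-trans (subst (num (List.reverse r) ≤_) (sym (trans (cong num (Listₚ.unfold-reverse b r)) (num-∷ʳ (List.reverse r) b)))
        (≤-trans (m≤n*m (num (List.reverse r)) 2) (≤-trans (m≤n+m _ (bitℕ b)) (n≤1+n _)))) q
    inv-iter : ∀ t → Inv (iter loadStep t (List.reverse w , []))
    inv-iter t = iter-inv Inv pres t (trans (+-identityʳ _) (Listₚ.length-reverse w) , ≤-reflexive (cong num (Listₚ.reverse-involutive w)))
    bound : ∀ t j → lookup (u t) j ≤ loadBound T
    bound t j with iter loadStep t (List.reverse w , []) | inv-iter t
    bound t zero       | r , l | p , q = ≤-trans q (≤-trans (n≤1+n _) (subst (_≤ loadBound T) (*-identityʳ (suc T)) (^-monoʳ-≤ (suc T) {1} {3 + μ} (s≤s z≤n))))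
    bound t (suc zero) | r , l | p , q = <⇒≤ (<-≤-trans (enc<^ (map bit l))
      (β^≤ {w = T} (subst₂ _≤_ (sym (length-map bit l)) (trans p (cong length (sym (str-num w)))) (m≤n+m (length l) (length r)))))

  module _ {i : Maybe ℕ} {k : ℕ} where

    wordC : ∀ {l} {f : Fn k l} → Core i k f → Core i k (λ fs ns → wordN (f fs ns))
    wordC {l} {f} p = runC {z = λ j fs ns → wordInit (f fs ns) j} {s = λ j fs → readN j} {b = λ fs ns → 4 * f fs ns + 2} {n = λ fs ns → 4 * f fs ns + 2}
        (λ { zero → constC 0 ; (suc zero) → p })
        (λ { zero → ext (λ { fs (a ∷ e ∷ []) → refl }) (atC {f = λ j fs ns → readAcc j (lookup ns zero)} acc₀ (topC e) λ { zero → acc₀ ; (suc zero) → sucC₁ (*C (constC 2) acc₀) ; (suc (suc zero)) → sucC₁ (sucC₁ (*C (constC 2) acc₀)) })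
           ; (suc zero) → ext (λ { fs (a ∷ e ∷ []) → refl }) (atC {f = λ j fs ns → readRest j (popN (lookup ns (suc zero)))} (constC 0) (topC e) λ { zero → constC 0 ; (suc _) → popC e }) })
        T T zero
      where
      acc₀ : Core i k {2} (λ fs ns → lookup ns zero)
      acc₀ = proj zero
      e : Core i k {2} (λ fs ns → lookup ns (suc zero))
      e = proj (suc zero)
      T = +C (*C (constC 4) p) (constC 2)

    loadC : ∀ {l} {f : Fn k l} → Core i k f → Core i k (λ fs ns → loadN (f fs ns))
    loadC {l} {f} p = runC {z = λ j fs ns → loadInit (f fs ns) j} {s = λ j fs → loadN-step j} {b = λ fs ns → loadBound (f fs ns)} {n = f}
        (λ { zero → p ; (suc zero) → constC 0 })
        (λ { zero → halfC (predC w)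
           ; (suc zero) → if0C w (proj (suc zero)) (pushC (sucC₁ (∸C (predC w) (*C (constC 2) (halfC (predC w))))) (proj (suc zero))) })
        (^C (sucC₁ p) (3 + μ)) p (suc zero)
      where
      w : Core i k {2} (λ fs ns → lookup ns zero)
      w = proj zero

-- Uniform access to the tapes of a machine

data TapeId (k l w : ℕ) : Set where
  inT  : Fin l → TapeId k l w
  outT : TapeId k l w
  qryT : Fin k → TapeId k l w
  ansT : Fin k → TapeId k l w
  wrkT : Fin w → TapeId k l w

module _ {k l w : ℕ} where

  get : {A : Set} → Tapes k l w A → TapeId k l w → A
  get t (inT j)  = lookup (Tapes.inputs t) j
  get t outT     = Tapes.output t
  get t (qryT j) = lookup (Tapes.queries t) j
  get t (ansT j) = lookup (Tapes.answers t) j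
  get t (wrkT j) = lookup (Tapes.work t) j

  build : {A : Set} → (TapeId k l w → A) → Tapes k l w A
  build f = record
    { inputs  = tabulate (f ∘ inT)
    ; output  = f outT
    ; queries = tabulate (f ∘ qryT)
    ; answers = tabulate (f ∘ ansT)
    ; work    = tabulate (f ∘ wrkT)
    }

  get-build : {A : Set} (f : TapeId k l w → A) → ∀ r → get (build f) r ≡ f r
  get-build f (inT j)  = lookup∘tabulate (f ∘ inT) j
  get-build f outT     = refl
  get-build f (qryT j) = lookup∘tabulate (f ∘ qryT) j
  get-build f (ansT j) = lookup∘tabulate (f ∘ ansT) j
  get-build f (wrkT j) = lookup∘tabulate (f ∘ wrkT) j

  tapes-cong : {A : Set} {is is′ : Vec A l} {o o′ : A} {qs qs′ as as′ : Vec A k} {ws ws′ : Vec A w} →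
               is ≡ is′ → o ≡ o′ → qs ≡ qs′ → as ≡ as′ → ws ≡ ws′ →
               _≡_ {A = Tapes k l w A} (record { inputs = is ; output = o ; queries = qs ; answers = as ; work = ws })
               (record { inputs = is′ ; output = o′ ; queries = qs′ ; answers = as′ ; work = ws′ })
  tapes-cong refl refl refl refl refl = refl

  build-cong : {A : Set} {f h : TapeId k l w → A} → (∀ r → f r ≡ h r) → build f ≡ build h
  build-cong p = tapes-cong (tabulate-cong (p ∘ inT)) (p outT) (tabulate-cong (p ∘ qryT))
    (tabulate-cong (p ∘ ansT)) (tabulate-cong (p ∘ wrkT))

  build-get : {A : Set} (t : Tapes k l w A) → build (get t) ≡ t
  build-get t = tapes-cong (tabulate∘lookup inputs) refl (tabulate∘lookup queries) (tabulate∘lookup answers) (tabulate∘lookup work)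
    where open Tapes t

  get-map : {A B : Set} (f : A → B) (t : Tapes k l w A) → ∀ r → get (mapTapes f t) r ≡ f (get t r)
  get-map f t (inT j) = lookup-map j f (Tapes.inputs t)
  get-map f t outT     = refl
  get-map f t (qryT j) = lookup-map j f (Tapes.queries t)
  get-map f t (ansT j) = lookup-map j f (Tapes.answers t)
  get-map f t (wrkT j) = lookup-map j f (Tapes.work t)

  get-zip : {A B C : Set} (f : A → B → C) (t : Tapes k l w A) (u : Tapes k l w B) →
            ∀ r → get (zipTapes f t u) r ≡ f (get t r) (get u r)
  get-zip f t u (inT j)  = lookup-zipWith f j (Tapes.inputs t) (Tapes.inputs u)
  get-zip f t u outT     = refl
  get-zip f t u (qryT j) = lookup-zipWith f j (Tapes.queries t) (Tapes.queries u)
  get-zip f t u (ansT j) = lookup-zipWith f j (Tapes.answers t) (Tapes.answers u)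
  get-zip f t u (wrkT j) = lookup-zipWith f j (Tapes.work t) (Tapes.work u)

  tapeCount : ℕ
  tapeCount = l + (1 + (k + (k + w)))

  toI : TapeId k l w → Fin tapeCount
  toI (inT j)  = j ↑ˡ _
  toI outT     = l ↑ʳ zero
  toI (qryT j) = l ↑ʳ suc (j ↑ˡ _)
  toI (ansT j) = l ↑ʳ suc (k ↑ʳ (j ↑ˡ _))
  toI (wrkT j) = l ↑ʳ suc (k ↑ʳ (k ↑ʳ j))

  fromI₄ : Fin k ⊎ Fin w → TapeId k l w
  fromI₄ = [ ansT , wrkT ]′

  fromI₃ : Fin k ⊎ Fin (k + w) → TapeId k l w
  fromI₃ (inj₁ j) = qryT j
  fromI₃ (inj₂ j) = fromI₄ (splitAt k j)

  fromI₂ : Fin l ⊎ Fin (1 + (k + (k + w))) → TapeId k l w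
  fromI₂ (inj₁ j)       = inT j
  fromI₂ (inj₂ zero)    = outT
  fromI₂ (inj₂ (suc j)) = fromI₃ (splitAt k j)

  fromI : Fin tapeCount → TapeId k l w
  fromI j = fromI₂ (splitAt l j)

  fromI-toI : ∀ r → fromI (toI r) ≡ r
  fromI-toI (inT j) rewrite splitAt-↑ˡ l j (1 + (k + (k + w))) = refl
  fromI-toI outT rewrite splitAt-↑ʳ l (1 + (k + (k + w))) zero = refl
  fromI-toI (qryT j) rewrite splitAt-↑ʳ l (1 + (k + (k + w))) (suc (j ↑ˡ (k + w))) | splitAt-↑ˡ k j (k + w) = refl
  fromI-toI (ansT j) rewrite splitAt-↑ʳ l (1 + (k + (k + w))) (suc (k ↑ʳ (j ↑ˡ w))) | splitAt-↑ʳ k (k + w) (j ↑ˡ w) | splitAt-↑ˡ k j w = refl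
  fromI-toI (wrkT j) rewrite splitAt-↑ʳ l (1 + (k + (k + w))) (suc (k ↑ʳ (k ↑ʳ j))) | splitAt-↑ʳ k (k + w) (k ↑ʳ j) | splitAt-↑ʳ k w j = refl

  tabulateI : {A : Set} → (TapeId k l w → A) → Vec A tapeCount
  tabulateI f = tabulate (f ∘ fromI)

  lookup-tabulateI : {A : Set} (f : TapeId k l w → A) → ∀ r → lookup (tabulateI f) (toI r) ≡ f r
  lookup-tabulateI f r = trans (lookup∘tabulate (f ∘ fromI) (toI r)) (cong f (fromI-toI r))

  get≤total : (t : Tapes k l w ℕ) → ∀ r → get t r ≤ totalTapes t
  get≤total t r = aux r
    where
    open Tapes t
    lookup≤sum : ∀ {n} (v : Vec ℕ n) j → lookup v j ≤ Vec.sum v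
    lookup≤sum (x ∷ v) zero    = m≤m+n x _
    lookup≤sum (x ∷ v) (suc j) = ≤-trans (lookup≤sum v j) (m≤n+m _ x)
    A = Vec.sum inputs
    aux : ∀ r → get t r ≤ A + output + Vec.sum queries + Vec.sum answers + Vec.sum work
    aux (inT j)  = ≤-trans (lookup≤sum inputs j) (≤-trans (m≤m+n A output) (≤-trans (m≤m+n (A + output) _) (≤-trans (m≤m+n _ (Vec.sum answers)) (m≤m+n _ (Vec.sum work)))))
    aux outT     = ≤-trans (m≤n+m output A) (≤-trans (m≤m+n (A + output) _) (≤-trans (m≤m+n _ (Vec.sum answers)) (m≤m+n _ (Vec.sum work))))
    aux (qryT j) = ≤-trans (lookup≤sum queries j) (≤-trans (m≤n+m _ (A + output)) (≤-trans (m≤m+n _ (Vec.sum answers)) (m≤m+n _ (Vec.sum work))))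
    aux (ansT j) = ≤-trans (lookup≤sum answers j) (≤-trans (m≤n+m _ (A + output + Vec.sum queries)) (m≤m+n _ (Vec.sum work)))
    aux (wrkT j) = ≤-trans (lookup≤sum work j) (m≤n+m _ (A + output + Vec.sum queries + Vec.sum answers))

  total≤ : (t : Tapes k l w ℕ) → ∀ B → (∀ r → get t r ≤ B) → totalTapes t ≤ tapeCount * B
  total≤ t B p = begin
    Vec.sum inputs + output + Vec.sum queries + Vec.sum answers + Vec.sum work
      ≤⟨ +-mono-≤ (+-mono-≤ (+-mono-≤ (+-mono-≤ (sum≤ inputs (p ∘ inT)) (p outT)) (sum≤ queries (p ∘ qryT))) (sum≤ answers (p ∘ ansT))) (sum≤ work (p ∘ wrkT)) ⟩
    l * B + B + k * B + k * B + w * B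
      ≡⟨ lem l k w B ⟩
    tapeCount * B ∎
    where
    open Tapes t
    open ≤-Reasoning
    sum≤ : ∀ {n} (v : Vec ℕ n) → (∀ j → lookup v j ≤ B) → Vec.sum v ≤ n * B
    sum≤ []      p = z≤n
    sum≤ (x ∷ v) p = +-mono-≤ (p zero) (sum≤ v (p ∘ suc))
    lem : ∀ l k w B → l * B + B + k * B + k * B + w * B ≡ (l + (1 + (k + (k + w)))) * B
    lem = solve-∀

-- Simulation of machines

moveIx : Move → Fin 3
moveIx goLeft  = zero
moveIx stay    = suc zero
moveIx goRight = suc (suc zero)

module _ {μ : ℕ} where

  encL encE : Tape μ → ℕ
  encL t = enc (Tape.left t)
  encE t = enc (Tape.head t ∷ Tape.right t)

  -- `L` codes the cells left of the head, nearest first, and `E` the cells from the head on; `w` is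
  -- the digit written. Because blanks are 0, the ends of the tape need no case of their own.
  shiftL shiftE : Fin 3 → ℕ → ℕ → ℕ → ℕ
  shiftL zero             w L E = popN {μ} L
  shiftL (suc zero)       w L E = L
  shiftL (suc (suc zero)) w L E = pushN {μ} w L
  shiftE zero             w L E = pushN {μ} (topN {μ} L) (pushN {μ} w (popN {μ} E))
  shiftE (suc zero)       w L E = pushN {μ} w (popN {μ} E)
  shiftE (suc (suc zero)) w L E = popN {μ} E

  shiftL-correct : ∀ s m (t : Tape μ) → encL (writeMove (s , m) t) ≡ shiftL (moveIx m) (toℕ (code s)) (encL t) (encE t)
  shiftL-correct s goLeft  ⟨ [] , h , rs ⟩     = refl
  shiftL-correct s goLeft  ⟨ x ∷ ls , h , rs ⟩ = sym (popN-push x (enc ls))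
  shiftL-correct s stay    t                   = refl
  shiftL-correct s goRight ⟨ ls , h , [] ⟩     = refl
  shiftL-correct s goRight ⟨ ls , h , r ∷ rs ⟩ = refl

  shiftE-correct : ∀ s m (t : Tape μ) → encE (writeMove (s , m) t) ≡ shiftE (moveIx m) (toℕ (code s)) (encL t) (encE t)
  shiftE-correct s goLeft  ⟨ [] , h , rs ⟩     = cong₂ (pushN {μ}) (sym (topN-0 {μ})) (cong (pushN {μ} (toℕ (code s))) (sym (popN-push h (enc rs))))
  shiftE-correct s goLeft  ⟨ x ∷ ls , h , rs ⟩ = cong₂ (pushN {μ}) (sym (topN-push x (enc ls))) (cong (pushN {μ} (toℕ (code s))) (sym (popN-push h (enc rs))))
  shiftE-correct s stay    ⟨ ls , h , rs ⟩     = cong (pushN {μ} (toℕ (code s))) (sym (popN-push h (enc rs)))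
  shiftE-correct s goRight ⟨ ls , h , [] ⟩     = trans (*-zeroʳ (3 + μ)) (sym (popN-push h 0))
  shiftE-correct s goRight ⟨ ls , h , r ∷ rs ⟩ = sym (popN-push h (enc (r ∷ rs)))

  encL-load : ∀ w → encL (load w) ≡ 0
  encL-load []      = refl
  encL-load (b ∷ w) = refl

  encE-load : ∀ w → encE (load w) ≡ enc {μ} (map bit w)
  encE-load []      = *-zeroʳ (3 + μ)
  encE-load (b ∷ w) = refl

  encL<^ : ∀ t → encL t < (3 + μ) ^ cells t
  encL<^ t = <-≤-trans (enc<^ (Tape.left t)) (^-monoʳ-≤ (3 + μ) (m≤m+n (length (Tape.left t)) (suc (length (Tape.right t)))))

  encE<^ : ∀ t → encE t < (3 + μ) ^ cells t
  encE<^ t = <-≤-trans (enc<^ (Tape.head t ∷ Tape.right t)) (^-monoʳ-≤ (3 + μ) (m≤n+m (suc (length (Tape.right t))) (length (Tape.left t))))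

-- Deleting the segment between two equal configurations of a halting run
-- leaves a shorter run, so some halting time is at most the number of codes.
early : ∀ {K} (v : ℕ → ℕ) (P : ℕ → Set) → (∀ t → v t ≤ K) → (∀ a b s → v a ≡ v b → P (b + s) → P (a + s)) →
        ∀ n → P n → ∃ λ m → m ≤ suc K × P m
early {K} v P v≤ cut n = aux n (<-wellFounded n)
  where
  aux : ∀ n → Acc _<_ n → P n → ∃ λ m → m ≤ suc K × P m
  aux n (acc rs) p with n ≤? suc K
  ... | yes n≤ = n , n≤ , p
  ... | no n≰ with pigeonhole {suc K} {2 + K} ≤-refl (λ j → fromℕ< (s≤s (v≤ (toℕ j))))
  ... | a , b , a<b , eq = aux (toℕ a + s) (rs lt)
          (cut (toℕ a) (toℕ b) s (trans (sym (toℕ-fromℕ< _)) (trans (cong toℕ eq) (toℕ-fromℕ< _))) (subst P (sym b+s) p))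
    where
    s = n ∸ toℕ b
    b+s : toℕ b + s ≡ n
    b+s = m+[n∸m]≡n (<⇒≤ (<-≤-trans (toℕ<n b) (≰⇒> n≰)))
    lt : toℕ a + s < n
    lt = subst (toℕ a + s <_) b+s (+-monoˡ-< s a<b)

module Simulation {k l : ℕ} (M : OTM k l) where
  open OTM M

  Id : Set
  Id = TapeId k l works

  Act : Set
  Act = Action k l works marks states

  N d : ℕ
  N = tapeCount {k} {l} {works}
  d = suc (N + N)

  view : Config M → Vec ℕ d
  view (q ▸ t) = toℕ q ∷ (tabulateI (λ r → encL (get t r)) Vec.++ tabulateI (λ r → encE (get t r)))

  ixL ixE : Id → Fin d
  ixL r = suc (toI r ↑ˡ N)
  ixE r = suc (N ↑ʳ toI r)

  view-L : ∀ c r → lookup (view c) (ixL r) ≡ encL (get (Config.tapes c) r)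
  view-L (q ▸ t) r = trans (Vecₚ.lookup-++ˡ (tabulateI (λ r → encL (get t r))) (tabulateI (λ r → encE (get t r))) (toI r))
    (lookup-tabulateI (λ r → encL (get t r)) r)

  view-E : ∀ c r → lookup (view c) (ixE r) ≡ encE (get (Config.tapes c) r)
  view-E (q ▸ t) r = trans (Vecₚ.lookup-++ʳ (tabulateI (λ r → encL (get t r))) (tabulateI (λ r → encE (get t r))) (toI r))
    (lookup-tabulateI (λ r → encE (get t r)) r)

  Heads : Set
  Heads = Tapes k l works (Symbol marks)

  headsOf : Vec (Fin (3 + marks)) N → Heads
  headsOf ds = build (λ r → symOf (lookup ds (toI r)))

  -- The next action depends only on the state and the scanned symbols, so everything a step must
  -- know about it is a finite table applied to the lowest digits of the tape codes.
  lookupAction : (Fin states → Heads → ℕ) → Vec ℕ d → ℕ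
  lookupAction f v = at 0 (λ q → table (λ ds → f q (headsOf ds)) (tabulateI (λ r → topN {marks} (lookup v (ixE r))))) (lookup v zero)

  lookupAction-view : ∀ f c → lookupAction f (view c) ≡ f (Config.state c) (mapTapes Tape.head (Config.tapes c))
  lookupAction-view f c@(q ▸ t) = begin
    lookupAction f (view c)
      ≡⟨ at-toℕ 0 (λ q → table (λ ds → f q (headsOf ds)) (tabulateI (λ r → topN {marks} (lookup (view c) (ixE r))))) q ⟩
    table (λ ds → f q (headsOf ds)) (tabulateI (λ r → topN {marks} (lookup (view c) (ixE r))))
      ≡⟨ cong (table (λ ds → f q (headsOf ds))) (trans (tabulate-cong (λ j → trans (cong (topN {marks}) (view-E c (fromI j)))
           (topN-push (Tape.head (get t (fromI j))) (enc (Tape.right (get t (fromI j)))))))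
           (Vecₚ.tabulate-∘ toℕ (λ j → code (Tape.head (get t (fromI j)))))) ⟩
    table (λ ds → f q (headsOf ds)) (Vec.map toℕ (tabulateI (λ r → code (Tape.head (get t r)))))
      ≡⟨ table-toℕ (λ ds → f q (headsOf ds)) (tabulateI (λ r → code (Tape.head (get t r)))) ⟩
    f q (headsOf (tabulateI (λ r → code (Tape.head (get t r)))))
      ≡⟨ cong (f q) (trans (build-cong (λ r → trans (cong symOf (lookup-tabulateI (λ r → code (Tape.head (get t r))) r))
           (trans (symOf-code _) (sym (get-map Tape.head t r))))) (build-get (mapTapes Tape.head t))) ⟩
    f q (mapTapes Tape.head t) ∎
    where open ≡-Reasoning

  nextState : Fin states → Act → Fin states
  nextState q halt         = q
  nextState q (go q′ _)    = q′
  nextState q (query _ q′) = q′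

  -- An action other than `go` counts as rewriting the scanned symbols in place. One formula then
  -- describes every tape except an answer tape that is being filled.
  written : Heads → Act → Id → Symbol marks
  written hs (go _ ws) r = proj₁ (get ws r)
  written hs _         r = get hs r

  moved : Act → Id → Move
  moved (go _ ws) r = proj₂ (get ws r)
  moved _         r = stay

  asked : Fin k → Act → ℕ
  asked j (query j′ _) with j Finₚ.≟ j′
  ... | yes _ = 1
  ... | no  _ = 0
  asked j _            = 0

  halting : Act → ℕ
  halting halt        = 1
  halting (go _ _)    = 0
  halting (query _ _) = 0

  stateF : Fin states → Heads → ℕ
  stateF q hs = toℕ (nextState q (action q hs))

  writtenF movedF : Id → Fin states → Heads → ℕ
  writtenF r q hs = toℕ (code (written hs (action q hs) r))
  movedF r q hs   = toℕ (moveIx (moved (action q hs) r))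

  askedF : Fin k → Fin states → Heads → ℕ
  askedF j q hs = asked j (action q hs)

  haltingF : Fin states → Heads → ℕ
  haltingF q hs = halting (action q hs)

  writtenT movedT : Id → Vec ℕ d → ℕ
  writtenT r = lookupAction (writtenF r)
  movedT r   = lookupAction (movedF r)

  Shift : Set
  Shift = Fin 3 → ℕ → ℕ → ℕ → ℕ

  plain : Shift → Id → Vec ℕ d → ℕ
  plain sh r v = at 0 (λ m → sh m (writtenT r v) (lookup v (ixL r)) (lookup v (ixE r))) (movedT r v)

  -- An answer tape is the only kind of tape that can change elsewhere than at its head, namely when
  -- its oracle is asked; its code is then computed afresh by `ld`.
  stepOn : Shift → (Fin k → Vec StrFun k → Vec ℕ d → ℕ) → Id → Vec StrFun k → Vec ℕ d → ℕ
  stepOn sh ld (ansT j) fs v = if0 (lookupAction (askedF j) v) (plain sh (ansT j) v) (ld j fs v)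
  stepOn sh ld r        fs v = plain sh r v

  loadedE : Fin k → Vec StrFun k → Vec ℕ d → ℕ
  loadedE j fs v = loadN {marks} (apN (lookup fs j) (wordN {marks} (lookup v (ixE (qryT j)))))

  stepL stepE : Id → Vec StrFun k → Vec ℕ d → ℕ
  stepL = stepOn (shiftL {marks}) (λ _ _ _ → 0)
  stepE = stepOn (shiftE {marks}) loadedE

  step : Fin d → Vec StrFun k → Vec ℕ d → ℕ
  step zero    fs v = lookupAction stateF v
  step (suc j) fs v = [ (λ j → stepL (fromI j) fs v) , (λ j → stepE (fromI j) fs v) ]′ (splitAt N j)

  plainTape : Config M → Id → Tape marks
  plainTape c r = writeMove (written (mapTapes Tape.head (Config.tapes c)) (nextAction M c) r , moved (nextAction M c) r) (get (Config.tapes c) r)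

  Tracks : Shift → (Tape marks → ℕ) → Set
  Tracks sh e = ∀ s m t → e (writeMove (s , m) t) ≡ sh (moveIx m) (toℕ (code s)) (encL t) (encE t)

  plain-view : ∀ sh e → Tracks sh e → ∀ c r → plain sh r (view c) ≡ e (plainTape c r)
  plain-view sh e track c@(q ▸ t) r = begin
    plain sh r (view c)                         ≡⟨ cong (at 0 X) (lookupAction-view (movedF r) c) ⟩
    at 0 X (toℕ (moveIx mv))                    ≡⟨ at-toℕ 0 X (moveIx mv) ⟩
    X (moveIx mv)                               ≡⟨ cong₂ (λ w L → sh (moveIx mv) w L (lookup (view c) (ixE r))) (lookupAction-view (writtenF r) c) (view-L c r) ⟩
    sh (moveIx mv) (toℕ (code wr)) (encL (get t r)) (lookup (view c) (ixE r))
                                                ≡⟨ cong (sh (moveIx mv) (toℕ (code wr)) (encL (get t r))) (view-E c r) ⟩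
    sh (moveIx mv) (toℕ (code wr)) (encL (get t r)) (encE (get t r))
                                                ≡⟨ sym (track wr mv (get t r)) ⟩
    e (plainTape c r)                           ∎
    where
    open ≡-Reasoning
    mv = moved (nextAction M c) r
    wr = written (mapTapes Tape.head t) (nextAction M c) r
    X : Fin 3 → ℕ
    X m = sh m (writtenT r (view c)) (lookup (view c) (ixL r)) (lookup (view c) (ixE r))

  rewriteHead : ∀ (t : Tapes k l works (Tape marks)) r → writeMove (get (mapTapes Tape.head t) r , stay) (get t r) ≡ get t r
  rewriteHead t r = cong (λ s → writeMove (s , stay) (get t r)) (get-map Tape.head t r)

  perform-plain : ∀ fs q t a r → (∀ j q′ → a ≡ query j q′ → r ≢ ansT j) →
    get (Config.tapes (perform M fs (q ▸ t) a)) r ≡ writeMove (written (mapTapes Tape.head t) a r , moved a r) (get t r)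
  perform-plain fs q t halt         r p = sym (rewriteHead t r)
  perform-plain fs q t (go q′ ws)   r p = get-zip writeMove ws t r
  perform-plain fs q t (query j q′) r p = trans (aux r (p j q′ refl)) (sym (rewriteHead t r))
    where
    aux : ∀ r → r ≢ ansT j → get (ask M fs j t) r ≡ get t r
    aux (inT _)  p = refl
    aux outT     p = refl
    aux (qryT _) p = refl
    aux (ansT _) p = Vecₚ.lookup∘update′ (λ e → p (cong ansT e)) (Tapes.answers t) _
    aux (wrkT _) p = refl

  askedLoad : Vec StrFun k → Tapes k l works (Tape marks) → Fin k → Tape marks
  askedLoad fs t j = load (lookup fs j (word (get t (qryT j))))

  AskedCase : Vec StrFun k → Config M → Fin k → Set
  AskedCase fs c@(q ▸ t) j =
    (asked j (nextAction M c) ≡ 0 × get (Config.tapes (perform M fs c (nextAction M c))) (ansT j) ≡ plainTape c (ansT j)) ⊎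
    (asked j (nextAction M c) ≡ 1 × get (Config.tapes (perform M fs c (nextAction M c))) (ansT j) ≡ askedLoad fs t j)

  asked-case : ∀ fs c j → AskedCase fs c j
  asked-case fs c@(q ▸ t) j with nextAction M c in eq
  ... | halt      = inj₁ (refl , perform-plain fs q t halt (ansT j) (λ _ _ ()))
  ... | go q′ ws  = inj₁ (refl , perform-plain fs q t (go q′ ws) (ansT j) (λ _ _ ()))
  ... | query j′ q′ with j Finₚ.≟ j′
  ...   | yes refl = inj₂ (refl , Vecₚ.lookup∘update j (Tapes.answers t) _)
  ...   | no  j≢   = inj₁ (refl , perform-plain fs q t (query j′ q′) (ansT j) (λ { _ _ refl refl → j≢ refl }))

  after : Vec StrFun k → Config M → Config M
  after fs c = perform M fs c (nextAction M c)

  loadedE-view : ∀ fs c j → loadedE j fs (view c) ≡ encE (askedLoad fs (Config.tapes c) j)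
  loadedE-view fs c@(q ▸ t) j = trans (cong (λ w → loadN {marks} (num (lookup fs j w)))
      (trans (cong str (trans (cong (wordN {marks}) (view-E c (qryT j))) (wordN-correct (Tape.head qt ∷ Tape.right qt)))) (str-num (word qt))))
    (trans (loadN-correct (lookup fs j (word qt))) (sym (encE-load (lookup fs j (word qt)))))
    where
    qt = get t (qryT j)

  stepOn-view : ∀ sh {ld} e → Tracks sh e → (∀ fs c j → ld j fs (view c) ≡ e (askedLoad fs (Config.tapes c) j)) →
    ∀ fs c r → stepOn sh ld r fs (view c) ≡ e (get (Config.tapes (after fs c)) r)
  stepOn-view sh {ld} e track loaded fs c = cases
    where
    other : ∀ r → (∀ j → r ≢ ansT j) → plain sh r (view c) ≡ e (get (Config.tapes (after fs c)) r)
    other r p = trans (plain-view sh e track c r)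
      (cong e (sym (perform-plain fs (Config.state c) (Config.tapes c) (nextAction M c) r (λ j _ _ → p j))))
    cases : ∀ r → stepOn sh ld r fs (view c) ≡ e (get (Config.tapes (after fs c)) r)
    cases (inT j)  = other (inT j) λ _ ()
    cases outT     = other outT λ _ ()
    cases (qryT j) = other (qryT j) λ _ ()
    cases (wrkT j) = other (wrkT j) λ _ ()
    cases (ansT j) with asked-case fs c j
    ... | inj₁ (a , p) = trans (cong (λ n → if0 n (plain sh (ansT j) (view c)) (ld j fs (view c))) (trans (lookupAction-view (askedF j) c) a))
            (trans (plain-view sh e track c (ansT j)) (cong e (sym p)))
    ... | inj₂ (a , p) = trans (cong (λ n → if0 n (plain sh (ansT j) (view c)) (ld j fs (view c))) (trans (lookupAction-view (askedF j) c) a))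
            (trans (loaded fs c j) (cong e (sym p)))

  stepL-view : ∀ fs c r → stepL r fs (view c) ≡ encL (get (Config.tapes (after fs c)) r)
  stepL-view = stepOn-view shiftL encL shiftL-correct λ fs c j → sym (encL-load (lookup fs j (word (get (Config.tapes c) (qryT j)))))

  stepE-view : ∀ fs c r → stepE r fs (view c) ≡ encE (get (Config.tapes (after fs c)) r)
  stepE-view = stepOn-view shiftE {loadedE} encE shiftE-correct loadedE-view

  state-after : ∀ fs c → Config.state (after fs c) ≡ nextState (Config.state c) (nextAction M c)
  state-after fs c with nextAction M c
  ... | halt      = refl
  ... | go _ _    = refl
  ... | query _ _ = refl

  step-view : ∀ fs c j → step j fs (view c) ≡ lookup (view (after fs c)) j
  step-view fs c zero    = trans (lookupAction-view stateF c) (cong toℕ (sym (state-after fs c)))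
  step-view fs c (suc j) = trans (aux (splitAt N j)) (sym (Vecₚ.lookup-splitAt N (tabulateI Ls) (tabulateI Es) j))
    where
    Ls Es : Id → ℕ
    Ls r = encL (get (Config.tapes (after fs c)) r)
    Es r = encE (get (Config.tapes (after fs c)) r)
    aux : ∀ x → [ (λ j → stepL (fromI j) fs (view c)) , (λ j → stepE (fromI j) fs (view c)) ]′ x ≡ [ lookup (tabulateI Ls) , lookup (tabulateI Es) ]′ x
    aux (inj₁ j) = trans (stepL-view fs c (fromI j)) (sym (lookup∘tabulate (Ls ∘ fromI) j))
    aux (inj₂ j) = trans (stepE-view fs c (fromI j)) (sym (lookup∘tabulate (Es ∘ fromI) j))

-- Majorizing quasi-polynomials by lengths of Core values

g-mono : ∀ i {m n} → m ≤ n → g i m ≤ g i n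
g-mono zero          p = *-monoʳ-≤ 2 p
g-mono (suc zero)    p = *-mono-≤ p p
g-mono (suc (suc i)) p = ^-monoʳ-≤ 2 (g-mono (suc i) (⌈log₂⌉-mono-≤ p))

n≤2^⌈log₂n⌉ : ∀ n → n ≤ 2 ^ ⌈log₂ n ⌉
n≤2^⌈log₂n⌉ n = aux n (<-wellFounded n)
  where
  n≤2⌈n/2⌉ : ∀ n → n ≤ 2 * ⌈ n /2⌉
  n≤2⌈n/2⌉ n = subst (_≤ 2 * ⌈ n /2⌉) (⌊n/2⌋+⌈n/2⌉≡n n)
    (+-mono-≤ (⌊n/2⌋≤⌈n/2⌉ n) (≤-reflexive (sym (+-identityʳ _))))
  aux : ∀ n → Acc _<_ n → n ≤ 2 ^ ⌈log₂ n ⌉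
  aux zero          _        = z≤n
  aux (suc zero)    _        = ≤-refl
  aux n@(suc (suc m)) (acc rs) = begin
    n                                    ≤⟨ n≤2⌈n/2⌉ n ⟩
    2 * ⌈ n /2⌉                          ≤⟨ *-monoʳ-≤ 2 (aux ⌈ n /2⌉ (rs (⌈n/2⌉<n m))) ⟩
    2 * 2 ^ ⌈log₂ ⌈ n /2⌉ ⌉              ≡⟨ cong (λ L → 2 ^ suc L) (⌈log₂⌈n/2⌉⌉≡⌈log₂n⌉∸1 n) ⟩
    2 ^ suc (⌈log₂ n ⌉ ∸ 1)              ≡⟨ cong (2 ^_) (m+[n∸m]≡n (⌈log₂⌉-mono-≤ {2} {n} (s≤s (s≤s z≤n)))) ⟩
    2 ^ ⌈log₂ n ⌉                        ∎
    where open ≤-Reasoning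

-- With L = ⌈log n⌉ ≥ 2, n² ≤ 2^(2L) ≤ 2^(L²), and the induction hypothesis at L finishes. Products
-- of lengths in quasi-polynomials are majorized through this; g₀ could not do it.
g-square : ∀ i → 1 ≤ i → ∃ λ c → ∀ n → c ≤ n → n * n ≤ g i n
g-square (suc zero)    _ = 0 , λ n _ → ≤-refl
g-square (suc (suc i)) _ with g-square (suc i) (s≤s z≤n)
-- The threshold makes L at least c, for the induction hypothesis, and at least 2, for 2L ≤ L².
... | c , h = 2 ^ (c ⊔ 2) , λ n p → let L = ⌈log₂ n ⌉ in begin
    n * n                    ≤⟨ *-mono-≤ (n≤2^⌈log₂n⌉ n) (n≤2^⌈log₂n⌉ n) ⟩
    2 ^ L * 2 ^ L            ≡⟨ sym (^-distribˡ-+-* 2 L L) ⟩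
    2 ^ (L + L)              ≡⟨ cong (λ e → 2 ^ (L + e)) (sym (+-identityʳ L)) ⟩
    2 ^ (2 * L)              ≤⟨ ^-monoʳ-≤ 2 (*-monoˡ-≤ L (≤-trans (m≤n⊔m c 2) (big n p))) ⟩
    2 ^ (L * L)              ≤⟨ ^-monoʳ-≤ 2 (h L (≤-trans (m≤m⊔n c 2) (big n p))) ⟩
    2 ^ g (suc i) L          ∎
  where
  open ≤-Reasoning
  big : ∀ n → 2 ^ (c ⊔ 2) ≤ n → c ⊔ 2 ≤ ⌈log₂ n ⌉
  big n p = subst (_≤ ⌈log₂ n ⌉) (⌈log₂2^n⌉≡n (c ⊔ 2)) (⌈log₂⌉-mono-≤ p)

strings-length : ∀ n → All (λ w → length w ≤ n) (strings≤ n)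
strings-length zero    = z≤n ∷ []
strings-length (suc n) = z≤n ∷ Allₚ.++⁺ (Allₚ.map⁺ (All.map s≤s (strings-length n))) (Allₚ.map⁺ (All.map s≤s (strings-length n)))

-- The argument at most n at which f has the largest value.  Unlike the value,
-- it is bounded independently of f, as bounded recursion requires.
best : StrFun → ℕ → ℕ
best f = rec 0 (λ m a → if0 (apN f a ∸ apN f (suc m)) (suc m) a)

best≤ : ∀ f n → best f n ≤ n
best≤ f zero    = ≤-refl
best≤ f (suc n) with apN f (best f n) ∸ apN f (suc n)
... | zero  = ≤-refl
... | suc _ = m≤n⇒m≤1+n (best≤ f n)

best-max : ∀ f n m → m ≤ n → apN f m ≤ apN f (best f n)
best-max f zero    .zero z≤n = ≤-refl
best-max f (suc n) m p with apN f (best f n) ≤? apN f (suc n) | m≤n⇒m<n∨m≡n p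
... | yes q | inj₁ m<  = subst (λ a → apN f m ≤ apN f a) (sym (if0-≤ q _ _)) (≤-trans (best-max f n m (s≤s⁻¹ m<)) q)
... | yes q | inj₂ refl = subst (λ a → apN f m ≤ apN f a) (sym (if0-≤ q _ _)) ≤-refl
... | no ¬q | inj₁ m<  = subst (λ a → apN f m ≤ apN f a) (sym (if0-> (≰⇒> ¬q) _ _)) (best-max f n m (s≤s⁻¹ m<))
... | no ¬q | inj₂ refl = subst (λ a → apN f m ≤ apN f a) (sym (if0-> (≰⇒> ¬q) _ _)) (<⇒≤ (≰⇒> ¬q))

bestC : ∀ {i k l} j {f : Fn k l} → Core i k f → Core i k (λ fs ns → best (lookup fs j) (f fs ns))
bestC j p = recC (constC 0) (if0C (∸C (apC₁ j (proj (suc zero))) (apC₁ j (sucC₁ (proj zero)))) (sucC₁ (proj zero)) (proj (suc zero)))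
  (proj zero) (λ fs n ns → best≤ (lookup fs j) n) p

-- `pad z z` is longer than z, so every word of length at most `len z` comes before it in the
-- enumeration and takes part in the search of `best`. A greatest number among the values also has
-- the greatest length.
funLength≤best : ∀ f {p z} → p ≤ len z → funLength f p ≤ len (apN f (best f (pad z z)))
funLength≤best f {p} {z} q = max≤v⁺ z≤n (Allₚ.map⁺ (All.map small (strings-length p)))
  where
  small : ∀ {w} → length w ≤ p → length (f w) ≤ len (apN f (best f (pad z z)))
  small {w} r = length-mono (≤-trans
      (subst (λ v → num (f v) ≤ apN f (best f (pad z z))) (str-num w)
        (best-max f (pad z z) (num w) (length<⇒num≤ w (pad z z) (subst (length w <_) (sym (len-pad z z)) (s≤s (≤-trans r (≤-trans q (m≤m+n _ _))))))))
      (≤-reflexive (sym (num-str _))))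

-- Space is measured against the length of a value in `Core`, not against the value: the codes of
-- configurations, exponential in the space, are then polynomial in `Z`.
Dominated : ∀ (i k : ℕ) {l} → (Vec StrFun k → Vec ℕ l → ℕ) → Set
Dominated i k {l} S = ∃ λ (Z : Fn k l) → Core (just i) k Z × (∀ fs ns → S fs ns ≤ len (Z fs ns))

dominate : ∀ i → 1 ≤ i → ∀ {k l} (P : QuasiPoly k l) →
           Dominated i k (λ fs ns → eval i P (Vec.map funLength fs) (Vec.map length (Vec.map str ns)))
dominate i 1≤i (const c) = _ , constC (num (ones c)) , λ fs ns → ≤-reflexive (sym (len-num-ones c))
dominate i 1≤i (var j)   = _ , proj j , λ fs ns → ≤-reflexive (trans (lookup-map j length (Vec.map str ns)) (cong length (lookup-map j str ns)))
dominate i 1≤i (P ⊕ Q) with dominate i 1≤i P | dominate i 1≤i Q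
... | Y , p , y | Z , q , z = _ , padC₂ p q , λ fs ns →
      ≤-trans (+-mono-≤ (y fs ns) (z fs ns)) (≤-trans (n≤1+n _) (≤-reflexive (sym (len-pad (Y fs ns) (Z fs ns)))))
-- The argument of the growth function is padded with `ones c`, so that it is longer than both
-- factors and past the threshold `c` from which squares are dominated.
dominate i 1≤i (P ⊗ Q) with dominate i 1≤i P | dominate i 1≤i Q | g-square i 1≤i
... | Y , p , y | Z , q , z | c , sq = _ , growC₁ refl (padC₂ (padC₂ p q) (constC (num (ones c)))) , λ fs ns →
  let a = len (Y fs ns); b = len (Z fs ns)
      X = pad (pad (Y fs ns) (Z fs ns)) (num (ones c))
      eq : len X ≡ suc (suc (a + b) + c)
      eq = trans (len-pad _ _) (cong suc (cong₂ _+_ (len-pad (Y fs ns) (Z fs ns)) (len-num-ones c)))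
      ab≤ : a + b ≤ len X
      ab≤ = subst (a + b ≤_) (sym eq) (≤-trans (n≤1+n _) (≤-trans (m≤m+n _ c) (n≤1+n _)))
      c≤ : c ≤ len X
      c≤ = subst (c ≤_) (sym eq) (≤-trans (m≤n+m c (suc (a + b))) (n≤1+n _))
  in ≤-trans (*-mono-≤ (≤-trans (y fs ns) (≤-trans (m≤m+n a b) ab≤)) (≤-trans (z fs ns) (≤-trans (m≤n+m b a) ab≤)))
       (≤-trans (sq (len X) c≤) (≤-reflexive (sym (len-num-ones _))))
dominate i 1≤i (app j P) with dominate i 1≤i P
... | Z , p , z = _ , apC₁ j (bestC j (padC₂ p p)) , λ fs ns →
      ≤-trans (≤-reflexive (cong-app (lookup-map j funLength fs) _)) (funLength≤best (lookup fs j) (z fs ns))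
dominate i 1≤i (grow P) with dominate i 1≤i P
... | Z , p , z = _ , growC₁ refl p , λ fs ns → ≤-trans (g-mono i (z fs ns)) (≤-reflexive (sym (len-num-ones _)))

-- Functionals of space-bounded machines belong to Core

fromFunctional : ∀ {k l} → Functional k l → Fn k l
fromFunctional F fs ns = num (F fs (Vec.map str ns))

configAt-halted : ∀ {k l} (M : OTM k l) fs xs {m} → Halted M (configAt M fs xs m) → ∀ s → configAt M fs xs (s + m) ≡ configAt M fs xs m
configAt-halted M fs xs h zero    = refl
configAt-halted M fs xs {m} h (suc s) = trans (cong (λ c → perform M fs c (nextAction M c)) (configAt-halted M fs xs {m} h s))
  (cong (perform M fs (configAt M fs xs m)) h)

module SimulationCore {i : Maybe ℕ} {k l : ℕ} (M : OTM k l) where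
  open OTM M
  open Simulation M

  lookupActionC : ∀ f → Core i k {d} (λ fs v → lookupAction f v)
  lookupActionC f = atC (constC 0) (proj zero) λ q → tableC (λ ds → f q (headsOf ds)) λ j → topC {marks} (proj (ixE (fromI j)))

  module _ (r : Id) where

    private
      w : Core i k {d} (λ fs v → writtenT r v)
      w = lookupActionC (writtenF r)
      L : Core i k {d} (λ fs v → lookup v (ixL r))
      L = proj (ixL r)
      E : Core i k {d} (λ fs v → lookup v (ixE r))
      E = proj (ixE r)

    plainC : ∀ sh → (∀ m → Core i k {d} (λ fs v → sh m (writtenT r v) (lookup v (ixL r)) (lookup v (ixE r)))) → Core i k {d} (λ fs v → plain sh r v)
    plainC sh p = atC {f = λ m fs v → sh m (writtenT r v) (lookup v (ixL r)) (lookup v (ixE r))} (constC 0) (lookupActionC (movedF r)) p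

    plainLC : Core i k {d} (λ fs v → plain (shiftL {marks}) r v)
    plainLC = plainC shiftL λ { zero → popC {marks} L ; (suc zero) → L ; (suc (suc zero)) → pushC {marks} w L }

    plainEC : Core i k {d} (λ fs v → plain (shiftE {marks}) r v)
    plainEC = plainC shiftE λ { zero → pushC {marks} (topC {marks} L) (pushC {marks} w (popC {marks} E))
                              ; (suc zero) → pushC {marks} w (popC {marks} E) ; (suc (suc zero)) → popC {marks} E }

  stepOnC : ∀ {sh ld} → (∀ r → Core i k {d} (λ fs v → plain sh r v)) → (∀ j → Core i k {d} (λ fs v → ld j fs v)) →
    ∀ r → Core i k {d} (λ fs v → stepOn sh ld r fs v)
  stepOnC p q (inT j)  = p (inT j)
  stepOnC p q outT     = p outT
  stepOnC p q (qryT j) = p (qryT j)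
  stepOnC p q (wrkT j) = p (wrkT j)
  stepOnC p q (ansT j) = if0C (lookupActionC (askedF j)) (p (ansT j)) (q j)

  stepC : ∀ j → Core i k {d} (λ fs v → step j fs v)
  stepC zero    = lookupActionC stateF
  stepC (suc j) with splitAt N j
  ... | inj₁ j′ = stepOnC plainLC (λ _ → constC 0) (fromI j′)
  ... | inj₂ j′ = stepOnC plainEC (λ j → loadC {marks} (apC₁ j (wordC {marks} (proj (ixE (qryT j)))))) (fromI j′)

  initE : Vec ℕ l → Id → ℕ
  initE ns (inT j) = loadN {marks} (lookup ns j)
  initE ns _       = 0

  init : Fin d → Vec ℕ l → ℕ
  init zero    ns = toℕ start
  init (suc j) ns = [ (λ _ → 0) , (λ j → initE ns (fromI j)) ]′ (splitAt N j)

  initC : ∀ j → Core i k (λ fs ns → init j ns)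
  initC zero    = constC (toℕ start)
  initC (suc j) with splitAt N j
  ... | inj₁ j′ = constC 0
  ... | inj₂ j′ = initEC (fromI j′)
    where
    initEC : ∀ r → Core i k (λ fs ns → initE ns r)
    initEC (inT j)  = loadC {marks} (proj j)
    initEC outT     = constC 0
    initEC (qryT j) = constC 0
    initEC (ansT j) = constC 0
    initEC (wrkT j) = constC 0

  init-view : ∀ ns j → init j ns ≡ lookup (view (initial M (Vec.map str ns))) j
  init-view ns zero    = refl
  init-view ns (suc j) = trans (aux (splitAt N j)) (sym (Vecₚ.lookup-splitAt N (tabulateI Ls) (tabulateI Es) j))
    where
    t = Config.tapes (initial M (Vec.map str ns))
    Ls Es : Id → ℕ
    Ls r = encL (get t r)
    Es r = encE (get t r)
    L0 : ∀ r → 0 ≡ Ls r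
    L0 (inT j)  = sym (trans (cong (encL {marks}) (lookup-map j (load {marks}) (Vec.map str ns))) (encL-load (lookup (Vec.map str ns) j)))
    L0 outT     = refl
    L0 (qryT j) = cong (encL {marks}) (sym (lookup-replicate j (load {marks} [])))
    L0 (ansT j) = cong (encL {marks}) (sym (lookup-replicate j (load {marks} [])))
    L0 (wrkT j) = cong (encL {marks}) (sym (lookup-replicate j (load {marks} [])))
    E0 : ∀ r → initE ns r ≡ Es r
    E0 (inT j)  = trans (cong (loadN {marks}) (sym (num-str (lookup ns j)))) (trans (loadN-correct {marks} (str (lookup ns j)))
      (sym (trans (cong (encE {marks}) (trans (lookup-map j (load {marks}) (Vec.map str ns)) (cong (load {marks}) (lookup-map j str ns)))) (encE-load (str (lookup ns j))))))
    E0 outT     = sym (encE-load {marks} [])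
    E0 (qryT j) = sym (trans (cong (encE {marks}) (lookup-replicate j (load {marks} []))) (encE-load {marks} []))
    E0 (ansT j) = sym (trans (cong (encE {marks}) (lookup-replicate j (load {marks} []))) (encE-load {marks} []))
    E0 (wrkT j) = sym (trans (cong (encE {marks}) (lookup-replicate j (load {marks} []))) (encE-load {marks} []))
    aux : ∀ x → [ (λ _ → 0) , (λ j → initE ns (fromI j)) ]′ x ≡ [ lookup (tabulateI Ls) , lookup (tabulateI Es) ]′ x
    aux (inj₁ j) = trans (L0 (fromI j)) (sym (lookup∘tabulate (Ls ∘ fromI) j))
    aux (inj₂ j) = trans (E0 (fromI j)) (sym (lookup∘tabulate (Es ∘ fromI) j))

  view≤ : ∀ c {S B} → space M c ≤ S → (3 + marks) ^ S ≤ B → states ≤ B → ∀ j → lookup (view c) j ≤ B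
  view≤ c p q r zero    = ≤-trans (<⇒≤ (toℕ<n (Config.state c))) r
  view≤ c@(s ▸ t) {S} {B} p q r (suc j) = subst (_≤ B) (sym (Vecₚ.lookup-splitAt N (tabulateI Ls) (tabulateI Es) j)) (aux (splitAt N j))
    where
    Ls Es : Id → ℕ
    Ls r = encL (get t r)
    Es r = encE (get t r)
    cells≤ : ∀ r → (3 + marks) ^ cells (get t r) ≤ B
    cells≤ r = ≤-trans (^-monoʳ-≤ (3 + marks) (≤-trans (subst (_≤ space M c) (get-map cells t r) (get≤total (mapTapes cells t) r)) p)) q
    aux : ∀ x → [ lookup (tabulateI Ls) , lookup (tabulateI Es) ]′ x ≤ B
    aux (inj₁ j) = subst (_≤ B) (sym (lookup∘tabulate (Ls ∘ fromI) j)) (≤-trans (<⇒≤ (encL<^ (get t (fromI j)))) (cells≤ (fromI j)))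
    aux (inj₂ j) = subst (_≤ B) (sym (lookup∘tabulate (Es ∘ fromI) j)) (≤-trans (<⇒≤ (encE<^ (get t (fromI j)))) (cells≤ (fromI j)))

  view-halted : ∀ c c′ → view c ≡ view c′ → Halted M c → Halted M c′
  view-halted c c′ eq h = aux (nextAction M c′)
      (trans (sym (lookupAction-view haltingF c′)) (trans (cong (lookupAction haltingF) (sym eq)) (trans (lookupAction-view haltingF c) (cong halting h))))
    where
    aux : ∀ a → halting a ≡ 1 → a ≡ halt
    aux halt _ = refl

  module _ {F : Functional k l} {S : Vec StrFun k → Vec Str l → ℕ} (computes : Computes M F) (inSpace : RunsInSpace M S)
           {Z : Fn k l} (Z-core : Core i k Z) (Z-bound : ∀ fs ns → S fs (Vec.map str ns) ≤ len (Z fs ns)) where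

    -- Tape codes are below (3 + marks)^S with S ≤ `len (Z fs ns)`, which `loadBound` covers; the
    -- summand `states` covers the state. Every code of a configuration is thus less than `time`,
    -- which is exactly the time bound that `early` gives.
    bound time : Fn k l
    bound fs ns = loadBound {marks} (Z fs ns) + states
    time fs ns = suc (encVec (tabulate {n = d} λ _ → bound fs ns))

    boundC : Core i k bound
    boundC = +C (^C (sucC₁ Z-core) (3 + marks)) (constC states)

    timeC : Core i k time
    timeC = sucC₁ (encVecC {d = d} (λ _ → boundC))

    final : Fn k l
    final fs ns = wordN {marks} (lookup (run (bound fs ns) (λ j → init j ns) (λ j → step j fs) (time fs ns)) (ixE outT))

    module _ (fs : Vec StrFun k) (ns : Vec ℕ l) where

      private
        xs = Vec.map str ns
        C : ℕ → Config M
        C = configAt M fs xs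
        v : ℕ → Vec ℕ d
        v = run (bound fs ns) (λ j → init j ns) (λ j → step j fs)

      run-view : ∀ t → v t ≡ view (C t)
      run-view = run-exact (view ∘ C) (init-view ns) (λ t → step-view fs (C t))
        λ t → view≤ (C t) (≤-trans (inSpace fs xs t) (Z-bound fs ns)) (≤-trans (β^≤ {marks} {w = Z fs ns} ≤-refl) (m≤m+n _ states)) (m≤n+m states _)

      halts-early : ∃ λ m → m ≤ time fs ns × Halted M (C m)
      halts-early with computes fs xs
      ... | _ , n , _ , h , _ = early (encVec ∘ v) (Halted M ∘ C) (encVec-run≤ (bound fs ns) (λ j → init j ns) (λ j → step j fs)) cut n h
        where
        v-cong : ∀ {a b} → v a ≡ v b → ∀ s → v (s + a) ≡ v (s + b)
        v-cong e zero    = e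
        v-cong e (suc s) = cong (λ u → tabulate λ j → step j fs u ⊓ bound fs ns) (v-cong e s)
        cut : ∀ a b s → encVec (v a) ≡ encVec (v b) → Halted M (C (b + s)) → Halted M (C (a + s))
        cut a b s e = view-halted (C (b + s)) (C (a + s)) (trans (sym (run-view (b + s))) (trans
          (cong v (+-comm b s)) (trans (sym (v-cong {a} {b} (trans (sym (decVec-encVec (v a))) (trans (cong decVec e) (decVec-encVec (v b)))) s))
            (trans (cong v (+-comm s a)) (run-view (a + s))))))

      result-at-time : result M (C (time fs ns)) ≡ F fs xs
      result-at-time with halts-early | computes fs xs
      ... | m , m≤ , h | _ , n , _ , h′ , eq = trans (cong (result M) C≡) eq
        where
        T = time fs ns
        T≡ : C T ≡ C m
        T≡ = trans (cong C (sym (m∸n+n≡m m≤))) (configAt-halted M fs xs h (T ∸ m))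
        C≡ : C T ≡ C n
        C≡ = trans (sym (configAt-halted M fs xs {T} (subst (Halted M) (sym T≡) h) n))
               (trans (cong C (+-comm n T)) (configAt-halted M fs xs h′ T))

      final-correct : final fs ns ≡ fromFunctional F fs ns
      final-correct = trans (cong (λ u → wordN {marks} (lookup u (ixE outT))) (run-view (time fs ns)))
        (trans (cong (wordN {marks}) (view-E (C (time fs ns)) outT))
          (trans (wordN-correct {marks} (Tape.head o ∷ Tape.right o)) (cong num result-at-time)))
        where
        o = Tapes.output (Config.tapes (C (time fs ns)))

    simulateC : Core i k (fromFunctional F)
    simulateC = ext (λ fs ns → sym (final-correct fs ns)) (wordC {marks} (runC initC stepC boundC timeC (ixE outT)))

QPS⇒Core : ∀ {i} → 1 ≤ i → ∀ {k l} {F : Functional k l} → QuasiPolySpace i F → Core (just i) k (fromFunctional F)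
QPS⇒Core {i} 1≤i (M , P , computes , inSpace) with dominate i 1≤i P
... | Z , Z-core , Z-bound = SimulationCore.simulateC M computes inSpace Z-core Z-bound

-- Feasible functionals are numerical functionals

sumP : ∀ {k l m} → (Fin m → QuasiPoly k l) → QuasiPoly k l
sumP {m = zero}  f = const 0
sumP {m = suc m} f = f zero ⊕ sumP (f ∘ suc)

eval-sumP : ∀ i {k l m} (f : Fin m → QuasiPoly k l) Ls ns → eval i (sumP f) Ls ns ≡ Vec.sum (tabulate λ j → eval i (f j) Ls ns)
eval-sumP i {m = zero}  f Ls ns = refl
eval-sumP i {m = suc m} f Ls ns = cong (eval i (f zero) Ls ns +_) (eval-sumP i (f ∘ suc) Ls ns)

polyP : ∀ {k l} → List ℕ → QuasiPoly k l → QuasiPoly k l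
polyP []      P = const 0
polyP (c ∷ p) P = const c ⊕ (P ⊗ polyP p P)

eval-polyP : ∀ i {k l} p (P : QuasiPoly k l) Ls ns → eval i (polyP p P) Ls ns ≡ evalPoly p (eval i P Ls ns)
eval-polyP i []      P Ls ns = refl
eval-polyP i (c ∷ p) P Ls ns = cong (λ r → c + eval i P Ls ns * r) (eval-polyP i p P Ls ns)

cells-load : ∀ {μ} w → cells (load {μ} w) ≤ suc (length w)
cells-load []      = ≤-refl
cells-load (b ∷ w) = ≤-trans (s≤s (≤-reflexive (length-map bit w))) (n≤1+n _)

cells-writeMove : ∀ {μ} x (t : Tape μ) → cells (writeMove x t) ≤ suc (cells t)
cells-writeMove (s , goLeft)  ⟨ [] , h , rs ⟩     = ≤-refl
cells-writeMove (s , goLeft)  ⟨ l ∷ ls , h , rs ⟩ = ≤-trans (≤-reflexive (+-suc (length ls) (suc (length rs)))) (n≤1+n _)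
cells-writeMove (s , stay)    t                   = n≤1+n _
cells-writeMove (s , goRight) ⟨ ls , h , [] ⟩     = ≤-refl
cells-writeMove (s , goRight) ⟨ ls , h , r ∷ rs ⟩ = ≤-trans (≤-reflexive (sym (+-suc (length ls) (suc (length rs))))) (n≤1+n _)

lookup≤sum-map : ∀ {A : Set} {n} (f : A → ℕ) (v : Vec A n) j → f (lookup v j) ≤ Vec.sum (Vec.map f v)
lookup≤sum-map f (x ∷ v) zero    = m≤m+n _ _
lookup≤sum-map f (x ∷ v) (suc j) = ≤-trans (lookup≤sum-map f v j) (m≤n+m _ (f x))

module _ {l : ℕ} (M : OTM 0 l) where
  open OTM M

  initial-cells : ∀ xs r → cells (get (Config.tapes (initial M xs)) r) ≤ suc (Vec.sum (Vec.map length xs))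
  initial-cells xs (inT j)  = subst (λ t → cells t ≤ _) (sym (lookup-map j load xs))
    (≤-trans (cells-load (lookup xs j)) (s≤s (lookup≤sum-map length xs j)))
  initial-cells xs outT     = s≤s z≤n
  initial-cells xs (wrkT j) = subst (λ t → cells t ≤ _) (sym (lookup-replicate j (load {marks} []))) (s≤s z≤n)

  -- Without oracles every step acts on each tape as a `writeMove`, which adds at most one cell.
  cells-configAt : ∀ xs n r → cells (get (Config.tapes (configAt M [] xs n)) r) ≤ n + suc (Vec.sum (Vec.map length xs))
  cells-configAt xs zero    r = initial-cells xs r
  cells-configAt xs (suc n) r = subst (λ t → cells t ≤ _)
    (sym (Simulation.perform-plain M [] (Config.state c) (Config.tapes c) (nextAction M c) r λ ()))
    (≤-trans (cells-writeMove (Simulation.written M (mapTapes Tape.head (Config.tapes c)) (nextAction M c) r , Simulation.moved M (nextAction M c) r) (get (Config.tapes c) r)) (s≤s (cells-configAt xs n r)))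
    where
    c = configAt M [] xs n

-- Up to the halting time a tape gains at most one cell per step. Space is charged at later times as
-- well, but the configuration no longer changes then.
PolyTime⇒QPS : ∀ i {l} {F : Functional 0 l} → PolyTime F → QuasiPolySpace i F
PolyTime⇒QPS i {l} {F} (M , p , halts) = M , P , computes , inSpace
  where
  open OTM M
  X P : QuasiPoly 0 l
  X = sumP var
  P = const (tapeCount {0} {l} {works}) ⊗ (polyP p X ⊕ (const 1 ⊕ X))
  eval-X : ∀ xs → eval i X (Vec.map funLength []) (Vec.map length xs) ≡ Vec.sum (Vec.map length xs)
  eval-X xs = trans (eval-sumP i var [] (Vec.map length xs)) (cong Vec.sum (tabulate∘lookup (Vec.map length xs)))
  eval-P : ∀ xs → eval i P (Vec.map funLength []) (Vec.map length xs) ≡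
    tapeCount {0} {l} {works} * (evalPoly p (Vec.sum (Vec.map length xs)) + suc (Vec.sum (Vec.map length xs)))
  eval-P xs = cong₂ (λ a b → tapeCount {0} {l} {works} * (a + suc b))
    (trans (eval-polyP i p X [] (Vec.map length xs)) (cong (evalPoly p) (eval-X xs))) (eval-X xs)
  computes : Computes M F
  computes [] xs = _ , halts xs
  inSpace : RunsInSpace M (λ fs xs → eval i P (Vec.map funLength fs) (Vec.map length xs))
  inSpace [] xs n with halts xs
  ... | m , m≤ , h , _ = subst (space M (configAt M [] xs n) ≤_) (sym (eval-P xs)) (total≤ _ _ λ r →
        subst (_≤ T + suc S) (sym (get-map cells (Config.tapes (configAt M [] xs n)) r)) (aux r))
    where
    S = Vec.sum (Vec.map length xs)
    T = evalPoly p S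
    aux : ∀ r → cells (get (Config.tapes (configAt M [] xs n)) r) ≤ T + suc S
    aux r with ≤-total n m
    ... | inj₁ n≤m = ≤-trans (cells-configAt M xs n r) (+-monoˡ-≤ (suc S) (≤-trans n≤m m≤))
    ... | inj₂ m≤n = subst (λ c → cells (get (Config.tapes c) r) ≤ T + suc S)
      (sym (trans (cong (configAt M [] xs) (sym (m∸n+n≡m m≤n))) (configAt-halted M [] xs {m} h (n ∸ m))))
      (≤-trans (cells-configAt M xs m r) (+-monoˡ-≤ (suc S) m≤))

compV : ∀ {i k l m} {H : Fn k m} → Core i k H → (v : Vec StrFun k → Vec ℕ l → Vec ℕ m) →
        (∀ j → Core i k (λ fs ns → lookup (v fs ns) j)) → Core i k (λ fs ns → H fs (v fs ns))
compV {H = H} p v q = ext (λ fs ns → cong (H fs) (sym (tabulate∘lookup (v fs ns)))) (comp p q)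

-- The recursion variable stands last in the class and first in `Core`; this splitting of indices
-- serves to move it.
snocIx : ∀ {l} → Fin (suc l) → Fin l ⊎ ⊤
snocIx {zero}  j       = inj₂ tt
snocIx {suc l} zero    = inj₁ zero
snocIx {suc l} (suc j) = [ inj₁ ∘ suc , inj₂ ]′ (snocIx j)

lookup-snocIx : ∀ {A : Set} {l} (v : Vec A l) x j → lookup (v Vec.∷ʳ x) j ≡ [ lookup v , (λ _ → x) ]′ (snocIx j)
lookup-snocIx []      x zero    = refl
lookup-snocIx (y ∷ v) x zero    = refl
lookup-snocIx (y ∷ v) x (suc j) with snocIx j | lookup-snocIx v x j
... | inj₁ _ | e = e
... | inj₂ _ | e = e

snocC : ∀ {i k l m} {v : Vec StrFun k → Vec ℕ l → Vec ℕ m} {x : Fn k l} →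
        (∀ j → Core i k (λ fs ns → lookup (v fs ns) j)) → Core i k x → ∀ j → Core i k (λ fs ns → lookup (v fs ns Vec.∷ʳ x fs ns) j)
snocC {i} {k} {l} {m} {v} {x} p q j = ext (λ fs ns → lookup-snocIx (v fs ns) (x fs ns) j) (aux (snocIx j))
  where
  aux : ∀ s → Core i k (λ fs ns → [ lookup (v fs ns) , (λ _ → x fs ns) ]′ s)
  aux (inj₁ j) = p j
  aux (inj₂ _) = q

lookup-fromℕ : ∀ {A : Set} {l} (v : Vec A l) x → lookup (v Vec.∷ʳ x) (Fin.fromℕ l) ≡ x
lookup-fromℕ []      x = refl
lookup-fromℕ (y ∷ v) x = lookup-fromℕ v x

lookup-inject₁ : ∀ {A : Set} {l} (v : Vec A l) x j → lookup (v Vec.∷ʳ x) (Fin.inject₁ j) ≡ lookup v j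
lookup-inject₁ (y ∷ v) x zero    = refl
lookup-inject₁ (y ∷ v) x (suc j) = lookup-inject₁ v x j

tabulate-inject₁ : ∀ {A : Set} {l} (v : Vec A l) x → tabulate (λ j → lookup (v Vec.∷ʳ x) (Fin.inject₁ j)) ≡ v
tabulate-inject₁ v x = trans (tabulate-cong (lookup-inject₁ v x)) (tabulate∘lookup v)

-- The number of oracles is fixed throughout a derivation in `Core`, whereas expansion changes it.
-- The change is pushed down to the occurrences of `apC`.
oraclesC : ∀ {i k k′ l} {F : Fn k l} (ρ : Fin k → Fin k′) → Core i k F → Core i k′ (λ fs ns → F (tabulate (lookup fs ∘ ρ)) ns)
oraclesC ρ zeroC    = zeroC
oraclesC ρ sucC     = sucC
oraclesC ρ padC     = padC
oraclesC ρ (growC e) = growC e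
oraclesC ρ (apC j)  = ext (λ fs ns → cong (λ f → apN f (lookup ns zero)) (lookup∘tabulate (lookup fs ∘ ρ) j)) (apC (ρ j))
oraclesC ρ (proj j) = proj j
oraclesC ρ (comp p q) = comp (oraclesC ρ p) (λ j → oraclesC ρ (q j))
oraclesC ρ (recur p q r b) = recur (oraclesC ρ p) (oraclesC ρ q) (oraclesC ρ r) (λ fs n ns → b (tabulate (lookup fs ∘ ρ)) n ns)
oraclesC ρ (ext e p) = ext (λ fs ns → e (tabulate (lookup fs ∘ ρ)) ns) (oraclesC ρ p)

map-str-num : ∀ {l} (xs : Vec Str l) → Vec.map str (Vec.map num xs) ≡ xs
map-str-num xs = trans (sym (Vecₚ.map-∘ str num xs)) (trans (Vecₚ.map-cong str-num xs) (Vecₚ.map-id xs))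

BFSF⇒Core : ∀ {i} → 1 ≤ i → ∀ {k l} {F : Functional k l} → BFSF i ∅ F → Core (just i) k (fromFunctional F)
BFSF⇒Core {i} 1≤i {F = F} (polyTime p) = QPS⇒Core 1≤i {F = F} (PolyTime⇒QPS i {F = F} p)
BFSF⇒Core 1≤i growth = ext (λ { fs (n ∷ []) → refl }) (growC refl)
BFSF⇒Core 1≤i application = ext (λ { (f ∷ []) (n ∷ []) → refl }) (apC zero)
BFSF⇒Core 1≤i (composition H Gs p q e) =
  ext (λ fs ns → cong num (trans (e fs (Vec.map str ns))
        (cong (H fs) (trans (tabulate-cong λ j → sym (str-num (Gs j fs (Vec.map str ns)))) (Vecₚ.tabulate-∘ str (λ j → fromFunctional (Gs j) fs ns))))))
    (comp (BFSF⇒Core 1≤i p) (λ j → BFSF⇒Core 1≤i (q j)))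
BFSF⇒Core 1≤i (expansion G σ τ p e) =
  ext (λ fs ns → cong num (trans (e fs (Vec.map str ns)) (cong (G (select σ fs))
        (trans (tabulate-cong λ j → lookup-map (Injection.to τ j) str ns) (Vecₚ.tabulate-∘ str (λ j → lookup ns (Injection.to τ j)))))))
    (rename (Injection.to τ) (oraclesC (Injection.to σ) (BFSF⇒Core 1≤i p)))
BFSF⇒Core {i} 1≤i {k} {suc l} {F} (boundedRecursion G H K p q r e₀ e₁ b) =
  ext value (consC {Gs = λ j fs ns → lookup ns (Fin.inject₁ j)}
        (recur (BFSF⇒Core 1≤i p)
          (compV (BFSF⇒Core 1≤i q) (λ { fs (m ∷ a ∷ ns) → ns Vec.∷ʳ m Vec.∷ʳ a })
            (λ j → ext (λ { fs (m ∷ a ∷ ns) → refl }) (snocC {v = λ fs ns → Vec.tail (Vec.tail ns) Vec.∷ʳ lookup ns zero}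
               (snocC {v = λ fs ns → Vec.tail (Vec.tail ns)} (λ j → ext (λ { fs (m ∷ a ∷ ns) → refl }) (proj (suc (suc j)))) (proj zero)) (proj (suc zero)) j)))
          (compV (BFSF⇒Core 1≤i r) (λ fs ns → Vec.tail ns Vec.∷ʳ Vec.head ns)
            (snocC {v = λ fs ns → Vec.tail ns} (λ j → ext (λ { fs (m ∷ ns) → refl }) (proj (suc j))) (ext (λ { fs (m ∷ ns) → refl }) (proj zero))))
          bound)
        (proj (Fin.fromℕ l)) (λ j → proj (Fin.inject₁ j)))
  where
  R : Vec StrFun k → Vec ℕ l → ℕ → ℕ
  R fs ns = rec (fromFunctional G fs ns) (λ m a → fromFunctional H fs (ns Vec.∷ʳ m Vec.∷ʳ a))
  R-correct : ∀ fs ns n → R fs ns n ≡ num (F fs (Vec.map str ns Vec.∷ʳ str n))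
  R-correct fs ns zero = cong num (trans (sym (e₀ fs (Vec.map str ns)))
    (cong (λ w → F fs (Vec.map str ns Vec.∷ʳ w)) (num-injective (trans num-[] (sym (num-str 0))))))
  R-correct fs ns (suc n) = trans (cong (λ a → fromFunctional H fs (ns Vec.∷ʳ n Vec.∷ʳ a)) (R-correct fs ns n)) (cong num (begin
    H fs (Vec.map str (ns Vec.∷ʳ n Vec.∷ʳ num a)) ≡⟨ cong (H fs) (trans (Vecₚ.map-∷ʳ str (num a) (ns Vec.∷ʳ n)) (cong₂ Vec._∷ʳ_ (Vecₚ.map-∷ʳ str n ns) (str-num a))) ⟩
    H fs (xs Vec.∷ʳ str n Vec.∷ʳ a)               ≡⟨ sym (e₁ fs xs (str n)) ⟩
    F fs (xs Vec.∷ʳ next (str n))                 ≡⟨ cong (λ w → F fs (xs Vec.∷ʳ w)) (next-str n) ⟩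
    F fs (xs Vec.∷ʳ str (suc n))                  ∎))
    where
    open ≡-Reasoning
    xs = Vec.map str ns
    a = F fs (xs Vec.∷ʳ str n)
  bound : ∀ fs n ns → R fs ns n ≤ fromFunctional K fs (ns Vec.∷ʳ n)
  bound fs n ns = subst₂ _≤_ (sym (trans (R-correct fs ns n) (num≡number _)))
    (trans (sym (num≡number _)) (cong (λ v → num (K fs v)) (sym (Vecₚ.map-∷ʳ str n ns)))) (b fs (Vec.map str ns) (str n))
  value : ∀ fs ns → fromFunctional F fs ns ≡ R fs (tabulate λ j → lookup ns (Fin.inject₁ j)) (lookup ns (Fin.fromℕ l))
  value fs ns with Vec.initLast ns
  ... | ms , n , refl = trans (cong (λ v → num (F fs v)) (Vecₚ.map-∷ʳ str n ms))
        (trans (sym (R-correct fs ms n)) (cong₂ (R fs) (sym (tabulate-inject₁ ms n)) (sym (lookup-fromℕ ms n))))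

-- Numerical functionals are feasible

iter-+ : ∀ {A : Set} (f : A → A) m n x → iter f (m + n) x ≡ iter f m (iter f n x)
iter-+ f zero    n x = refl
iter-+ f (suc m) n x = cong f (iter-+ f m n x)

next-[] : next [] ≡ false ∷ []
next-[] = num-injective (trans (num-next []) (trans (cong suc num-[])
  (sym (trans (num-∷ʳ [] false) (cong (λ n → suc (2 * n)) num-[])))))

next-false : ∀ w → next (w ∷ʳ false) ≡ w ∷ʳ true
next-false w = num-injective (trans (num-next _) (trans (cong suc (num-∷ʳ w false)) (sym (num-∷ʳ w true))))

next-true : ∀ w → next (w ∷ʳ true) ≡ next w ∷ʳ false
next-true w = num-injective (trans (num-next _) (trans (cong suc (num-∷ʳ w true))
  (sym (trans (num-∷ʳ (next w) false) (trans (cong (λ n → suc (2 * n)) (num-next w)) (cong suc (*-suc 2 (num w))))))))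

-- Polynomial-time machines for the empty word, the successor and padding

module _ {l : ℕ} (M : OTM 0 l) where

  next₀ : Config M → Config M
  next₀ c = perform M [] c (nextAction M c)

  configAt-iter : ∀ xs n → configAt M [] xs n ≡ iter next₀ n (initial M xs)
  configAt-iter xs zero    = refl
  configAt-iter xs (suc n) = cong next₀ (configAt-iter xs n)

  Steps : ℕ → Config M → Config M → Set
  Steps n c c′ = iter next₀ n c ≡ c′

  steps-trans : ∀ {m n c c′ c″} → Steps m c c′ → Steps n c′ c″ → Steps (n + m) c c″
  steps-trans {m} {n} {c} refl q = trans (iter-+ next₀ n m c) q

  data Ends (n : ℕ) (c : Config M) (y : Str) : Set where
    ends : ∀ {c′} → Steps n c c′ → Halted M c′ → result M c′ ≡ y → Ends n c y

  ends-step : ∀ {n c c₁ y} → next₀ c ≡ c₁ → Ends n c₁ y → Ends (suc n) c y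
  ends-step {n} {c} p (ends q h r) = ends (trans (iter-shift next₀ n c) (trans (cong (iter next₀ n) p) q)) h r

  ends-steps : ∀ {m n c c₁ y} → Steps m c c₁ → Ends n c₁ y → Ends (n + m) c y
  ends-steps {m} {n} p (ends q h r) = ends (steps-trans {m} {n} p q) h r

  haltsWithin : ∀ {T n xs y} → n ≤ T → Ends n (initial M xs) y → HaltsWithin M T [] xs y
  haltsWithin {n = n} {xs} n≤ (ends p h r) = n , n≤ , subst (Halted M) (sym e) h , trans (cong (result M) e) r
    where e = trans (configAt-iter xs n) p

-- The tape whose head has passed the word with reversal u and is on the first symbol of w.
reading : Str → Str → Tape 0
reading u []      = ⟨ map bit u , blank , [] ⟩
reading u (b ∷ w) = ⟨ map bit u , bit b , map bit w ⟩

reading-right : ∀ u b w → writeMove (bit b , goRight) (reading u (b ∷ w)) ≡ reading (b ∷ u) w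
reading-right u b []      = refl
reading-right u b (c ∷ w) = refl

load-reading : ∀ w → load w ≡ reading [] w
load-reading []      = refl
load-reading (b ∷ w) = refl

backing : Str → List (Symbol 0) → Tape 0
backing []      rs = ⟨ [] , blank , rs ⟩
backing (b ∷ u) rs = ⟨ map bit u , bit b , rs ⟩

backing-left : ∀ u s rs → writeMove (s , goLeft) ⟨ map bit u , s , rs ⟩ ≡ backing u (s ∷ rs)
backing-left []      s rs = refl
backing-left (b ∷ u) s rs = refl

writing : Str → Tape 0
writing w = ⟨ [] , blank , map bit w ⟩

zeroM : OTM 0 0
zeroM = record { states = 1 ; works = 0 ; marks = 0 ; start = zero ; action = λ _ _ → halt }

zero-polyTime : PolyTime {0} (λ _ _ → [])
zero-polyTime = zeroM , [] , λ { [] → 0 , z≤n , refl , refl }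

oneTape : Fin 4 → (i o : Symbol 0 × Move) → Action 0 1 0 0 4
oneTape q i o = go q (record { inputs = i ∷ [] ; output = o ; queries = [] ; answers = [] ; work = [] })

-- State 0 runs to the end of the input, state 1 carries back through trailing ones, state 2 copies
-- what lies before them, and state 3 halts. The output is written from right to left, so the head
-- ends on its first bit, as `result` expects; a carry past the first bit prefixes a `false`.
nextAct : Fin 4 → Symbol 0 → Action 0 1 0 0 4
nextAct zero                   (bit b)     = oneTape zero (bit b , goRight) (blank , stay)
nextAct zero                   _           = oneTape (suc zero) (blank , goLeft) (blank , stay)
nextAct (suc zero)             (bit true)  = oneTape (suc zero) (bit true , goLeft) (bit false , goLeft)
nextAct (suc zero)             (bit false) = oneTape (suc (suc zero)) (bit false , goLeft) (bit true , goLeft)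
nextAct (suc zero)             _           = oneTape (suc (suc (suc zero))) (blank , stay) (bit false , stay)
nextAct (suc (suc zero))       (bit b)     = oneTape (suc (suc zero)) (bit b , goLeft) (bit b , goLeft)
nextAct (suc (suc zero))       _           = oneTape (suc (suc (suc zero))) (blank , stay) (blank , goRight)
nextAct (suc (suc (suc zero))) _           = halt

nextM : OTM 0 1
nextM = record { states = 4 ; works = 0 ; marks = 0 ; start = zero ; action = λ q t → nextAct q (Vec.head (Tapes.inputs t)) }

nextC : Fin 4 → Tape 0 → Tape 0 → Config nextM
nextC q i o = q ▸ record { inputs = i ∷ [] ; output = o ; queries = [] ; answers = [] ; work = [] }

next-scan : ∀ u w o → Steps nextM (length w) (nextC zero (reading u w) (writing o)) (nextC zero (reading (List.reverse w ++ u) []) (writing o))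
next-scan u []      o = refl
next-scan u (b ∷ w) o = begin
  iter (next₀ nextM) (suc (length w)) (nextC zero (reading u (b ∷ w)) (writing o))
    ≡⟨ iter-shift (next₀ nextM) (length w) _ ⟩
  iter (next₀ nextM) (length w) (nextC zero (writeMove (bit b , goRight) (reading u (b ∷ w))) (writing o))
    ≡⟨ cong (λ t → iter (next₀ nextM) (length w) (nextC zero t (writing o))) (reading-right u b w) ⟩
  iter (next₀ nextM) (length w) (nextC zero (reading (b ∷ u) w) (writing o))
    ≡⟨ next-scan (b ∷ u) w o ⟩
  nextC zero (reading (List.reverse w ++ b ∷ u) []) (writing o)
    ≡⟨ cong (λ v → nextC zero (reading v []) (writing o)) (trans (sym (++-assoc (List.reverse w) (b ∷ []) u)) (cong (_++ u) (sym (Listₚ.unfold-reverse b w)))) ⟩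
  nextC zero (reading (List.reverse (b ∷ w) ++ u) []) (writing o) ∎
  where open ≡-Reasoning

bitPrefix-map : ∀ {μ} w → bitPrefix {μ} (map bit w) ≡ w
bitPrefix-map []      = refl
bitPrefix-map (b ∷ w) = cong (b ∷_) (bitPrefix-map w)

next-copy : ∀ u rs o → Ends nextM (suc (length u)) (nextC (suc (suc zero)) (backing u rs) (writing o)) (List.reverse u ++ o)
next-copy []      rs []      = ends refl refl refl
next-copy []      rs (b ∷ o) = ends refl refl (cong (b ∷_) (bitPrefix-map o))
next-copy (b ∷ u) rs o       = subst (Ends nextM _ _) (trans (sym (++-assoc (List.reverse u) (b ∷ []) o)) (cong (_++ o) (sym (Listₚ.unfold-reverse b u))))
  (ends-step nextM (cong (λ t → nextC (suc (suc zero)) t (writing (b ∷ o))) (backing-left u (bit b) rs)) (next-copy u (bit b ∷ rs) (b ∷ o)))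

-- `u` is the unread part of the input from its end, `o` the output so far. The three clauses are
-- the rules `next-[]`, `next-true` and `next-false`.
next-carry : ∀ u rs o → Ends nextM (suc (length u)) (nextC (suc zero) (backing u rs) (writing o)) (next (List.reverse u) ++ o)
next-carry []          rs o = ends refl refl (trans (cong (false ∷_) (bitPrefix-map o)) (cong (_++ o) (sym next-[])))
next-carry (true ∷ u)  rs o = subst (Ends nextM _ _) (trans (sym (++-assoc (next (List.reverse u)) (false ∷ []) o))
    (cong (_++ o) (trans (sym (next-true (List.reverse u))) (cong next (sym (Listₚ.unfold-reverse true u))))))
  (ends-step nextM (cong (λ t → nextC (suc zero) t (writing (false ∷ o))) (backing-left u (bit true) rs)) (next-carry u (bit true ∷ rs) (false ∷ o)))
next-carry (false ∷ u) rs o = subst (Ends nextM _ _) (trans (sym (++-assoc (List.reverse u) (true ∷ []) o))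
    (cong (_++ o) (trans (sym (next-false (List.reverse u))) (cong next (sym (Listₚ.unfold-reverse false u))))))
  (ends-step nextM (cong (λ t → nextC (suc (suc zero)) t (writing (true ∷ o))) (backing-left u (bit false) rs)) (next-copy u (bit false ∷ rs) (true ∷ o)))

next-polyTime : PolyTime {1} (λ _ xs → next (lookup xs zero))
-- The polynomial is 2 + 2n: n steps to the end of the word, one to turn, and n + 1 back.
next-polyTime = nextM , 2 ∷ 2 ∷ [] , λ { (w ∷ []) → aux w }
  where
  time : ∀ n → suc (suc (n + n)) ≡ 2 + (n + 0) * (2 + (n + 0) * 0)
  time = solve-∀
  aux : ∀ w → HaltsWithin nextM (evalPoly (2 ∷ 2 ∷ []) (length w + 0)) [] (w ∷ []) (next w)
  aux w = haltsWithin nextM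
    (≤-reflexive (trans (cong (λ n → suc (suc (n + length w))) (Listₚ.length-reverse w)) (time (length w))))
    (subst (λ y → Ends nextM (suc (suc (length (List.reverse w))) + length w) (initial nextM (w ∷ [])) y)
      (trans (++-identityʳ _) (cong next (Listₚ.reverse-involutive w)))
      (ends-steps nextM {m = length w}
        (subst₂ (Steps nextM (length w)) (cong (λ t → nextC zero t (writing [])) (sym (load-reading w)))
          (cong (λ v → nextC zero (reading v []) (writing [])) (++-identityʳ (List.reverse w))) (next-scan [] w []))
        (ends-step nextM (cong (λ t → nextC (suc zero) t (writing [])) (backing-left (List.reverse w) blank [])) (next-carry (List.reverse w) (blank ∷ []) []))))

twoTapes : Fin 2 → (i j o : Symbol 0 × Move) → Action 0 2 0 0 2
twoTapes q i j o = go q (record { inputs = i ∷ j ∷ [] ; output = o ; queries = [] ; answers = [] ; work = [] })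

padAct : Fin 2 → (s t : Symbol 0) → Action 0 2 0 0 2
padAct zero    (bit b) t       = twoTapes zero (bit b , goRight) (t , stay) (bit true , goLeft)
padAct zero    s       (bit b) = twoTapes zero (s , stay) (bit b , goRight) (bit true , goLeft)
padAct zero    s       t       = twoTapes (suc zero) (s , stay) (t , stay) (bit true , stay)
padAct (suc _) _       _       = halt

padM : OTM 0 2
padM = record { states = 2 ; works = 0 ; marks = 0 ; start = zero
              ; action = λ q t → padAct q (lookup (Tapes.inputs t) zero) (lookup (Tapes.inputs t) (suc zero)) }

padConfig : Fin 2 → Tape 0 → Tape 0 → Tape 0 → Config padM
padConfig q i j o = q ▸ record { inputs = i ∷ j ∷ [] ; output = o ; queries = [] ; answers = [] ; work = [] }

pad-run : ∀ u v w w′ n → Ends padM (suc (length w + length w′)) (padConfig zero (reading u w) (reading v w′) (writing (ones n))) (ones (suc (length w + length w′ + n)))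
pad-run u v []      []       n = ends refl refl (cong (true ∷_) (bitPrefix-map (ones n)))
pad-run u v []      (b ∷ w′) n = subst (Ends padM _ _) (cong (ones ∘ suc) (+-suc (length w′) n))
  (ends-step padM (cong (λ t → padConfig zero (reading u []) t (writing (ones (suc n)))) (reading-right v b w′)) (pad-run u (b ∷ v) [] w′ (suc n)))
pad-run u v (b ∷ w) w′       n = subst (Ends padM _ _) (cong (ones ∘ suc) (+-suc (length w + length w′) n))
  (ends-step padM (cong (λ t → padConfig zero t (reading v w′) (writing (ones (suc n)))) (reading-right u b w)) (pad-run (b ∷ u) v w w′ (suc n)))

pad-polyTime : PolyTime {2} (λ _ xs → padS (lookup xs zero) (lookup xs (suc zero)))
pad-polyTime = padM , 1 ∷ 1 ∷ [] , λ { (w ∷ w′ ∷ []) → aux w w′ }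
  where
  time : ∀ m n → suc (m + n) ≡ 1 + (m + (n + 0)) * (1 + (m + (n + 0)) * 0)
  time = solve-∀
  aux : ∀ w w′ → HaltsWithin padM (evalPoly (1 ∷ 1 ∷ []) (length w + (length w′ + 0))) [] (w ∷ w′ ∷ []) (padS w w′)
  aux w w′ = haltsWithin padM (≤-reflexive (time (length w) (length w′)))
    (subst₂ (Ends padM (suc (length w + length w′))) (cong₂ (λ s t → padConfig zero s t (writing [])) (sym (load-reading w)) (sym (load-reading w′)))
      (cong (ones ∘ suc) (+-identityʳ _)) (pad-run [] [] w w′ 0))

-- From Core back to the class

toFunctional : ∀ {k l} → Fn k l → Functional k l
toFunctional F fs xs = str (F fs (Vec.map num xs))

id↣ : ∀ {n} → Fin n ↣ Fin n
id↣ = mk↣ {to = id} id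

point↣ : ∀ {n} → Fin n → Fin 1 ↣ Fin n
point↣ j = mk↣ {to = λ _ → j} λ { {zero} {zero} _ → refl }

none↣ : ∀ {n} → Fin 0 ↣ Fin n
none↣ = mk↣ {to = λ ()} λ { {()} }

module _ {i : ℕ} {X : Class} where

  BFSF-ext : ∀ {k l} {F G : Functional k l} → (∀ fs xs → F fs xs ≡ G fs xs) → BFSF i X G → BFSF i X F
  BFSF-ext {G = G} e p = expansion G id↣ id↣ p λ fs xs →
    trans (e fs xs) (cong₂ G (sym (tabulate∘lookup fs)) (sym (tabulate∘lookup xs)))

  emptyB : ∀ {k l} → BFSF i X {k} {l} (λ _ _ → [])
  emptyB = expansion {k = 0} {l = 0} (λ _ _ → []) none↣ none↣ (polyTime zero-polyTime) λ _ _ → refl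

  nextB : BFSF i X {0} {1} (λ _ xs → next (lookup xs zero))
  nextB = polyTime next-polyTime

  -- A recursion whose step returns the successor of the counter and ignores the previous value. All
  -- projections are expansions of it.
  identityB : BFSF i X {0} {1} (λ _ xs → lookup xs zero)
  identityB = boundedRecursion (λ _ _ → []) (λ _ xs → next (lookup xs zero)) (λ _ xs → next (lookup xs zero))
    emptyB (expansion _ none↣ (point↣ zero) nextB λ _ _ → refl) nextB
    (λ { _ [] → refl }) (λ { _ [] _ → refl })
    (λ { _ [] n → subst₂ _≤_ (num≡number n) (trans (sym (num-next n)) (num≡number (next n))) (n≤1+n (num n)) })

  projB : ∀ {k l} (j : Fin l) → BFSF i X {k} (λ _ xs → lookup xs j)
  projB j = expansion _ none↣ (point↣ j) identityB λ _ _ → refl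

  permB : ∀ {k l m} {G : Functional k m} (ρ : Fin m → Fin l) → BFSF i X G → BFSF i X (λ fs xs → G fs (tabulate λ j → lookup xs (ρ j)))
  permB {G = G} ρ p = composition G (λ j _ xs → lookup xs (ρ j)) p (λ j → projB (ρ j)) λ _ _ → refl

Core⇒BFSF : ∀ {i} {X : Class} {k l} {F : Fn k l} → Core (just i) k F → BFSF i X (toFunctional F)
Core⇒BFSF zeroC = BFSF-ext (λ _ _ → num-injective (trans (num-str 0) (sym num-[]))) emptyB
Core⇒BFSF sucC  = expansion (λ _ xs → next (lookup xs zero)) none↣ id↣ nextB
  λ { _ (w ∷ []) → trans (sym (next-str (num w))) (cong next (str-num w)) }
Core⇒BFSF padC  = expansion (λ _ xs → padS (lookup xs zero) (lookup xs (suc zero))) none↣ id↣ (polyTime pad-polyTime)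
  λ { _ (v ∷ w ∷ []) → trans (str-num _) (cong₂ padS (str-num v) (str-num w)) }
Core⇒BFSF {i} (growC refl) = expansion (unaryGrowth i) none↣ id↣ growth
  λ { _ (w ∷ []) → trans (str-num _) (cong (λ v → ones (g i (length v))) (str-num w)) }
Core⇒BFSF (apC j) = expansion Ap (point↣ j) id↣ application λ { fs (w ∷ []) → trans (str-num _) (cong (lookup fs j) (str-num w)) }
Core⇒BFSF (proj j) = BFSF-ext (λ fs xs → trans (cong str (lookup-map j num xs)) (str-num _)) (projB j)
Core⇒BFSF (comp {H = H} {Gs} p q) = composition (toFunctional H) (λ j → toFunctional (Gs j)) (Core⇒BFSF p) (λ j → Core⇒BFSF (q j))
  λ fs xs → cong (λ v → str (H fs v)) (trans (tabulate-cong λ j → sym (num-str _)) (Vecₚ.tabulate-∘ num λ j → toFunctional (Gs j) fs xs))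
Core⇒BFSF (ext e p) = BFSF-ext (λ fs xs → cong str (e fs (Vec.map num xs))) (Core⇒BFSF p)
Core⇒BFSF {i} {X} {k} (recur {l} {G} {H} {K} p q r b) =
    BFSF-ext (λ { fs (n ∷ xs) → sym (trans (cong (R fs) (tabulate-cons xs n)) (R-snoc fs xs n)) }) (permB {G = R} σ
      (boundedRecursion {F = R} (toFunctional G) (λ fs ys → toFunctional H fs (tabulate (lookup ys ∘ ρ))) (λ fs ys → toFunctional K fs (tabulate (lookup ys ∘ τ)))
        (Core⇒BFSF p) (permB ρ (Core⇒BFSF q)) (permB τ (Core⇒BFSF r)) zeroCase sucCase bound))
  where
  rc : Vec StrFun k → Vec ℕ l → ℕ → ℕ
  rc fs ns = rec (G fs ns) (λ m a → H fs (m ∷ a ∷ ns))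
  -- `R` is the recursion with its variable moved from the first place to the last, where the class
  -- expects it; `ρ` and `τ` rearrange the arguments of `H` and `K` accordingly, and `σ` undoes the
  -- move at the end.
  R : Functional k (suc l)
  R fs ys = str (rc fs (Vec.map num (tabulate (λ j → lookup ys (Fin.inject₁ j)))) (num (lookup ys (Fin.fromℕ l))))
  R-snoc : ∀ fs xs n → R fs (xs Vec.∷ʳ n) ≡ str (rc fs (Vec.map num xs) (num n))
  R-snoc fs xs n = cong₂ (λ v w → str (rc fs (Vec.map num v) (num w))) (tabulate-inject₁ xs n) (lookup-fromℕ xs n)
  σ : Fin (suc l) → Fin (suc l)
  σ j = [ suc , (λ _ → zero) ]′ (snocIx j)
  tabulate-cons : ∀ (xs : Vec Str l) n → tabulate (λ j → lookup (n ∷ xs) (σ j)) ≡ xs Vec.∷ʳ n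
  tabulate-cons xs n = trans (tabulate-cong λ j → trans (aux (snocIx j)) (sym (lookup-snocIx xs n j))) (tabulate∘lookup (xs Vec.∷ʳ n))
    where
    aux : ∀ s → lookup (n ∷ xs) ([ suc , (λ _ → zero) ]′ s) ≡ [ lookup xs , (λ _ → n) ]′ s
    aux (inj₁ _) = refl
    aux (inj₂ _) = refl
  ρ : Fin (2 + l) → Fin (2 + l)
  ρ zero          = Fin.inject₁ (Fin.fromℕ l)
  ρ (suc zero)    = Fin.fromℕ (suc l)
  ρ (suc (suc j)) = Fin.inject₁ (Fin.inject₁ j)
  τ : Fin (suc l) → Fin (suc l)
  τ zero    = Fin.fromℕ l
  τ (suc j) = Fin.inject₁ j
  tabulate-ρ : ∀ (xs : Vec Str l) n a → tabulate (lookup (xs Vec.∷ʳ n Vec.∷ʳ a) ∘ ρ) ≡ n ∷ a ∷ xs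
  tabulate-ρ xs n a = cong₂ _∷_ (trans (lookup-inject₁ (xs Vec.∷ʳ n) a (Fin.fromℕ l)) (lookup-fromℕ xs n))
    (cong₂ _∷_ (lookup-fromℕ (xs Vec.∷ʳ n) a)
      (trans (tabulate-cong λ j → trans (lookup-inject₁ (xs Vec.∷ʳ n) a (Fin.inject₁ j)) (lookup-inject₁ xs n j)) (tabulate∘lookup xs)))
  tabulate-τ : ∀ (xs : Vec Str l) n → tabulate (lookup (xs Vec.∷ʳ n) ∘ τ) ≡ n ∷ xs
  tabulate-τ xs n = cong₂ _∷_ (lookup-fromℕ xs n) (tabulate-inject₁ xs n)
  zeroCase : ∀ fs xs → R fs (xs Vec.∷ʳ []) ≡ toFunctional G fs xs
  zeroCase fs xs = trans (R-snoc fs xs []) (cong (λ n → str (rc fs (Vec.map num xs) n)) num-[])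
  sucCase : ∀ fs xs n → R fs (xs Vec.∷ʳ next n) ≡ toFunctional H fs (tabulate (lookup (xs Vec.∷ʳ n Vec.∷ʳ R fs (xs Vec.∷ʳ n)) ∘ ρ))
  sucCase fs xs n = trans (R-snoc fs xs (next n)) (trans (cong (λ m → str (rc fs (Vec.map num xs) m)) (num-next n))
    (sym (cong str (trans (cong (H fs ∘ Vec.map num) (tabulate-ρ xs n _))
      (cong (λ a → H fs (num n ∷ a ∷ Vec.map num xs)) (trans (cong num (R-snoc fs xs n)) (num-str _)))))))
  bound : ∀ fs xs n → R fs (xs Vec.∷ʳ n) ≤ₛ toFunctional K fs (tabulate (lookup (xs Vec.∷ʳ n) ∘ τ))
  bound fs xs n = subst₂ _≤_
    (trans (sym (num-str _)) (trans (cong num (sym (R-snoc fs xs n))) (num≡number _)))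
    (trans (sym (num-str _)) (trans (cong (λ v → num (toFunctional K fs v)) (sym (tabulate-τ xs n))) (num≡number _)))
    (b fs (num n) (Vec.map num xs))

-- Structured programs

-- A register is a stack of bits whose top is the first one; branch pops it.

data Reg (k l : ℕ) : Set where
  inR  : Fin l → Reg k l
  outR : Reg k l
  qryR : Fin k → Reg k l
  ansR : Fin k → Reg k l
  wrk  : ℕ → Reg k l

data Cmd (k l : ℕ) : Set where
  skip   : Cmd k l
  push   : Reg k l → Bool → Cmd k l
  branch : Reg k l → (onEmpty on0 on1 : Cmd k l) → Cmd k l
  while  : Reg k l → Cmd k l → Cmd k l
  oracle : Fin k → Cmd k l
  _⨾_    : Cmd k l → Cmd k l → Cmd k l

infixr 5 _⨾_

inR-injective : ∀ {k l} {j j′ : Fin l} → inR {k} j ≡ inR j′ → j ≡ j′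
inR-injective refl = refl

qryR-injective : ∀ {k l} {j j′ : Fin k} → qryR {k} {l} j ≡ qryR j′ → j ≡ j′
qryR-injective refl = refl

ansR-injective : ∀ {k l} {j j′ : Fin k} → ansR {k} {l} j ≡ ansR j′ → j ≡ j′
ansR-injective refl = refl

wrk-injective : ∀ {k l n n′} → wrk {k} {l} n ≡ wrk n′ → n ≡ n′
wrk-injective refl = refl

_≟ᴿ_ : ∀ {k l} (r r′ : Reg k l) → Dec (r ≡ r′)
inR j  ≟ᴿ inR j′  with j Finₚ.≟ j′
... | yes refl = yes refl
... | no  j≢   = no (j≢ ∘ inR-injective)
inR _  ≟ᴿ outR    = no λ ()
inR _  ≟ᴿ qryR _  = no λ ()
inR _  ≟ᴿ ansR _  = no λ ()
inR _  ≟ᴿ wrk _   = no λ ()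
outR   ≟ᴿ inR _   = no λ ()
outR   ≟ᴿ outR    = yes refl
outR   ≟ᴿ qryR _  = no λ ()
outR   ≟ᴿ ansR _  = no λ ()
outR   ≟ᴿ wrk _   = no λ ()
qryR _ ≟ᴿ inR _   = no λ ()
qryR _ ≟ᴿ outR    = no λ ()
qryR j ≟ᴿ qryR j′ with j Finₚ.≟ j′
... | yes refl = yes refl
... | no  j≢   = no (j≢ ∘ qryR-injective)
qryR _ ≟ᴿ ansR _  = no λ ()
qryR _ ≟ᴿ wrk _   = no λ ()
ansR _ ≟ᴿ inR _   = no λ ()
ansR _ ≟ᴿ outR    = no λ ()
ansR _ ≟ᴿ qryR _  = no λ ()
ansR j ≟ᴿ ansR j′ with j Finₚ.≟ j′
... | yes refl = yes refl
... | no  j≢   = no (j≢ ∘ ansR-injective)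
ansR _ ≟ᴿ wrk _   = no λ ()
wrk _  ≟ᴿ inR _   = no λ ()
wrk _  ≟ᴿ outR    = no λ ()
wrk _  ≟ᴿ qryR _  = no λ ()
wrk _  ≟ᴿ ansR _  = no λ ()
wrk n  ≟ᴿ wrk n′  with n ≟ n′
... | yes refl = yes refl
... | no  n≢   = no (n≢ ∘ wrk-injective)

pick : {A : Set} → Bool → A → A → A
pick false x y = x
pick true  x y = y

ʳ++-involutive : ∀ (w : Str) → (w List.ʳ++ []) List.ʳ++ [] ≡ w
ʳ++-involutive = Listₚ.reverse-involutive

length-ʳ++[] : ∀ (w : Str) → length (w List.ʳ++ []) ≡ length w
length-ʳ++[] = Listₚ.length-reverse

flag : Bool → Str
flag true  = true ∷ []
flag false = []

same : Bool → Bool → Bool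
same true  b = b
same false b = not b

-- Adding (c = true) or subtracting (c = false) one: running from the last
-- bit, the bits are inverted as long as they equal c and once more.
rippled : Bool → Bool → Str → Str → Bool × Str
rippled c f     []      rest = f , rest
rippled c true  (b ∷ w) rest = rippled c (same c b) w (not b ∷ rest)
rippled c false (b ∷ w) rest = rippled c false w (b ∷ rest)

module _ {k l : ℕ} where

  Store : Set
  Store = Reg k l → Str

  decide : {A : Set} (x r : Reg k l) → (x ≡ r → A) → (x ≢ r → A) → A
  decide x r f h with x ≟ᴿ r
  ... | yes e = f e
  ... | no ¬e = h ¬e

  Bounded : ℕ → Store → Set
  Bounded B s = ∀ r → length (s r) ≤ B

  abstract

    upd : Store → Reg k l → Str → Store
    upd s r w r′ with r′ ≟ᴿ r
    ... | yes _ = w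
    ... | no  _ = s r′

    upd-same : ∀ s r w → upd s r w r ≡ w
    upd-same s r w with r ≟ᴿ r
    ... | yes _  = refl
    ... | no  r≢ = contradiction refl r≢

    upd-other : ∀ s {r r′} w → r′ ≢ r → upd s r w r′ ≡ s r′
    upd-other s {r} {r′} w r′≢ with r′ ≟ᴿ r
    ... | yes e = contradiction e r′≢
    ... | no  _ = refl

    upd-bounded : ∀ {B s r w} → Bounded B s → length w ≤ B → Bounded B (upd s r w)
    upd-bounded {r = r} p q r′ with r′ ≟ᴿ r
    ... | yes _ = q
    ... | no  _ = p r′

  module _ (fs : Vec StrFun k) (B : ℕ) where

    -- The register bound is part of the semantics: `push` and `oracle` are the only commands that
    -- can lengthen a register, and both ask for room. A derivation is finite, so it also witnesses
    -- termination.
    data Run : Cmd k l → Store → Store → Set where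
      run-skip   : ∀ {s} → Run skip s s
      run-push   : ∀ {r b s} → suc (length (s r)) ≤ B → Run (push r b) s (upd s r (b ∷ s r))
      run-empty  : ∀ {r c c₀ c₁ s s′} → s r ≡ [] → Run c s s′ → Run (branch r c c₀ c₁) s s′
      run-bit    : ∀ {r b w c c₀ c₁ s s′} → s r ≡ b ∷ w → Run (pick b c₀ c₁) (upd s r w) s′ → Run (branch r c c₀ c₁) s s′
      run-done   : ∀ {r c s} → s r ≡ [] → Run (while r c) s s
      run-again  : ∀ {r b w c s s′ s″} → s r ≡ b ∷ w → Run c s s′ → Run (while r c) s′ s″ → Run (while r c) s s″
      run-oracle : ∀ {j s} → length (lookup fs j (s (qryR j))) ≤ B → Run (oracle j) s (upd s (ansR j) (lookup fs j (s (qryR j))))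
      run-seq    : ∀ {c c′ s s′ s″} → Run c s s′ → Run c′ s′ s″ → Run (c ⨾ c′) s s″

    run-bounded : ∀ {c s s′} → Run c s s′ → Bounded B s → Bounded B s′
    run-bounded run-skip         b = b
    run-bounded (run-push p)     b = upd-bounded b p
    run-bounded (run-empty _ p)  b = run-bounded p b
    run-bounded {s = s} (run-bit {r} e p) b =
      run-bounded p (upd-bounded b (≤-trans (n≤1+n _) (subst (λ w → length w ≤ B) e (b r))))
    run-bounded (run-done _)     b = b
    run-bounded (run-again _ p q) b = run-bounded q (run-bounded p b)
    run-bounded (run-oracle p)   b = upd-bounded b p
    run-bounded (run-seq p q)    b = run-bounded q (run-bounded p b)

    Reaches : Cmd k l → Store → (Store → Set) → Set
    Reaches c s P = ∃ λ s′ → Run c s s′ × P s′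

  module _ {fs : Vec StrFun k} {B : ℕ} where

    infixr 5 _then_

    _then_ : ∀ {c c′ s} {P Q : Store → Set} → Reaches fs B c s P → (∀ {s′} → Run fs B c s s′ → P s′ → Reaches fs B c′ s′ Q) → Reaches fs B (c ⨾ c′) s Q
    (s′ , p , x) then f with f p x
    ... | s″ , q , y = s″ , run-seq p q , y

    infixr 5 _done_

    _done_ : ∀ {c s} {P Q : Store → Set} → Reaches fs B c s P → (∀ {s′} → Run fs B c s s′ → P s′ → Q s′) → Reaches fs B c s Q
    (s′ , p , x) done f = s′ , p , f p x

    push-run : ∀ r b s → suc (length (s r)) ≤ B → Reaches fs B (push r b) s (λ s′ → s′ r ≡ b ∷ s r × (∀ x → x ≢ r → s′ x ≡ s x))
    push-run r b s p = _ , run-push p , upd-same s r _ , λ x x≢ → upd-other s _ x≢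

    oracle-run : ∀ j s → length (lookup fs j (s (qryR j))) ≤ B →
      Reaches fs B (oracle j) s (λ s′ → s′ (ansR j) ≡ lookup fs j (s (qryR j)) × (∀ x → x ≢ ansR j → s′ x ≡ s x))
    oracle-run j s p = _ , run-oracle p , upd-same s (ansR j) _ , λ x x≢ → upd-other s _ x≢

  forEach : Reg k l → Cmd k l → Cmd k l → Cmd k l
  forEach r c₀ c₁ = while r (branch r skip c₀ c₁)

  module _ {fs : Vec StrFun k} {B : ℕ} where

    -- The loop consumes `r`, so the induction is on its word. The invariant is indexed by the part
    -- still to be read, and the body starts after the bit has been popped.
    forEach-run : ∀ {r c₀ c₁} (Inv : Str → Store → Set) → (∀ {w s} → Inv w s → s r ≡ w) →
      (∀ {b w s} → Inv (b ∷ w) s → Reaches fs B (pick b c₀ c₁) (upd s r w) (Inv w)) →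
      ∀ w s → Inv w s → Reaches fs B (forEach r c₀ c₁) s (Inv [])
    forEach-run Inv val body []      s i = s , run-done (val i) , i
    forEach-run Inv val body (b ∷ w) s i with body i
    ... | s′ , p , i′ with forEach-run Inv val body w s′ i′
    ... | s″ , q , i″ = s″ , run-again (val i) (run-bit (val i) p) q , i″

  clear : Reg k l → Cmd k l
  clear r = forEach r skip skip

  drain : Reg k l → Reg k l → Cmd k l
  drain r t = forEach r (push t false) (push t true)

  drain₂ : Reg k l → Reg k l → Reg k l → Cmd k l
  drain₂ r t u = forEach r (push t false ⨾ push u false) (push t true ⨾ push u true)

  Same : Store → Store → Reg k l → Set
  Same s s′ r = s′ r ≡ s r

  module _ {fs : Vec StrFun k} {B : ℕ} where

    clear-run : ∀ r s → Reaches fs B (clear r) s (λ s′ → s′ r ≡ [] × (∀ x → x ≢ r → Same s s′ x))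
    clear-run r s = forEach-run Inv proj₁ body (s r) s (refl , λ _ _ → refl)
      where
      Inv : Str → Store → Set
      Inv w s′ = s′ r ≡ w × (∀ x → x ≢ r → Same s s′ x)
      body : ∀ {b w s′} → Inv (b ∷ w) s′ → Reaches fs B (pick b skip skip) (upd s′ r w) (Inv w)
      body {b} {w} {s′} (p , q) = upd s′ r w , aux b , upd-same s′ r w , λ x x≢ → trans (upd-other s′ w x≢) (q x x≢)
        where
        aux : ∀ b → Run fs B (pick b skip skip) (upd s′ r w) (upd s′ r w)
        aux false = run-skip
        aux true  = run-skip

    drain-run : ∀ {r t} s → t ≢ r → length (s r) + length (s t) ≤ B →
      Reaches fs B (drain r t) s (λ s′ → s′ r ≡ [] × s′ t ≡ s r List.ʳ++ s t × (∀ x → x ≢ r → x ≢ t → Same s s′ x))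
    drain-run {r} {t} s t≢r len≤ with forEach-run Inv proj₁ body (s r) s (refl , refl , len≤ , λ _ _ _ → refl)
      where
      Inv : Str → Store → Set
      Inv w s′ = s′ r ≡ w × w List.ʳ++ s′ t ≡ s r List.ʳ++ s t × length w + length (s′ t) ≤ B × (∀ x → x ≢ r → x ≢ t → Same s s′ x)
      body : ∀ {b w s′} → Inv (b ∷ w) s′ → Reaches fs B (pick b (push t false) (push t true)) (upd s′ r w) (Inv w)
      body {b} {w} {s′} (p , q , L , o) = _ , aux b ,
          trans (upd-other s₁ _ (t≢r ∘ sym)) (upd-same s′ r w) ,
          trans (cong (w List.ʳ++_) e) q ,
          ≤-trans (≤-reflexive (trans (cong (λ v → length w + length v) e) (+-suc (length w) _))) L ,
          λ x x≢r x≢t → trans (upd-other s₁ _ x≢t) (trans (upd-other s′ w x≢r) (o x x≢r x≢t))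
        where
        s₁ = upd s′ r w
        e : upd s₁ t (b ∷ s₁ t) t ≡ b ∷ s′ t
        e = trans (upd-same s₁ t _) (cong (b ∷_) (upd-other s′ w t≢r))
        room : suc (length (s₁ t)) ≤ B
        room = ≤-trans (s≤s (≤-trans (≤-reflexive (cong length (upd-other s′ w t≢r))) (m≤n+m _ (length w)))) L
        aux : ∀ b → Run fs B (pick b (push t false) (push t true)) s₁ (upd s₁ t (b ∷ s₁ t))
        aux false = run-push room
        aux true  = run-push room
    ... | s′ , p , x , y , _ , z = s′ , p , x , y , z

    drain₂-run : ∀ {r t u} s → t ≢ r → u ≢ r → u ≢ t → length (s r) + length (s t) ≤ B → length (s r) + length (s u) ≤ B →
      Reaches fs B (drain₂ r t u) s (λ s′ → s′ r ≡ [] × s′ t ≡ s r List.ʳ++ s t × s′ u ≡ s r List.ʳ++ s u ×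
        (∀ x → x ≢ r → x ≢ t → x ≢ u → Same s s′ x))
    drain₂-run {r} {t} {u} s t≢r u≢r u≢t len≤ len≤′ with forEach-run Inv proj₁ body (s r) s (refl , refl , refl , len≤ , len≤′ , λ _ _ _ _ → refl)
      where
      Inv : Str → Store → Set
      Inv w s′ = s′ r ≡ w × w List.ʳ++ s′ t ≡ s r List.ʳ++ s t × w List.ʳ++ s′ u ≡ s r List.ʳ++ s u ×
        length w + length (s′ t) ≤ B × length w + length (s′ u) ≤ B × (∀ x → x ≢ r → x ≢ t → x ≢ u → Same s s′ x)
      body : ∀ {b w s′} → Inv (b ∷ w) s′ → Reaches fs B (pick b (push t false ⨾ push u false) (push t true ⨾ push u true)) (upd s′ r w) (Inv w)
      body {b} {w} {s′} (p , q , q′ , L , L′ , o) = _ , aux b ,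
          trans (upd-other s₂ _ (u≢r ∘ sym)) (trans (upd-other s₁ _ (t≢r ∘ sym)) (upd-same s′ r w)) ,
          trans (cong (w List.ʳ++_) e) q , trans (cong (w List.ʳ++_) e′) q′ ,
          ≤-trans (≤-reflexive (trans (cong (λ v → length w + length v) e) (+-suc (length w) _))) L ,
          ≤-trans (≤-reflexive (trans (cong (λ v → length w + length v) e′) (+-suc (length w) _))) L′ ,
          λ x x≢r x≢t x≢u → trans (upd-other s₂ _ x≢u) (trans (upd-other s₁ _ x≢t) (trans (upd-other s′ w x≢r) (o x x≢r x≢t x≢u)))
        where
        s₁ = upd s′ r w
        s₂ = upd s₁ t (b ∷ s₁ t)
        u₂ : s₂ u ≡ s′ u
        u₂ = trans (upd-other s₁ _ u≢t) (upd-other s′ w u≢r)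
        e : upd s₂ u (b ∷ s₂ u) t ≡ b ∷ s′ t
        e = trans (upd-other s₂ _ (u≢t ∘ sym)) (trans (upd-same s₁ t _) (cong (b ∷_) (upd-other s′ w t≢r)))
        e′ : upd s₂ u (b ∷ s₂ u) u ≡ b ∷ s′ u
        e′ = trans (upd-same s₂ u _) (cong (b ∷_) u₂)
        room : suc (length (s₁ t)) ≤ B
        room = ≤-trans (s≤s (≤-trans (≤-reflexive (cong length (upd-other s′ w t≢r))) (m≤n+m _ (length w)))) L
        room′ : ∀ b → suc (length (upd s₁ t (b ∷ s₁ t) u)) ≤ B
        room′ b = ≤-trans (s≤s (≤-trans (≤-reflexive (cong length (trans (upd-other s₁ _ u≢t) (upd-other s′ w u≢r)))) (m≤n+m _ (length w)))) L′
        aux : ∀ b → Run fs B (pick b (push t false ⨾ push u false) (push t true ⨾ push u true)) s₁ (upd (upd s₁ t (b ∷ s₁ t)) u (b ∷ upd s₁ t (b ∷ s₁ t) u))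
        aux false = run-seq (run-push room) (run-push (room′ false))
        aux true  = run-seq (run-push room) (run-push (room′ true))
    ... | s′ , p , x , y , y′ , _ , _ , z = s′ , p , x , y , y′ , z

  -- Popping is destructive, so a word is read into u reversed and written
  -- back from there.
  fetch : Reg k l → Reg k l → Reg k l → Cmd k l
  fetch r t u = clear t ⨾ clear u ⨾ drain r u ⨾ drain₂ u r t

  put : Reg k l → Reg k l → Reg k l → Cmd k l
  put t r u = clear r ⨾ clear u ⨾ drain t u ⨾ drain u r

  module _ {fs : Vec StrFun k} {B : ℕ} where

    fetch-run : ∀ {r t u} s → Bounded B s → r ≢ t → r ≢ u → t ≢ u →
      Reaches fs B (fetch r t u) s (λ s′ → s′ t ≡ s r × (∀ x → x ≢ t → x ≢ u → Same s s′ x))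
    fetch-run {r} {t} {u} s bd r≢t r≢u t≢u =
      clear-run t s then λ {s₁} _ (a₁ , o₁) →
      clear-run u s₁ then λ {s₂} _ (a₂ , o₂) →
      let r₂ : s₂ r ≡ s r
          r₂ = trans (o₂ r r≢u) (o₁ r r≢t)
      in drain-run s₂ (r≢u ∘ sym) (≤-trans (≤-reflexive (trans (cong₂ (λ v w → length v + length w) r₂ a₂) (+-identityʳ _))) (bd r)) then λ {s₃} _ (a₃ , b₃ , o₃) →
      let u₃ : s₃ u ≡ s r List.ʳ++ []
          u₃ = trans b₃ (cong₂ List._ʳ++_ r₂ a₂)
          t₃ : s₃ t ≡ []
          t₃ = trans (o₃ t (r≢t ∘ sym) t≢u) (trans (o₂ t t≢u) a₁)
          small : ∀ {w} → w ≡ [] → length (s₃ u) + length w ≤ B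
          small e = ≤-trans (≤-reflexive (trans (cong₂ (λ v w → length v + length w) u₃ e) (trans (+-identityʳ _) (length-ʳ++[] (s r))))) (bd r)
      in drain₂-run s₃ r≢u t≢u (r≢t ∘ sym) (small a₃) (small t₃) done λ {s₄} _ (a₄ , b₄ , c₄ , o₄) →
      let frame : ∀ x → x ≢ t → x ≢ u → Same s s₄ x
          frame x x≢t x≢u = decide x r
            (λ { refl → trans b₄ (trans (cong₂ List._ʳ++_ u₃ a₃) (ʳ++-involutive (s r))) })
            (λ x≢r → trans (o₄ x x≢u x≢r x≢t) (trans (o₃ x x≢r x≢u) (trans (o₂ x x≢u) (o₁ x x≢t))))
      in trans c₄ (trans (cong₂ List._ʳ++_ u₃ t₃) (ʳ++-involutive (s r))) , frame

    put-run : ∀ {t r u} s → Bounded B s → t ≢ r → t ≢ u → r ≢ u →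
      Reaches fs B (put t r u) s (λ s′ → s′ r ≡ s t × (∀ x → x ≢ t → x ≢ r → x ≢ u → Same s s′ x))
    put-run {t} {r} {u} s bd t≢r t≢u r≢u =
      clear-run r s then λ {s₁} _ (a₁ , o₁) →
      clear-run u s₁ then λ {s₂} _ (a₂ , o₂) →
      let t₂ : s₂ t ≡ s t
          t₂ = trans (o₂ t t≢u) (o₁ t t≢r)
      in drain-run s₂ (t≢u ∘ sym) (≤-trans (≤-reflexive (trans (cong₂ (λ v w → length v + length w) t₂ a₂) (+-identityʳ _))) (bd t)) then λ {s₃} _ (a₃ , b₃ , o₃) →
      let u₃ : s₃ u ≡ s t List.ʳ++ []
          u₃ = trans b₃ (cong₂ List._ʳ++_ t₂ a₂)
          r₃ : s₃ r ≡ []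
          r₃ = trans (o₃ r (t≢r ∘ sym) r≢u) (trans (o₂ r r≢u) a₁)
      in drain-run s₃ r≢u (≤-trans (≤-reflexive (trans (cong₂ (λ v w → length v + length w) u₃ r₃) (trans (+-identityʳ _) (length-ʳ++[] (s t))))) (bd t)) done λ {s₄} _ (a₄ , b₄ , o₄) →
         trans b₄ (trans (cong₂ List._ʳ++_ u₃ r₃) (ʳ++-involutive (s t))) ,
         λ x x≢t x≢r x≢u → trans (o₄ x x≢u x≢r) (trans (o₃ x x≢t x≢u) (trans (o₂ x x≢u) (o₁ x x≢r)))

  keep : Reg k l → Bool → Cmd k l
  keep f true  = push f true
  keep f false = skip

  -- A nonempty `f` means that the carry or borrow is still running. Testing `f` pops it, so `keep`
  -- pushes it again if the ripple goes on; otherwise the remaining bits are only copied.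
  rippleBit : Bool → Reg k l → Reg k l → Bool → Cmd k l
  rippleBit c f r b = branch f (push r b) skip (push r (not b) ⨾ keep f (same c b))

  ripple : Bool → Reg k l → Reg k l → Reg k l → Cmd k l
  ripple c t f r = clear t ⨾ drain r t ⨾ clear f ⨾ push f true ⨾ forEach t (rippleBit c f r false) (rippleBit c f r true)

  module _ {fs : Vec StrFun k} {B : ℕ} where

    ripple-run : ∀ c {t f r} s → Bounded B s → 1 ≤ B → t ≢ f → t ≢ r → f ≢ r →
      Reaches fs B (ripple c t f r) s (λ s′ → s′ f ≡ flag (proj₁ (rippled c true (List.reverse (s r)) [])) ×
        s′ r ≡ proj₂ (rippled c true (List.reverse (s r)) []) × (∀ x → x ≢ t → x ≢ f → x ≢ r → Same s s′ x))
    ripple-run c {t} {f} {r} s bd 1≤B t≢f t≢r f≢r =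
      clear-run t s then λ {s₁} _ (a₁ , o₁) →
      let r₁ = o₁ r (t≢r ∘ sym) in
      drain-run s₁ t≢r (≤-trans (≤-reflexive (trans (cong₂ (λ v w → length v + length w) r₁ a₁) (+-identityʳ _))) (bd r)) then λ {s₂} _ (a₂ , b₂ , o₂) →
      clear-run f s₂ then λ {s₃} _ (a₃ , o₃) →
      push-run f true s₃ (≤-trans (s≤s (≤-reflexive (cong length a₃))) 1≤B) then λ {s₄} _ (a₄ , o₄) →
      let t₃ : s₃ t ≡ List.reverse (s r)
          t₃ = trans (o₃ t t≢f) (trans b₂ (cong₂ List._ʳ++_ r₁ a₁))
          r₄ : s₄ r ≡ []
          r₄ = trans (o₄ r (f≢r ∘ sym)) (trans (o₃ r (f≢r ∘ sym)) a₂)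
          start≡ : Inv (List.reverse (s r)) s₄
          start≡ = trans (o₄ t t≢f) t₃ , true , trans a₄ (cong (true ∷_) a₃) ,
            cong (rippled c true (List.reverse (s r))) r₄ ,
            ≤-trans (≤-reflexive (trans (cong (λ v → length (List.reverse (s r)) + length v) r₄) (trans (+-identityʳ _) (Listₚ.length-reverse (s r))))) (bd r) ,
            λ x x≢t x≢f x≢r → trans (o₄ x x≢f) (trans (o₃ x x≢f) (trans (o₂ x x≢r x≢t) (o₁ x x≢t)))
      in forEach-run Inv proj₁ body (List.reverse (s r)) s₄ start≡ done λ {s₅} _ (x , g , y , z , _ , o₅) →
        trans y (cong (flag ∘ proj₁) z) , cong proj₂ z , o₅
      where
      T = rippled c true (List.reverse (s r)) []
      Inv : Str → Store → Set
      Inv w s′ = s′ t ≡ w × ∃ λ g → s′ f ≡ flag g × rippled c g w (s′ r) ≡ T × length w + length (s′ r) ≤ B × (∀ x → x ≢ t → x ≢ f → x ≢ r → Same s s′ x)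
      bodyBit : ∀ {b w s′} → Inv (b ∷ w) s′ → Reaches fs B (rippleBit c f r b) (upd s′ t w) (Inv w)
      bodyBit {b} {w} {s′} (p , false , q , e , L , o) = _ , run-empty f₁ (run-push room) ,
          trans (upd-other s₁ _ t≢r) (upd-same s′ t w) , false ,
          trans (upd-other s₁ _ f≢r) f₁ ,
          trans (cong (rippled c false w) r₂) e ,
          ≤-trans (≤-reflexive (trans (cong (λ v → length w + length v) r₂) (+-suc (length w) _))) L ,
          λ x x≢t x≢f x≢r → trans (upd-other s₁ _ x≢r) (trans (upd-other s′ w x≢t) (o x x≢t x≢f x≢r))
        where
        s₁ = upd s′ t w
        f₁ : s₁ f ≡ []
        f₁ = trans (upd-other s′ w (t≢f ∘ sym)) q
        r₁ : s₁ r ≡ s′ r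
        r₁ = upd-other s′ w (t≢r ∘ sym)
        r₂ : upd s₁ r (b ∷ s₁ r) r ≡ b ∷ s′ r
        r₂ = trans (upd-same s₁ r _) (cong (b ∷_) r₁)
        room : suc (length (s₁ r)) ≤ B
        room = ≤-trans (s≤s (≤-trans (≤-reflexive (cong length r₁)) (m≤n+m _ (length w)))) L
      bodyBit {b} {w} {s′} (p , true , q , e , L , o) with keeps (same c b)
        where
        s₁ = upd s′ t w
        s₂ = upd s₁ f []
        s₃ = upd s₂ r (not b ∷ s₂ r)
        f₃ : s₃ f ≡ []
        f₃ = trans (upd-other s₂ _ f≢r) (upd-same s₁ f [])
        keeps : ∀ g → Reaches fs B (keep f g) s₃ (λ s₄ → s₄ f ≡ flag g × (∀ x → x ≢ f → s₄ x ≡ s₃ x))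
        keeps false = s₃ , run-skip , f₃ , λ _ _ → refl
        keeps true  = _ , run-push (≤-trans (s≤s (≤-reflexive (cong length f₃))) 1≤B) ,
          trans (upd-same s₃ f _) (cong (true ∷_) f₃) , λ x x≢ → upd-other s₃ _ x≢
      ... | s₄ , run₄ , f₄ , o₄ = s₄ , run-bit f₁ (run-seq (run-push room) run₄) ,
          trans (o₄ t t≢f) (trans (upd-other s₂ _ t≢r) (trans (upd-other s₁ _ t≢f) (upd-same s′ t w))) , same c b , f₄ ,
          trans (cong (rippled c (same c b) w) r₄) e ,
          ≤-trans (≤-reflexive (trans (cong (λ v → length w + length v) r₄) (+-suc (length w) _))) L ,
          λ x x≢t x≢f x≢r → trans (o₄ x x≢f) (trans (upd-other s₂ _ x≢r) (trans (upd-other s₁ _ x≢f) (trans (upd-other s′ w x≢t) (o x x≢t x≢f x≢r))))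
        where
        s₁ = upd s′ t w
        s₂ = upd s₁ f []
        f₁ : s₁ f ≡ true ∷ []
        f₁ = trans (upd-other s′ w (t≢f ∘ sym)) q
        r₂ : s₂ r ≡ s′ r
        r₂ = trans (upd-other s₁ _ (f≢r ∘ sym)) (upd-other s′ w (t≢r ∘ sym))
        r₄ : s₄ r ≡ not b ∷ s′ r
        r₄ = trans (o₄ r (f≢r ∘ sym)) (trans (upd-same s₂ r _) (cong (not b ∷_) r₂))
        room : suc (length (s₂ r)) ≤ B
        room = ≤-trans (s≤s (≤-trans (≤-reflexive (cong length r₂)) (m≤n+m _ (length w)))) L
      body : ∀ {b w s′} → Inv (b ∷ w) s′ → Reaches fs B (pick b (rippleBit c f r false) (rippleBit c f r true)) (upd s′ t w) (Inv w)
      body {false} = bodyBit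
      body {true}  = bodyBit

-- In bijective numeration the successor of 1...1 is 0...0 with one more digit, and the predecessor
-- of 0...0 is 1...1 with one digit less. These are the cases in which the ripple survives the whole
-- word.
carried borrowed : Bool × Str → Str
carried (true , v)   = false ∷ v
carried (false , v)  = v
borrowed (true , v)  = List.drop 1 v
borrowed (false , v) = v

rippled-idle : ∀ c u rest → rippled c false u rest ≡ (false , u List.ʳ++ rest)
rippled-idle c []      rest = refl
rippled-idle c (b ∷ u) rest = rippled-idle c u (b ∷ rest)

carried-next : ∀ u rest → carried (rippled true true u rest) ≡ next (List.reverse u) ++ rest
carried-next []          rest = cong (_++ rest) (sym next-[])
carried-next (true ∷ u)  rest = trans (carried-next u (false ∷ rest)) (trans (sym (++-assoc (next (List.reverse u)) (false ∷ []) rest))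
  (cong (_++ rest) (trans (sym (next-true (List.reverse u))) (cong next (sym (Listₚ.unfold-reverse true u))))))
carried-next (false ∷ u) rest = trans (cong carried (rippled-idle true u (true ∷ rest))) (trans (Listₚ.ʳ++-defn u)
  (trans (sym (++-assoc (List.reverse u) (true ∷ []) rest)) (cong (_++ rest) (trans (sym (next-false (List.reverse u))) (cong next (sym (Listₚ.unfold-reverse false u)))))))

prev : Str → Str
prev w = str (pred (num w))

prev-next : ∀ w → prev (next w) ≡ w
prev-next w = trans (cong (str ∘ pred) (num-next w)) (str-num w)

-- The rules for the predecessor are those for `next`, inverted by `prev-next`. Borrowing through a
-- `false` needs a rest that is itself a successor, which is why the clause for `false` is split on
-- whether the rest is empty.
borrowed-prev : ∀ b u rest → borrowed (rippled false true (b ∷ u) rest) ≡ prev (List.reverse (b ∷ u)) ++ rest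
borrowed-prev true u rest = trans (cong borrowed (rippled-idle false u (false ∷ rest))) (trans (Listₚ.ʳ++-defn u)
  (trans (sym (++-assoc (List.reverse u) (false ∷ []) rest)) (cong (_++ rest)
    (trans (sym (prev-next (List.reverse u ∷ʳ false))) (cong prev (trans (next-false (List.reverse u)) (sym (Listₚ.unfold-reverse true u))))))))
borrowed-prev false []      rest = cong (_++ rest) (trans (sym (prev-next [])) (cong prev next-[]))
borrowed-prev false (b ∷ u) rest = trans (borrowed-prev b u (true ∷ rest))
  (trans (sym (++-assoc (prev v) (true ∷ []) rest)) (cong (_++ rest) (trans (sym (prev-next (prev v ∷ʳ true)))
    (cong prev (trans (next-true (prev v)) (trans (cong (_∷ʳ false) next-prev) (sym (Listₚ.unfold-reverse false (b ∷ u)))))))))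
  where
  v = List.reverse (b ∷ u)
  next-prev : next (prev v) ≡ v
  next-prev = trans (next-str (pred (num v))) (trans (cong str (aux (num v) positive)) (str-num v))
    where
    aux : ∀ n → 1 ≤ n → suc (pred n) ≡ n
    aux (suc n) _ = refl
    positive : 1 ≤ num v
    positive = subst (λ w → 1 ≤ num w) (sym (Listₚ.unfold-reverse b u)) (subst (1 ≤_) (sym (num-∷ʳ (List.reverse u) b)) (s≤s z≤n))

str-0 : str 0 ≡ []
str-0 = num-injective (trans (num-str 0) (sym num-[]))

str-suc : ∀ n → ∃ λ b → ∃ λ w → str (suc n) ≡ b ∷ w
str-suc n with str (suc n) in eq
... | b ∷ w = b , w , refl
... | []    = contradiction (trans (sym (num-str (suc n))) (trans (cong num eq) num-[])) λ ()

module _ {k l : ℕ} where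

  inc dec₁ : Reg k l → Reg k l → Reg k l → Cmd k l
  inc r t f  = ripple true t f r ⨾ branch f skip skip (push r false)
  dec₁ r t f = ripple false t f r ⨾ branch f skip skip (branch r skip skip skip)

  addOnes : Reg k l → Reg k l → Cmd k l
  addOnes a o = forEach a (push o true) (push o true)

  module _ {fs : Vec StrFun k} {B : ℕ} where

    inc-run : ∀ {r t f} s → Bounded B s → 1 ≤ B → length (next (s r)) ≤ B → t ≢ f → t ≢ r → f ≢ r →
      Reaches fs B (inc r t f) s (λ s′ → s′ r ≡ next (s r) × (∀ x → x ≢ t → x ≢ f → x ≢ r → Same s s′ x))
    inc-run {r} {t} {f} s bd 1≤B small t≢f t≢r f≢r =
      ripple-run true s bd 1≤B t≢f t≢r f≢r then λ {s₁} _ (a , b , o) →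
        aux s₁ (rippled true true (List.reverse (s r)) []) a b o
          (trans (carried-next (List.reverse (s r)) []) (trans (++-identityʳ _) (cong next (Listₚ.reverse-involutive (s r)))))
      where
      aux : ∀ s₁ p → s₁ f ≡ flag (proj₁ p) → s₁ r ≡ proj₂ p → (∀ x → x ≢ t → x ≢ f → x ≢ r → Same s s₁ x) → carried p ≡ next (s r) →
        Reaches fs B (branch f skip skip (push r false)) s₁ (λ s′ → s′ r ≡ next (s r) × (∀ x → x ≢ t → x ≢ f → x ≢ r → Same s s′ x))
      aux s₁ (false , v) a b o e = s₁ , run-empty a run-skip , trans b e , o
      aux s₁ (true , v)  a b o e = _ , run-bit a (run-push (subst (λ w → length w ≤ B) (sym v≡) small)) ,
          trans (upd-same s₂ r _) v≡ , λ x x≢t x≢f x≢r → trans (upd-other s₂ _ x≢r) (trans (upd-other s₁ [] x≢f) (o x x≢t x≢f x≢r))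
        where
        s₂ = upd s₁ f []
        v≡ : false ∷ s₂ r ≡ next (s r)
        v≡ = trans (cong (false ∷_) (trans (upd-other s₁ [] (f≢r ∘ sym)) b)) e

    dec-run : ∀ {r t f n} s → Bounded B s → 1 ≤ B → s r ≡ str (suc n) → t ≢ f → t ≢ r → f ≢ r →
      Reaches fs B (dec₁ r t f) s (λ s′ → s′ r ≡ str n × (∀ x → x ≢ t → x ≢ f → x ≢ r → Same s s′ x))
    dec-run {r} {t} {f} {n} s bd 1≤B sr t≢f t≢r f≢r =
      ripple-run false s bd 1≤B t≢f t≢r f≢r then λ {s₁} _ (a , b , o) →
        aux s₁ (rippled false true (List.reverse (s r)) []) a b o (borrow (List.reverse (s r)) refl)
      where
      borrow : ∀ u → List.reverse (s r) ≡ u → borrowed (rippled false true (List.reverse (s r)) []) ≡ str n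
      borrow []      e = contradiction (trans (sym (num-str (suc n))) (trans (cong num (trans (sym sr)
        (trans (sym (Listₚ.reverse-involutive (s r))) (cong List.reverse e)))) num-[])) λ ()
      borrow (b ∷ u) e = trans (cong (λ v → borrowed (rippled false true v [])) e) (trans (borrowed-prev b u []) (trans (++-identityʳ _)
        (trans (cong (prev ∘ List.reverse) (sym e)) (trans (cong prev (trans (Listₚ.reverse-involutive (s r)) sr)) (cong (str ∘ pred) (num-str (suc n)))))))
      aux : ∀ s₁ p → s₁ f ≡ flag (proj₁ p) → s₁ r ≡ proj₂ p → (∀ x → x ≢ t → x ≢ f → x ≢ r → Same s s₁ x) → borrowed p ≡ str n →
        Reaches fs B (branch f skip skip (branch r skip skip skip)) s₁ (λ s′ → s′ r ≡ str n × (∀ x → x ≢ t → x ≢ f → x ≢ r → Same s s′ x))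
      aux s₁ (false , v) a b o e = s₁ , run-empty a run-skip , trans b e , o
      aux s₁ (true , v)  a b o e with v in eq
      ... | []    = s₂ , run-bit a (run-empty r₂ run-skip) , trans r₂ e , λ x x≢t x≢f x≢r → trans (upd-other s₁ [] x≢f) (o x x≢t x≢f x≢r)
        where
        s₂ = upd s₁ f []
        r₂ : s₂ r ≡ []
        r₂ = trans (upd-other s₁ [] (f≢r ∘ sym)) b
      ... | c ∷ w = _ , run-bit a (run-bit {b = c} r₂ (skips c)) , trans (upd-same s₂ r w) e ,
          λ x x≢t x≢f x≢r → trans (upd-other s₂ w x≢r) (trans (upd-other s₁ [] x≢f) (o x x≢t x≢f x≢r))
        where
        s₂ = upd s₁ f []
        r₂ : s₂ r ≡ c ∷ w
        r₂ = trans (upd-other s₁ [] (f≢r ∘ sym)) b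
        skips : ∀ c → Run fs B (pick c skip skip) (upd s₂ r w) (upd s₂ r w)
        skips false = run-skip
        skips true  = run-skip

    addOnes-run : ∀ {a o n} s → a ≢ o → s o ≡ ones n → length (s a) + n ≤ B →
      Reaches fs B (addOnes a o) s (λ s′ → s′ o ≡ ones (length (s a) + n) × (∀ x → x ≢ a → x ≢ o → Same s s′ x))
    addOnes-run {a} {o} {n} s a≢o so room with forEach-run Inv proj₁ body (s a) s (refl , (n , so , refl) , λ _ _ _ → refl)
      where
      Inv : Str → Store → Set
      Inv w s′ = s′ a ≡ w × (∃ λ m → s′ o ≡ ones m × length w + m ≡ length (s a) + n) × (∀ x → x ≢ a → x ≢ o → Same s s′ x)
      body : ∀ {b w s′} → Inv (b ∷ w) s′ → Reaches fs B (pick b (push o true) (push o true)) (upd s′ a w) (Inv w)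
      body {b} {w} {s′} (p , (m , q , e) , fr) = _ , aux b , trans (upd-other s₁ _ a≢o) (upd-same s′ a w) ,
          (suc m , trans (upd-same s₁ o _) (cong (true ∷_) o₁) , trans (+-suc (length w) m) e) ,
          λ x x≢a x≢o → trans (upd-other s₁ _ x≢o) (trans (upd-other s′ w x≢a) (fr x x≢a x≢o))
        where
        s₁ = upd s′ a w
        o₁ : s₁ o ≡ ones m
        o₁ = trans (upd-other s′ w (a≢o ∘ sym)) q
        fits : suc (length (s₁ o)) ≤ B
        fits = ≤-trans (s≤s (≤-reflexive (trans (cong length o₁) (length-replicate m)))) (≤-trans (s≤s (m≤n+m m (length w))) (≤-trans (≤-reflexive e) room))
        aux : ∀ b → Run fs B (pick b (push o true) (push o true)) s₁ (upd s₁ o (true ∷ s₁ o))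
        aux false = run-push fits
        aux true  = run-push fits
    ... | s′ , p , _ , (m , q , e) , fr = s′ , p , trans q (cong ones e) , fr

  -- Registers that code with base m may read; the others are its workspace.
  Old : ℕ → Reg k l → Set
  Old m (inR _)  = ⊤
  Old m outR     = ⊤
  Old m (qryR _) = ⊥
  Old m (ansR _) = ⊥
  Old m (wrk n)  = n < m

  old-mono : ∀ {m m′} → m ≤ m′ → ∀ r → Old m r → Old m′ r
  old-mono p (inR _) _ = tt
  old-mono p outR    _ = tt
  old-mono p (wrk n) q = ≤-trans q p

  old≢wrk : ∀ {m n r} → Old m r → m ≤ n → r ≢ wrk n
  old≢wrk p q refl = <⇒≱ p q

  wrk≢ : ∀ {m n} → m < n → wrk {k} {l} m ≢ wrk n
  wrk≢ p refl = <-irrefl refl p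

  vals : ∀ {n} → Store → Vec (Reg k l) n → Vec ℕ n
  vals s ins = tabulate λ j → num (s (lookup ins j))

  vals-cong : ∀ {n} s s′ (ins : Vec (Reg k l) n) → (∀ j → Same s s′ (lookup ins j)) → vals s′ ins ≡ vals s ins
  vals-cong s s′ ins p = tabulate-cong λ j → cong num (p j)

  Outcome : ℕ → Reg k l → Str → Store → Store → Set
  Outcome m out w s s′ = s′ out ≡ w × (∀ r → Old m r → r ≢ out → Same s s′ r)

-- `S` bounds what the program needs beyond the store it finds: any `B` above `S` that bounds the
-- initial store will do, so all parts of a program can share one `B`. The target `out` may be among
-- the inputs, as in a loop that overwrites its current value.
record Impl {k l : ℕ} (F S : Fn k l) : Set where
  field
    compiled : ∀ {L} → Vec (Reg k L) l → Reg k L → ℕ → Cmd k L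
    correct  : ∀ {L} {ins : Vec (Reg k L) l} {out m} → (∀ j → Old m (lookup ins j)) → Old m out →
               ∀ {fs B} s → Bounded B s → S fs (vals s ins) ≤ B →
               Reaches fs B (compiled ins out m) s (Outcome m out (str (F fs (vals s ins))) s)

open Impl public

-- Programs for the operations of Core

implExt : ∀ {k l} {F G S T : Fn k l} → (∀ fs ns → F fs ns ≡ G fs ns) → (∀ fs ns → T fs ns ≤ S fs ns) → Impl G T → Impl F S
implExt e p i .compiled = i .compiled
implExt e p i .correct {ins = ins} {out} {m} oi oo {fs} s bd S≤ =
  i .correct oi oo s bd (≤-trans (p fs (vals s ins)) S≤) done λ _ (v , o) → trans v (cong str (sym (e fs (vals s ins)))) , o

zeroI : ∀ {k} → Impl {k} {0} (λ _ _ → 0) (λ _ _ → 0)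
zeroI .compiled ins out m = clear out
zeroI .correct {out = out} oi oo s bd _ with clear-run out s
... | s′ , r , v , o = s′ , r , trans v (sym str-0) , λ x _ x≢ → o x x≢

projI : ∀ {k l} (j : Fin l) → Impl {k} (λ _ ns → lookup ns j) (λ _ _ → 0)
projI j .compiled ins out m = fetch (lookup ins j) (wrk m) (wrk (suc m)) ⨾ put (wrk m) out (wrk (suc m))
projI j .correct {ins = ins} {out} {m} oi oo {fs} {B} s bd _ =
  fetch-run s bd (old≢wrk (oi j) ≤-refl) (old≢wrk (oi j) (n≤1+n m)) (wrk≢ ≤-refl) then λ {s₁} r₁ (v₁ , o₁) →
  put-run {r = out} s₁ (run-bounded fs B r₁ bd) (old≢wrk oo ≤-refl ∘ sym) (wrk≢ ≤-refl) (old≢wrk oo (n≤1+n m)) done λ _ (v₂ , o₂) →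
     trans v₂ (trans v₁ (sym (trans (cong str (lookup∘tabulate _ j)) (str-num _)))) ,
     λ x ox x≢ → trans (o₂ x (old≢wrk ox ≤-refl) x≢ (old≢wrk ox (n≤1+n m))) (o₁ x (old≢wrk ox ≤-refl) (old≢wrk ox (n≤1+n m)))

sucI : ∀ {k} → Impl {k} {1} (λ _ ns → suc (lookup ns zero)) (λ _ ns → suc (len (suc (lookup ns zero))))
sucI .compiled (r ∷ []) out m = fetch r (wrk m) (wrk (suc m)) ⨾ inc (wrk m) (wrk (suc m)) (wrk (2 + m)) ⨾ put (wrk m) out (wrk (suc m))
sucI .correct {ins = r ∷ []} {out} {m} oi oo {fs} {B} s bd S≤ =
  fetch-run s bd (old≢wrk (oi zero) ≤-refl) (old≢wrk (oi zero) (n≤1+n m)) (wrk≢ ≤-refl) then λ {s₁} r₁ (v₁ , o₁) →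
  let bd₁ = run-bounded fs B r₁ bd
      next≡ : next (s₁ (wrk m)) ≡ str (suc (num (s r)))
      next≡ = trans (cong next (trans v₁ (sym (str-num (s r))))) (next-str (num (s r)))
  in inc-run s₁ bd₁ (≤-trans (s≤s z≤n) S≤) (≤-trans (≤-reflexive (cong length next≡)) (≤-trans (n≤1+n _) S≤))
       (wrk≢ ≤-refl) (wrk≢ ≤-refl ∘ sym) (wrk≢ (s≤s (n≤1+n m)) ∘ sym) then λ {s₂} r₂ (v₂ , o₂) →
  put-run {r = out} s₂ (run-bounded fs B r₂ bd₁) (old≢wrk oo ≤-refl ∘ sym) (wrk≢ ≤-refl) (old≢wrk oo (n≤1+n m)) done λ _ (v₃ , o₃) →
     trans v₃ (trans v₂ next≡) , λ x ox x≢ →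
     let x₀ = old≢wrk ox ≤-refl; x₁ = old≢wrk ox (n≤1+n m); x₂ = old≢wrk ox (m≤n+m m 2)
     in trans (o₃ x x₀ x≢ x₁) (trans (o₂ x x₁ x₂ x₀) (o₁ x x₀ x₁))

padI : ∀ {k} → Impl {k} {2} (λ _ ns → pad (lookup ns zero) (lookup ns (suc zero))) (λ _ ns → suc (len (lookup ns zero) + len (lookup ns (suc zero))))
padI .compiled (r ∷ r′ ∷ []) out m = fetch r (wrk m) (wrk (suc m)) ⨾ fetch r′ (wrk (suc m)) (wrk (2 + m)) ⨾ clear (wrk (2 + m)) ⨾
  addOnes (wrk m) (wrk (2 + m)) ⨾ addOnes (wrk (suc m)) (wrk (2 + m)) ⨾ push (wrk (2 + m)) true ⨾ put (wrk (2 + m)) out (wrk m)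
padI .correct {ins = r ∷ r′ ∷ []} {out} {m} oi oo {fs} {B} s bd S≤ =
  fetch-run s bd (old≢wrk (oi zero) ≤-refl) (old≢wrk (oi zero) (n≤1+n m)) a≢b then λ {s₁} r₁ (v₁ , o₁) →
  let bd₁ = run-bounded fs B r₁ bd in
  fetch-run s₁ bd₁ (old≢wrk (oi (suc zero)) (n≤1+n m)) (old≢wrk (oi (suc zero)) (m≤n+m m 2)) b≢c then λ {s₂} r₂ (v₂ , o₂) →
  let bd₂ = run-bounded fs B r₂ bd₁ in
  clear-run (wrk (2 + m)) s₂ then λ {s₃} r₃ (v₃ , o₃) →
  let bd₃ = run-bounded fs B r₃ bd₂
      a₃ : length (s₃ (wrk m)) ≡ len (num (s r))
      a₃ = cong length (trans (o₃ _ a≢c) (trans (o₂ _ a≢b a≢c) (trans v₁ (sym (str-num (s r))))))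
      b₃ : length (s₃ (wrk (suc m))) ≡ len (num (s r′))
      b₃ = cong length (trans (o₃ _ b≢c) (trans v₂ (trans (o₁ r′ (old≢wrk (oi (suc zero)) ≤-refl) (old≢wrk (oi (suc zero)) (n≤1+n m))) (sym (str-num (s r′))))))
  in
  addOnes-run {n = 0} s₃ a≢c v₃ (≤-trans (≤-reflexive (trans (+-identityʳ _) a₃)) (≤-trans (m≤m+n _ _) (≤-trans (n≤1+n _) S≤))) then λ {s₄} r₄ (v₄ , o₄) →
  let bd₄ = run-bounded fs B r₄ bd₃
      b₄ = trans (cong length (o₄ (wrk (suc m)) (a≢b ∘ sym) b≢c)) b₃
      sum≡ : length (s₄ (wrk (suc m))) + (length (s₃ (wrk m)) + 0) ≡ len (num (s r)) + len (num (s r′))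
      sum≡ = trans (cong₂ _+_ b₄ (trans (+-identityʳ _) a₃)) (+-comm (len (num (s r′))) _)
  in
  addOnes-run s₄ b≢c v₄ (≤-trans (≤-reflexive sum≡) (≤-trans (n≤1+n _) S≤)) then λ {s₅} r₅ (v₅ , o₅) →
  let bd₅ = run-bounded fs B r₅ bd₄
      c₅ : s₅ (wrk (2 + m)) ≡ ones (len (num (s r)) + len (num (s r′)))
      c₅ = trans v₅ (cong ones sum≡)
  in
  push-run (wrk (2 + m)) true s₅ (≤-trans (s≤s (≤-reflexive (trans (cong length c₅) (length-replicate _)))) S≤) then λ {s₆} r₆ (v₆ , o₆) →
  put-run {r = out} s₆ (run-bounded fs B r₆ bd₅) (old≢wrk oo (m≤n+m m 2) ∘ sym) (a≢c ∘ sym) (old≢wrk oo ≤-refl) done λ _ (v₇ , o₇) →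
     trans v₇ (trans v₆ (trans (cong (true ∷_) c₅) (sym (str-num _)))) , λ x ox x≢ →
     let x₀ = old≢wrk ox ≤-refl; x₁ = old≢wrk ox (n≤1+n m); x₂ = old≢wrk ox (m≤n+m m 2)
     in trans (o₇ x x₂ x≢ x₀) (trans (o₆ x x₂) (trans (o₅ x x₁ x₂) (trans (o₄ x x₀ x₂) (trans (o₃ x x₂) (trans (o₂ x x₁ x₂) (o₁ x x₀ x₁))))))
  where
  a≢b = wrk≢ {m = m} {suc m} ≤-refl
  a≢c = wrk≢ {m = m} {2 + m} (s≤s (n≤1+n m))
  b≢c = wrk≢ {m = suc m} {2 + m} ≤-refl

-- Query and answer registers are never `Old`, hence free for use here. The query is a copy of an
-- input and so fits already; only the length of the answer enters the bound.
apI : ∀ {k} j → Impl {k} {1} (λ fs ns → apN (lookup fs j) (lookup ns zero)) (λ fs ns → len (apN (lookup fs j) (lookup ns zero)))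
apI j .compiled (r ∷ []) out m = fetch r (qryR j) (wrk m) ⨾ oracle j ⨾ put (ansR j) out (wrk m)
apI j .correct {ins = r ∷ []} {out} {m} oi oo {fs} {B} s bd S≤ =
  fetch-run s bd (λ e → subst (Old m) e (oi zero)) (old≢wrk (oi zero) ≤-refl) (λ ()) then λ {s₁} r₁ (v₁ , o₁) →
  let a₁ : lookup fs j (s₁ (qryR j)) ≡ str (apN (lookup fs j) (num (s r)))
      a₁ = trans (cong (lookup fs j) (trans v₁ (sym (str-num (s r))))) (sym (str-num _))
  in
  oracle-run j s₁ (≤-trans (≤-reflexive (cong length a₁)) S≤) then λ {s₂} r₂ (v₂ , o₂) →
  put-run {t = ansR j} {r = out} s₂ (run-bounded fs B r₂ (run-bounded fs B r₁ bd)) (λ e → subst (Old m) (sym e) oo) (λ ()) (old≢wrk oo ≤-refl) done λ _ (v₃ , o₃) →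
     trans v₃ (trans v₂ a₁) , λ x ox x≢ →
     trans (o₃ x (λ { refl → ox }) x≢ (old≢wrk ox ≤-refl)) (trans (o₂ x (λ { refl → ox })) (o₁ x (λ { refl → ox }) (old≢wrk ox ≤-refl)))

module _ {k l : ℕ} where

  seqAll : ∀ {n} → (Fin n → Cmd k l) → Cmd k l
  seqAll {zero}  c = skip
  seqAll {suc n} c = c zero ⨾ seqAll (c ∘ suc)

  -- Each value joins the invariant once it is computed; later commands preserve it because each
  -- leaves the targets of the others alone.
  seqAll-run : ∀ {n fs B} {c : Fin n → Cmd k l} (I : Store → Set) (t : Fin n → Reg k l) (v : Fin n → Str) →
    (∀ j s → Bounded B s → I s → Reaches fs B (c j) s λ s′ → I s′ × s′ (t j) ≡ v j × (∀ j′ → j′ ≢ j → Same s s′ (t j′))) →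
    ∀ s → Bounded B s → I s → Reaches fs B (seqAll c) s λ s′ → I s′ × (∀ j → s′ (t j) ≡ v j)
  seqAll-run {zero}  I t v h s bd i = s , run-skip , i , λ ()
  seqAll-run {suc n} {fs} {B} I t v h s bd i =
    h zero s bd i then λ {s₁} r₁ (i₁ , v₁ , _) →
    seqAll-run (λ s → I s × s (t zero) ≡ v zero) (t ∘ suc) (v ∘ suc)
        (λ j s bd (i , e) → h (suc j) s bd i done λ _ (i′ , w , o) →
           (i′ , trans (o zero λ ()) e) , w , λ j′ j′≢ → o (suc j′) (j′≢ ∘ Finₚ.suc-injective))
        s₁ (run-bounded fs B r₁ bd) (i₁ , v₁) done λ _ ((i₂ , e₂) , v₂) →
    i₂ , λ { zero → e₂ ; (suc j) → v₂ j }

compI : ∀ {k l n} {H SH : Fn k n} {Gs SGs : Fin n → Fn k l} {S : Fn k l} → Impl H SH → (∀ j → Impl (Gs j) (SGs j)) →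
  (∀ fs ns j → SGs j fs ns ≤ S fs ns) → (∀ fs ns → SH fs (tabulate λ j → Gs j fs ns) ≤ S fs ns) →
  Impl (λ fs ns → H fs (tabulate λ j → Gs j fs ns)) S
compI {n = n} h gs p q .compiled ins out m =
  seqAll (λ j → gs j .compiled ins (wrk (m + toℕ j)) (m + n)) ⨾ h .compiled (tabulate λ j → wrk (m + toℕ j)) out (m + n)
compI {n = n} {H} {SH} {Gs} {SGs} h gs p q .correct {ins = ins} {out} {m} oi oo {fs} {B} s bd S≤ =
  seqAll-run I t (λ j → str (Gs j fs (vals s ins))) arg s bd (λ _ _ → refl) then λ {s₁} r₁ (i₁ , v₁) →
  let vals≡ : vals s₁ (tabulate t) ≡ tabulate λ j → Gs j fs (vals s ins)
      vals≡ = tabulate-cong λ j → trans (cong (num ∘ s₁) (lookup∘tabulate t j)) (trans (cong num (v₁ j)) (num-str _))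
  in h .correct (λ j → subst (Old (m + n)) (sym (lookup∘tabulate t j)) (oldT j)) (old-mono (m≤m+n m n) out oo) s₁
        (run-bounded fs B r₁ bd) (≤-trans (≤-reflexive (cong (SH fs) vals≡)) (≤-trans (q fs (vals s ins)) S≤)) done λ _ (v₂ , o₂) →
  trans v₂ (cong (str ∘ H fs) vals≡) , λ x ox x≢ → trans (o₂ x (old-mono (m≤m+n m n) x ox) x≢) (i₁ x ox)
  where
  t : Fin n → Reg _ _
  t j = wrk (m + toℕ j)
  I : Store → Set
  I s′ = ∀ x → Old m x → Same s s′ x
  oldT : ∀ j → Old (m + n) (t j)
  oldT j = +-monoʳ-< m (toℕ<n j)
  arg : ∀ j s′ → Bounded B s′ → I s′ → Reaches fs B (gs j .compiled ins (t j) (m + n)) s′ λ s″ →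
    I s″ × s″ (t j) ≡ str (Gs j fs (vals s ins)) × (∀ j′ → j′ ≢ j → Same s′ s″ (t j′))
  arg j s′ bd′ i with vals-cong s s′ ins (λ j → i (lookup ins j) (oi j))
  ... | e with gs j .correct {ins = ins} {t j} {m + n} (λ j → old-mono (m≤m+n m n) (lookup ins j) (oi j)) (oldT j) s′ bd′
                 (≤-trans (≤-reflexive (cong (SGs j fs) e)) (≤-trans (p fs (vals s ins) j) S≤))
  ... | s″ , r , v , o = s″ , r , (λ x ox → trans (o x (old-mono (m≤m+n m n) x ox) (old≢wrk ox (m≤m+n m _))) (i x ox)) ,
        trans v (cong (str ∘ Gs j fs) e) , λ j′ j′≢ → o (t j′) (oldT j′) (j′≢ ∘ toℕ-injective ∘ +-cancelˡ-≡ m _ _ ∘ wrk-injective)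

-- The registers m, …, m + 4 hold the number of remaining rounds, the round
-- number, the current value and two workspaces of the counters.
module _ {k l : ℕ} {G SG : Fn k l} {H SH : Fn k (2 + l)} (g : Impl G SG) (h : Impl H SH) where

  private
    R : Vec StrFun k → Vec ℕ l → ℕ → ℕ
    R fs ns = rec (G fs ns) (λ m a → H fs (m ∷ a ∷ ns))

  module _ {L : ℕ} (ins : Vec (Reg k L) l) (m : ℕ) where

    private
      d c y t f : Reg k L
      d = wrk m
      c = wrk (1 + m)
      y = wrk (2 + m)
      t = wrk (3 + m)
      f = wrk (4 + m)

    recBody : Cmd k L
    recBody = dec₁ d t f ⨾ h .compiled (c ∷ y ∷ ins) y (5 + m) ⨾ inc c t f

    module _ (oi : ∀ j → Old m (lookup ins j)) {fs : Vec StrFun k} {B : ℕ} (s₀ : Store) {N : ℕ} (1≤B : 1 ≤ B) (N≤ : len N ≤ B)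
             (SH≤ : ∀ j → j < N → SH fs (j ∷ R fs (vals s₀ ins) j ∷ vals s₀ ins) ≤ B) where

      Round : ℕ → ℕ → Store → Set
      Round j n s = s d ≡ str n × s c ≡ str j × s y ≡ str (R fs (vals s₀ ins) j) × (∀ x → Old m x → Same s₀ s x)

      rec-round : ∀ j n s → j < N → Bounded B s → Round j (suc n) s → Reaches fs B recBody s (Round (suc j) n)
      rec-round j n s j<N bd (sd , sc , sy , fr) =
        dec-run s bd 1≤B sd (wrk≢ ≤-refl) (wrk≢ {m = m} {3 + m} (m<n+m m (s≤s z≤n)) ∘ sym) (wrk≢ {m = m} {4 + m} (m<n+m m (s≤s z≤n)) ∘ sym) then λ {s₁} r₁ (v₁ , o₁) →
        let bd₁ = run-bounded fs B r₁ bd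
            c₁ : s₁ c ≡ str j
            c₁ = trans (o₁ c c≢t c≢f (wrk≢ {m = m} {1 + m} ≤-refl ∘ sym)) sc
            y₁ : s₁ y ≡ str (R fs (vals s₀ ins) j)
            y₁ = trans (o₁ y y≢t y≢f (wrk≢ {m = m} {2 + m} (s≤s (n≤1+n m)) ∘ sym)) sy
            fr₁ : ∀ x → Old m x → Same s₀ s₁ x
            fr₁ x ox = trans (o₁ x (old≢wrk ox (m≤n+m m 3)) (old≢wrk ox (m≤n+m m 4)) (old≢wrk ox ≤-refl)) (fr x ox)
            e₁ : vals s₁ (c ∷ y ∷ ins) ≡ j ∷ R fs (vals s₀ ins) j ∷ vals s₀ ins
            e₁ = cong₂ _∷_ (trans (cong num c₁) (num-str j)) (cong₂ _∷_ (trans (cong num y₁) (num-str _)) (vals-cong s₀ s₁ ins λ i → fr₁ _ (oi i)))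
        in
        h .correct {ins = c ∷ y ∷ ins} {y} {5 + m} (λ { zero → wrk<5 (s≤s (s≤s z≤n)) ; (suc zero) → wrk<5 (s≤s (s≤s (s≤s z≤n))) ; (suc (suc i)) → old-mono (m≤n+m m 5) _ (oi i) })
          (wrk<5 (s≤s (s≤s (s≤s z≤n)))) s₁ bd₁ (≤-trans (≤-reflexive (cong (SH fs) e₁)) (SH≤ j j<N)) then λ {s₂} r₂ (v₂ , o₂) →
        let bd₂ = run-bounded fs B r₂ bd₁
            c₂ : s₂ c ≡ str j
            c₂ = trans (o₂ c (wrk<5 (s≤s (s≤s z≤n))) (y≢c ∘ sym)) c₁
            next≡ : next (s₂ c) ≡ str (suc j)
            next≡ = trans (cong next c₂) (next-str j)
        -- The round number never exceeds `N`, so its register is no longer than the word for `N`,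
        -- which fits by `N≤`.
        in inc-run {r = c} {t} {f} s₂ bd₂ 1≤B (≤-trans (≤-reflexive (cong length next≡)) (≤-trans (len-mono j<N) N≤)) (wrk≢ ≤-refl) (c≢t ∘ sym) (c≢f ∘ sym) done λ _ (v₃ , o₃) →
           trans (o₃ d (wrk≢ (m<n+m m {3} (s≤s z≤n))) (wrk≢ (m<n+m m {4} (s≤s z≤n))) (wrk≢ ≤-refl)) (trans (o₂ d (wrk<5 (s≤s z≤n)) (wrk≢ (s≤s (n≤1+n m)))) v₁) ,
           trans v₃ next≡ ,
           trans (o₃ y y≢t y≢f y≢c) (trans v₂ (cong (str ∘ H fs) e₁)) ,
           λ x ox → trans (o₃ x (old≢wrk ox (m≤n+m m 3)) (old≢wrk ox (m≤n+m m 4)) (old≢wrk ox (m≤n+m m 1)))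
             (trans (o₂ x (old-mono (m≤n+m m 5) x ox) (old≢wrk ox (m≤n+m m 2))) (fr₁ x ox))
        where
        wrk<5 : ∀ {i} → i < 5 → i + m < 5 + m
        wrk<5 p = +-monoˡ-< m p
        c≢t : c ≢ t
        c≢t = wrk≢ (s≤s (s≤s (n≤1+n m)))
        c≢f : c ≢ f
        c≢f = wrk≢ (s≤s (s≤s (m≤n+m m 2)))
        y≢t : y ≢ t
        y≢t = wrk≢ ≤-refl
        y≢f : y ≢ f
        y≢f = wrk≢ (s≤s (s≤s (s≤s (n≤1+n m))))
        y≢c : y ≢ c
        y≢c = wrk≢ {m = 1 + m} {2 + m} ≤-refl ∘ sym

      rec-rounds : ∀ n j s → j + n ≡ N → Bounded B s → Round j n s → Reaches fs B (while d recBody) s (Round N 0)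
      rec-rounds zero    j s e bd i@(sd , _) = s , run-done (trans sd str-0) , subst (λ j → Round j 0 s) (trans (sym (+-identityʳ j)) e) i
      rec-rounds (suc n) j s e bd i@(sd , _) =
        let e′ = trans (sym (+-suc j n)) e
            (s₁ , r₁ , i₁) = rec-round j n s (subst (suc j ≤_) e′ (m≤m+n (suc j) n)) bd i
            (s₂ , r₂ , i₂) = rec-rounds n (suc j) s₁ e′ (run-bounded fs B r₁ bd) i₁
        in s₂ , run-again (trans sd (proj₂ (proj₂ (str-suc n)))) r₁ r₂ , i₂

  -- The first premise makes room for the carry flag of the counters. Room for `H` is demanded only
  -- at the arguments with which the loop calls it, so no majorant of the recursion appears.
  recI : ∀ {S : Fn k (suc l)} → (∀ fs n ns → 1 ≤ S fs (n ∷ ns)) → (∀ fs n ns → SG fs ns ≤ S fs (n ∷ ns)) →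
    (∀ fs n ns j → j < n → SH fs (j ∷ R fs ns j ∷ ns) ≤ S fs (n ∷ ns)) →
    Impl (λ fs ns → R fs (Vec.tail ns) (Vec.head ns)) S
  recI p q r .compiled (x ∷ ins) out m = fetch x (wrk m) (wrk (3 + m)) ⨾ clear (wrk (1 + m)) ⨾ g .compiled ins (wrk (2 + m)) (5 + m) ⨾
    while (wrk m) (recBody ins m) ⨾ put (wrk (2 + m)) out (wrk (3 + m))
  recI {S} p q r .correct {ins = x ∷ ins} {out} {m} oi oo {fs} {B} s bd S≤ =
    fetch-run s bd (old≢wrk (oi zero) ≤-refl) (old≢wrk (oi zero) (m≤n+m m 3)) (wrk≢ (m<n+m m {3} (s≤s z≤n))) then λ {s₁} r₁ (v₁ , o₁) →
    let bd₁ = run-bounded fs B r₁ bd in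
    clear-run (wrk (1 + m)) s₁ then λ {s₂} r₂ (v₂ , o₂) →
    let bd₂ = run-bounded fs B r₂ bd₁
        fr₂ : ∀ x → Old m x → Same s s₂ x
        fr₂ x ox = trans (o₂ x (old≢wrk ox (m≤n+m m 1))) (o₁ x (old≢wrk ox ≤-refl) (old≢wrk ox (m≤n+m m 3)))
        e₂ : vals s₂ ins ≡ vals s ins
        e₂ = vals-cong s s₂ ins λ j → fr₂ _ (oi (suc j))
    in
    g .correct {ins = ins} {wrk (2 + m)} {5 + m} (λ j → old-mono (m≤n+m m 5) _ (oi (suc j))) (+-monoˡ-< m {2} {5} (s≤s (s≤s (s≤s z≤n)))) s₂ bd₂
      (≤-trans (≤-reflexive (cong (SG fs) e₂)) (≤-trans (q fs N (vals s ins)) S≤)) then λ {s₃} r₃ (v₃ , o₃) →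
    let bd₃ = run-bounded fs B r₃ bd₂
        d₃ = trans (o₃ (wrk m) (m<n+m m {5} (s≤s z≤n)) (wrk≢ (m<n+m m {2} (s≤s z≤n)))) (trans (o₂ _ (wrk≢ ≤-refl)) (trans v₁ (sym (str-num (s x)))))
        c₃ = trans (o₃ (wrk (1 + m)) (+-monoˡ-< m {1} {5} (s≤s (s≤s z≤n))) (wrk≢ ≤-refl)) (trans v₂ (sym str-0))
        y₃ = trans v₃ (cong (str ∘ G fs) e₂)
        fr₃ : ∀ x → Old m x → Same s s₃ x
        fr₃ x ox = trans (o₃ x (old-mono (m≤n+m m 5) x ox) (old≢wrk ox (m≤n+m m 2))) (fr₂ x ox)
    in
    rec-rounds ins m (oi ∘ suc) s (≤-trans (p fs N (vals s ins)) S≤) (≤-trans (≤-reflexive (cong length (str-num (s x)))) (bd x))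
      (λ j j<N → ≤-trans (r fs N (vals s ins) j j<N) S≤) N 0 s₃ refl bd₃ (d₃ , c₃ , y₃ , fr₃) then λ {s₄} r₄ (_ , _ , y₄ , fr₄) →
    put-run {r = out} s₄ (run-bounded fs B r₄ bd₃) (old≢wrk oo (m≤n+m m 2) ∘ sym) (wrk≢ ≤-refl) (old≢wrk oo (m≤n+m m 3)) done λ _ (v₅ , o₅) →
    trans v₅ y₄ , λ z oz z≢ → trans (o₅ z (old≢wrk oz (m≤n+m m 2)) z≢ (old≢wrk oz (m≤n+m m 3))) (fr₄ z oz)
    where
    N = num (s x)

-- Space bounds

∈-strings≤ : ∀ w {n} → length w ≤ n → w ∈ strings≤ n
∈-strings≤ []          {zero}  p       = here refl
∈-strings≤ []          {suc n} p       = here refl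
∈-strings≤ (false ∷ w) {suc n} (s≤s p) = there (∈-++⁺ˡ (∈-map⁺ (false ∷_) (∈-strings≤ w p)))
∈-strings≤ (true ∷ w)  {suc n} (s≤s p) = there (∈-++⁺ʳ (map (false ∷_) (strings≤ n)) (∈-map⁺ (true ∷_) (∈-strings≤ w p)))

length≤funLength : ∀ f w {n} → length w ≤ n → length (f w) ≤ funLength f n
length≤funLength f w {n} p = All.lookup (xs≤max 0 (map (length ∘ f) (strings≤ n))) (∈-map⁺ (length ∘ f) (∈-strings≤ w p))

funLength-mono : ∀ f {m n} → m ≤ n → funLength f m ≤ funLength f n
funLength-mono f {m} p = max≤v⁺ z≤n (Allₚ.map⁺ (All.map (λ {w} q → length≤funLength f w (≤-trans q p)) (strings-length m)))

module _ (i : ℕ) {k : ℕ} (fs : Vec StrFun k) where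

  qp : ∀ {l} → QuasiPoly k l → Vec ℕ l → ℕ
  qp P = eval i P (Vec.map funLength fs)

  qp-mono : ∀ {l} (P : QuasiPoly k l) {ms ns} → (∀ j → lookup ms j ≤ lookup ns j) → qp P ms ≤ qp P ns
  qp-mono (const c) p = ≤-refl
  qp-mono (var j)   p = p j
  qp-mono (P ⊕ Q)   p = +-mono-≤ (qp-mono P p) (qp-mono Q p)
  qp-mono (P ⊗ Q)   p = *-mono-≤ (qp-mono P p) (qp-mono Q p)
  qp-mono (app j P) {ms} {ns} p = subst (λ L → L (qp P ms) ≤ L (qp P ns)) (sym (lookup-map j funLength fs)) (funLength-mono (lookup fs j) (qp-mono P p))
  qp-mono (grow P)  p = g-mono i (qp-mono P p)

substP : ∀ {k l m} → QuasiPoly k m → (Fin m → QuasiPoly k l) → QuasiPoly k l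
substP (const c) σ = const c
substP (var j)   σ = σ j
substP (P ⊕ Q)   σ = substP P σ ⊕ substP Q σ
substP (P ⊗ Q)   σ = substP P σ ⊗ substP Q σ
substP (app j P) σ = app j (substP P σ)
substP (grow P)  σ = grow (substP P σ)

eval-substP : ∀ i {k l m} (P : QuasiPoly k m) (σ : Fin m → QuasiPoly k l) Ls ns →
  eval i (substP P σ) Ls ns ≡ eval i P Ls (tabulate λ j → eval i (σ j) Ls ns)
eval-substP i (const c) σ Ls ns = refl
eval-substP i (var j)   σ Ls ns = sym (lookup∘tabulate _ j)
eval-substP i (P ⊕ Q)   σ Ls ns = cong₂ _+_ (eval-substP i P σ Ls ns) (eval-substP i Q σ Ls ns)
eval-substP i (P ⊗ Q)   σ Ls ns = cong₂ _*_ (eval-substP i P σ Ls ns) (eval-substP i Q σ Ls ns)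
eval-substP i (app j P) σ Ls ns = cong (lookup Ls j) (eval-substP i P σ Ls ns)
eval-substP i (grow P)  σ Ls ns = cong (g i) (eval-substP i P σ Ls ns)

≤-substP : ∀ i {k l m} (fs : Vec StrFun k) (P : QuasiPoly k m) (σ : Fin m → QuasiPoly k l) {ms ns} →
  (∀ j → lookup ms j ≤ qp i fs (σ j) ns) → qp i fs P ms ≤ qp i fs (substP P σ) ns
≤-substP i fs P σ {ms} {ns} p = ≤-trans (qp-mono i fs P (λ j → subst (lookup ms j ≤_) (sym (lookup∘tabulate _ j)) (p j)))
  (≤-reflexive (sym (eval-substP i P σ (Vec.map funLength fs) ns)))

lens : ∀ {l} → Vec ℕ l → Vec ℕ l
lens = Vec.map len

-- One polynomial bounds both the registers and the length of the value. The bound on the value is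
-- what allows polynomials to be substituted into each other under composition and recursion.
record Feasible (i : ℕ) {k l : ℕ} (F : Fn k l) : Set where
  field
    poly  : QuasiPoly k l
    impl  : Impl F (λ fs ns → qp i fs poly (lens ns))
    small : ∀ fs ns → len (F fs ns) ≤ qp i fs poly (lens ns)

open Feasible public

len-suc≤ : ∀ n → len (suc n) ≤ suc (len n)
len-suc≤ n = s≤s⁻¹ (2^-cancel-< {len (suc n)} {2 + len n}
  (≤-<-trans (≤-trans (2^len≤ (suc n)) (<2^len n)) (^-monoʳ-< 2 (s≤s (s≤s z≤n)) {suc (len n)} {2 + len n} ≤-refl)))

len-0 : len 0 ≡ 0
len-0 = cong length str-0

≤sumP : ∀ i {k l m} (f : Fin m → QuasiPoly k l) (fs : Vec StrFun k) ns j → qp i fs (f j) ns ≤ qp i fs (sumP f) ns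
≤sumP i f fs ns zero    = m≤m+n _ _
≤sumP i f fs ns (suc j) = ≤-trans (≤sumP i (f ∘ suc) fs ns j) (m≤n+m _ _)

-- The growth function is a parameter. For the index `nothing` the parameter is vacuous, and this
-- instance provides the subprograms from which the growth function is then programmed.
Core⇒Feasible : ∀ {i γ k l} {F : Fn k l} → (∀ {n} → γ ≡ just n → Feasible i {k} {1} (λ _ ns → growN n (lookup ns zero))) →
  Core γ k F → Feasible i F
Core⇒Feasible gr zeroC = record { poly = const 0 ; impl = zeroI ; small = λ _ _ → ≤-reflexive len-0 }
Core⇒Feasible gr sucC  = record { poly = const 2 ⊕ var zero
  ; impl  = implExt (λ _ _ → refl) (λ { _ (n ∷ []) → s≤s (len-suc≤ n) }) sucI
  ; small = λ { _ (n ∷ []) → ≤-trans (len-suc≤ n) (n≤1+n _) } }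
Core⇒Feasible gr padC  = record { poly = const 1 ⊕ (var zero ⊕ var (suc zero))
  ; impl  = implExt (λ _ _ → refl) (λ { _ (m ∷ n ∷ []) → ≤-refl }) padI
  ; small = λ { _ (m ∷ n ∷ []) → ≤-reflexive (len-pad m n) } }
Core⇒Feasible gr (growC e) = gr e
Core⇒Feasible {i} {k = k} gr (apC j) = record { poly = app j (var zero) ; impl = implExt (λ _ _ → refl) bound (apI j) ; small = bound }
  where
  bound : ∀ fs ns → len (apN (lookup fs j) (lookup ns zero)) ≤ qp i {k} fs (app j (var zero)) (lens {1} ns)
  bound fs (n ∷ []) = subst₂ _≤_ (cong length (sym (str-num _))) (cong-app (sym (lookup-map j funLength fs)) (len n))
    (length≤funLength (lookup fs j) (str n) ≤-refl)
Core⇒Feasible gr (proj j) = record { poly = var j ; impl = implExt (λ _ _ → refl) (λ _ _ → z≤n) (projI j)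
  ; small = λ fs ns → ≤-reflexive (sym (lookup-map j len ns)) }
Core⇒Feasible {i} gr (comp {H = H} {Gs} p q) = record
  { poly  = sumP (λ j → gs j .poly) ⊕ substP (h .poly) (λ j → gs j .poly)
  ; impl  = compI (h .impl) (λ j → gs j .impl) (λ fs ns j → ≤-trans (≤sumP i (λ j → gs j .poly) fs (lens ns) j) (m≤m+n _ _))
              (λ fs ns → ≤-trans (inner fs ns) (m≤n+m _ _))
  ; small = λ fs ns → ≤-trans (h .small fs (tabulate λ j → Gs j fs ns)) (≤-trans (inner fs ns) (m≤n+m _ _)) }
  where
  h  = Core⇒Feasible gr p
  gs = λ j → Core⇒Feasible gr (q j)
  inner : ∀ fs ns → qp i fs (h .poly) (lens (tabulate λ j → Gs j fs ns)) ≤ qp i fs (substP (h .poly) (λ j → gs j .poly)) (lens ns)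
  inner fs ns = ≤-substP i fs (h .poly) (λ j → gs j .poly) λ j →
    subst (_≤ qp i fs (gs j .poly) (lens ns)) (sym (trans (lookup-map j len (tabulate λ j → Gs j fs ns)) (cong len (lookup∘tabulate (λ j → Gs j fs ns) j)))) (gs j .small fs ns)
Core⇒Feasible {i} {k = k} gr (recur {l} {G} {H} {K} p q r b) = record
  { poly  = P
  ; impl  = recI (g₀ .impl) (h .impl) (λ { fs n ns → s≤s z≤n })
      (λ fs n ns → ≤-trans (≤-substP i fs (g₀ .poly) (var ∘ suc) (λ j → ≤-refl)) (≤-trans (m≤m+n _ _) (≤-trans (m≤m+n _ _) (m≤n+m _ 1))))
      (λ fs n ns j j<n → ≤-trans (≤-substP i fs (h .poly) σ {ns = lens (n ∷ ns)}
         (λ { zero → len-mono (<⇒≤ j<n) ; (suc zero) → value fs j n ns (<⇒≤ j<n) ; (suc (suc x)) → ≤-refl }))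
         (≤-trans (m≤n+m _ (qp i fs (substP (g₀ .poly) (var ∘ suc)) (lens (n ∷ ns)))) (≤-trans (m≤m+n _ (qp i fs (k₀ .poly) (lens (n ∷ ns)))) (m≤n+m _ 1))))
  ; small = λ { fs (n ∷ ns) → ≤-trans (value fs n n ns ≤-refl) (≤-trans (m≤n+m _ (qp i fs (substP (g₀ .poly) (var ∘ suc)) (lens (n ∷ ns)) + qp i fs (substP (h .poly) σ) (lens (n ∷ ns)))) (m≤n+m _ 1)) } }
  where
  g₀ = Core⇒Feasible gr p
  h  = Core⇒Feasible gr q
  k₀ = Core⇒Feasible gr r
  -- The previous value is an argument of `H`; the polynomial of the majorant `K` stands in for its
  -- length. Without it the bounds would be nested once per round.
  σ : Fin (2 + l) → QuasiPoly k (suc l)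
  σ zero          = var zero
  σ (suc zero)    = k₀ .poly
  σ (suc (suc j)) = var (suc j)
  P : QuasiPoly k (suc l)
  P = const 1 ⊕ ((substP (g₀ .poly) (var ∘ suc) ⊕ substP (h .poly) σ) ⊕ k₀ .poly)
  value : ∀ fs j n ns → j ≤ n → len (rec (G fs ns) (λ m a → H fs (m ∷ a ∷ ns)) j) ≤ qp i fs (k₀ .poly) (lens (n ∷ ns))
  value fs j n ns j≤n = ≤-trans (len-mono (b fs j ns)) (≤-trans (k₀ .small fs (j ∷ ns))
    (qp-mono i fs (k₀ .poly) λ { zero → len-mono j≤n ; (suc x) → ≤-refl }))
Core⇒Feasible gr (ext e p) = record { poly = f .poly ; impl = implExt e (λ _ _ → ≤-refl) (f .impl)
  ; small = λ fs ns → ≤-trans (≤-reflexive (cong len (e fs ns))) (f .small fs ns) }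
  where f = Core⇒Feasible gr p

-- Programs for the growth functions

cat : ℕ → ℕ → ℕ
cat m n = half (pred (pad m n))

-- On numbers, `half ∘ pred` deletes the last bit, here the extra one in `pad`. What remains adds
-- lengths in unary exactly.
cat-ones : ∀ m n → cat m n ≡ num (ones (len m + len n))
cat-ones m n = trans (cong (half ∘ pred ∘ num) (sym (ones-∷ʳ (len m + len n)))) (half-snoc (ones (len m + len n)) true)

num-ones-mono-< : ∀ {m n} → m < n → num (ones m) < num (ones n)
num-ones-mono-< {m} {n} p = +-cancelˡ-< 2 _ _ (subst₂ _<_ (num-ones m) (num-ones n) (^-monoʳ-< 2 (s≤s (s≤s z≤n)) (s≤s p)))

-- The length grows by at most one from `m` to `suc m`. `Core` does not see lengths directly, but
-- `cat m 0` depends only on the length of `m` and is strictly increasing in it, so comparing two of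
-- them detects the growth.
lenStep : ℕ → ℕ → ℕ
lenStep m a = if0 (cat (suc m) 0 ∸ cat m 0) a (suc a)

len-rec : ∀ n → len n ≡ rec 0 lenStep n
len-rec zero    = len-0
len-rec (suc n) with m≤n⇒m<n∨m≡n (len-suc≤ n)
... | inj₁ p = trans (≤-antisym (s≤s⁻¹ p) (len-mono (n≤1+n n))) (trans (len-rec n) (sym (if0-≤ (≤-reflexive (trans (cat-ones (suc n) 0)
        (trans (cong (λ m → num (ones (m + len 0))) (≤-antisym (s≤s⁻¹ p) (len-mono (n≤1+n n)))) (sym (cat-ones n 0))))) (rec 0 lenStep n) _)))
... | inj₂ p = trans p (trans (cong suc (len-rec n)) (sym (if0-> (subst₂ _<_ (sym (cat-ones n 0)) (sym (cat-ones (suc n) 0))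
        (num-ones-mono-< (+-monoˡ-< (len 0) (≤-reflexive (sym p))))) (rec 0 lenStep n) _)))

len≤ : ∀ n → len n ≤ n
len≤ n = s≤s⁻¹ (≤-trans (n<2^n (len n)) (2^len≤ n))

-- As 2^|n| < n + 2 ≤ 2^(|n|+1), the length of a word is a rounded logarithm in disguise.
⌈log₂2+n⌉ : ∀ n → ⌈log₂ 2 + n ⌉ ≡ suc (len n)
⌈log₂2+n⌉ n = ≤-antisym
  (subst (⌈log₂ 2 + n ⌉ ≤_) (⌈log₂2^n⌉≡n (suc (len n))) (⌈log₂⌉-mono-≤ (<2^len n)))
  (≰⇒> λ p → <⇒≱ (s≤s (2^len≤ n)) (≤-trans (n≤2^⌈log₂n⌉ (2 + n)) (^-monoʳ-≤ 2 p)))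

⌈log₂n⌉≤n : ∀ n → ⌈log₂ n ⌉ ≤ n
⌈log₂n⌉≤n n = subst (⌈log₂ n ⌉ ≤_) (⌈log₂2^n⌉≡n n) (⌈log₂⌉-mono-≤ (<⇒≤ (n<2^n n)))

-- Growth functions act on lengths, so the logarithm is delivered as the length of a word. It is 0
-- for lengths L below 2; from there on `⌈log₂2+n⌉` applies at L - 2, and the extra letter of `pad`
-- is the successor in it.
logN : ℕ → ℕ
logN n = if0 (len n ∸ 1) 0 (pad (len n ∸ 2) 0)

len-logN : ∀ n → len (logN n) ≡ ⌈log₂ len n ⌉
len-logN n = aux (len n)
  where
  aux : ∀ L → len (if0 (L ∸ 1) 0 (pad (L ∸ 2) 0)) ≡ ⌈log₂ L ⌉
  aux zero          = len-0
  aux (suc zero)    = len-0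
  aux (suc (suc L)) = trans (len-pad L 0) (trans (cong suc (trans (cong (len L +_) len-0) (+-identityʳ _))) (sym (⌈log₂2+n⌉ L)))

module _ {k : ℕ} where

  catC : ∀ {l} {f h : Fn k l} → Core nothing k f → Core nothing k h → Core nothing k (λ fs ns → cat (f fs ns) (h fs ns))
  catC p q = halfC {0} (predC (padC₂ p q))

  lenC : ∀ {l} {f : Fn k l} → Core nothing k f → Core nothing k (λ fs ns → len (f fs ns))
  lenC {f = f} p = ext (λ fs ns → len-rec (f fs ns)) (recC (constC 0)
    (if0C (∸C (catC (sucC₁ (proj zero)) (constC 0)) (catC (proj zero) (constC 0))) (proj (suc zero)) (sucC₁ (proj (suc zero))))
    (proj zero) (λ fs n ns → subst (_≤ n) (len-rec n) (len≤ n)) p)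

  logC : ∀ {l} {f : Fn k l} → Core nothing k f → Core nothing k (λ fs ns → logN (f fs ns))
  logC p = if0C (∸C (lenC p) (constC 1)) (constC 0) (padC₂ (∸C (lenC p) (constC 2)) (constC 0))

  module _ (i : ℕ) where

    abstract

      feasible : ∀ {l} {F : Fn k l} → Core nothing k F → Feasible i F
      feasible = Core⇒Feasible λ ()

    -- The space bound of a function of fast growth may refer to its value.
    record Growing (h : ℕ → ℕ) : Set where
      field
        poly₂ : QuasiPoly k 2
        impl₂ : Impl {k} {1} (λ _ ns → num (ones (h (len (lookup ns zero)))))
                  (λ fs ns → qp i fs poly₂ (len (lookup ns zero) ∷ h (len (lookup ns zero)) ∷ []))

    open Growing

    private
      lenF : Feasible i {k} {1} (λ _ ns → len (lookup ns zero))
      lenF = feasible (lenC (proj zero))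

    -- Values are words of ones, of length `h j L` after j rounds. Using `recur` would call for a
    -- majorant in growth-free `Core`; `recI` asks for room only at the values that occur, and by
    -- monotonicity these are no longer than the result, whose length is the second variable of
    -- `poly₂`.
    iterating : ∀ {b : ℕ} {s : ℕ → ℕ → ℕ} (h : ℕ → ℕ → ℕ) → Core nothing k {3} (λ _ ns → s (lookup ns (suc zero)) (lookup ns (suc (suc zero)))) →
      (∀ L → b ≡ num (ones (h 0 L))) → (∀ j x → s (num (ones (h j (len x)))) x ≡ num (ones (h (suc j) (len x)))) →
      (∀ {j j′} L → j ≤ j′ → h j L ≤ h j′ L) → Growing (λ n → h n n)
    iterating {b} {s} h sC base step mono = record
      { poly₂ = P
      ; impl₂ = implExt (λ { fs (n ∷ []) → sym (R-ones n (len n)) }) (λ _ _ → ≤-refl)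
          (compI {Gs = Gs} {SGs} {S} (recI (B .impl) (H .impl) {S = T}
            (λ { _ _ (_ ∷ []) → s≤s z≤n }) (λ { fs n (x ∷ []) → ≤-trans (m≤m+n _ _) (m≤n+m _ 1) })
            (λ { fs n (x ∷ []) j j<n → ≤-trans (qp-mono i fs (H .poly) λ
                   { zero → len-mono (<⇒≤ j<n)
                   ; (suc zero) → ≤-trans (≤-reflexive (trans (cong len (R-ones x j)) (len-num-ones _))) (mono (len x) (<⇒≤ j<n))
                   ; (suc (suc zero)) → ≤-refl })
                 (≤-trans (m≤n+m _ _) (m≤n+m _ 1)) }))
            (λ { zero → lenF .impl ; (suc zero) → projI zero })
            (λ { fs (n ∷ []) zero → ≤-trans (≤-substP i fs (lenF .poly) (λ _ → var zero) (λ { zero → ≤-refl })) (≤-trans (m≤n+m _ _) (m≤n+m _ 1))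
               ; fs ns (suc zero) → z≤n })
            (λ { fs (n ∷ []) → s≤s (≤-trans (+-mono-≤ (≤-substP i fs (B .poly) (λ _ → var zero) (λ { zero → ≤-refl }))
                 (≤-substP i fs (H .poly) σ (λ { zero → len≤ (len n) ; (suc zero) → ≤-refl ; (suc (suc zero)) → ≤-refl }))) (m≤m+n _ _)) })) }
      where
      H : Feasible i {k} {3} (λ _ ns → s (lookup ns (suc zero)) (lookup ns (suc (suc zero))))
      H = feasible sC
      B : Feasible i {k} {1} (λ _ _ → b)
      B = feasible (constC b)
      σ : Fin 3 → QuasiPoly k 2
      σ zero          = var zero
      σ (suc zero)    = var (suc zero)
      σ (suc (suc _)) = var zero
      P : QuasiPoly k 2
      P = const 1 ⊕ ((substP (B .poly) (λ _ → var zero) ⊕ substP (H .poly) σ) ⊕ substP (lenF .poly) (λ _ → var zero))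
      S : Fn k 1
      S fs ns = qp i fs P (len (lookup ns zero) ∷ h (len (lookup ns zero)) (len (lookup ns zero)) ∷ [])
      Gs SGs : Fin 2 → Fn k 1
      Gs zero     fs ns = len (lookup ns zero)
      Gs (suc _)  fs ns = lookup ns zero
      SGs zero    fs ns = qp i fs (lenF .poly) (lens ns)
      SGs (suc _) fs ns = 0
      T : Fn k 2
      T fs (n ∷ x ∷ []) = 1 + (qp i fs (B .poly) (lens (x ∷ [])) + qp i fs (H .poly) (len n ∷ h n (len x) ∷ len x ∷ []))
      R-ones : ∀ x j → rec b (λ m a → s a x) j ≡ num (ones (h j (len x)))
      R-ones x zero    = base (len x)
      R-ones x (suc j) = trans (cong (λ a → s a x) (R-ones x j)) (step j x)

    squaring : Growing (λ n → n * n)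
    squaring = iterating {s = λ a x → cat x a} (λ j L → j * L) (catC (proj (suc (suc zero))) (proj (suc zero))) (λ _ → sym num-[])
      (λ j x → trans (cat-ones x _) (cong (λ n → num (ones (len x + n))) (len-num-ones _))) (λ L → *-monoˡ-≤ L)

    exponential : Growing (λ n → 2 ^ n)
    exponential = iterating {s = λ a x → cat a a} (λ j L → 2 ^ j) (catC (proj (suc zero)) (proj (suc zero))) (λ _ → refl)
      (λ j x → trans (cat-ones _ _) (cong (num ∘ ones) (cong₂ _+_ (len-num-ones (2 ^ j)) (trans (len-num-ones (2 ^ j)) (sym (+-identityʳ _))))))
      (λ _ → ^-monoʳ-≤ 2)

    -- The defining equation is followed literally: logarithm, smaller growth function, power of 2.
    -- The intermediate value is below the result because n < 2^n, so one variable for the result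
    -- suffices in the bound.
    growing : ∀ j → Growing (g (suc j))
    growing zero    = squaring
    growing (suc j) = record
      { poly₂ = P
      ; impl₂ = implExt (λ { fs (n ∷ []) → sym (cong (λ L → num (ones (2 ^ L))) (len-y n)) }) (λ _ _ → ≤-refl)
          (compI {Gs = λ _ → Y} {SGs = λ _ → SY} {S} (exponential .impl₂)
            (λ _ → compI {Gs = λ _ _ ns → logN (lookup ns zero)} {SGs = λ _ fs ns → qp i fs (logF .poly) (lens ns)} {SY} (growing j .impl₂) (λ _ → logF .impl)
               (λ fs ns _ → m≤m+n _ _) (λ { fs (n ∷ []) → m≤n+m _ _ }))
            (λ { fs (n ∷ []) _ → ≤-trans (+-mono-≤ (≤-substP i fs (logF .poly) (λ _ → var zero) (λ { zero → ≤-refl }))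
                   (qp-mono i fs (growing j .poly₂) λ { zero → ≤-trans (≤-reflexive (len-logN n)) (⌈log₂n⌉≤n (len n)) ; (suc zero) → y≤v n }))
                 (m≤m+n _ _) })
            (λ { fs (n ∷ []) → ≤-trans (≤-substP i fs (exponential .poly₂) (λ _ → var (suc zero))
                   (λ { zero → ≤-trans (≤-reflexive (len-num-ones _)) (y≤v n) ; (suc zero) → ≤-reflexive (cong (2 ^_) (len-y n)) }))
                 (m≤n+m _ _) })) }
      where
      logF : Feasible i {k} {1} (λ _ ns → logN (lookup ns zero))
      logF = feasible (logC (proj zero))
      P : QuasiPoly k 2
      P = (substP (logF .poly) (λ _ → var zero) ⊕ growing j .poly₂) ⊕ substP (exponential .poly₂) (λ _ → var (suc zero))
      S SY Y : Fn k 1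
      S fs ns = qp i fs P (len (lookup ns zero) ∷ g (suc (suc j)) (len (lookup ns zero)) ∷ [])
      SY fs ns = qp i fs (logF .poly) (lens ns) + qp i fs (growing j .poly₂) (len (logN (lookup ns zero)) ∷ g (suc j) (len (logN (lookup ns zero))) ∷ [])
      Y fs ns = num (ones (g (suc j) (len (logN (lookup ns zero)))))
      len-y : ∀ n → len (num (ones (g (suc j) (len (logN n))))) ≡ g (suc j) ⌈log₂ len n ⌉
      len-y n = trans (len-num-ones _) (cong (g (suc j)) (len-logN n))
      y≤v : ∀ n → g (suc j) (len (logN n)) ≤ g (suc (suc j)) (len n)
      y≤v n = ≤-trans (≤-reflexive (cong (g (suc j)) (len-logN n))) (<⇒≤ (n<2^n _))

-- Replacing the second variable of `poly₂` by `grow (var zero)` turns the bound in terms of the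
-- result into a quasi-polynomial in the argument. This discharges the parameter of `Core⇒Feasible`.
Core⇒Feasible′ : ∀ {i} → 1 ≤ i → ∀ {k l} {F : Fn k l} → Core (just i) k F → Feasible i F
Core⇒Feasible′ {suc j} _ {k} = Core⇒Feasible λ { refl → record
    { poly  = substP (Q .poly₂) σ ⊕ grow (var zero)
    ; impl  = implExt (λ _ _ → refl) (λ { fs (n ∷ []) → ≤-trans (≤-substP (suc j) fs (Q .poly₂) σ (λ { zero → ≤-refl ; (suc zero) → ≤-refl })) (m≤m+n _ _) }) (Q .impl₂)
    ; small = λ { fs (n ∷ []) → ≤-trans (≤-reflexive (len-num-ones _)) (m≤n+m _ _) } } }
  where
  open Growing
  Q : Growing {k} (suc j) (g (suc j))
  Q = growing (suc j) j
  σ : Fin 2 → QuasiPoly k 1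
  σ zero    = var zero
  σ (suc _) = grow (var zero)

-- Compilation

topR : ∀ {k l} → Reg k l → ℕ
topR (wrk n) = n
topR _       = 0

-- Only tested work registers are counted. A work register that is merely pushed to may lack a tape:
-- pushing to it then changes no tape, and no command observes its contents.
top : ∀ {k l} → Cmd k l → ℕ
top skip              = 0
top (push r b)        = 0
top (branch r c c₀ c₁) = topR r ⊔ (top c ⊔ (top c₀ ⊔ top c₁))
top (while r c)       = topR r ⊔ top c
top (oracle j)        = 0
top (c ⨾ c′)          = top c ⊔ top c′

clamp : ∀ m → ℕ → Fin (suc m)
clamp zero    n       = zero
clamp (suc m) zero    = zero
clamp (suc m) (suc n) = suc (clamp m n)

toℕ-clamp : ∀ {m n} → n ≤ m → toℕ (clamp m n) ≡ n
toℕ-clamp {zero}  z≤n     = refl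
toℕ-clamp {suc m} z≤n     = refl
toℕ-clamp         (s≤s p) = cong suc (toℕ-clamp p)

-- A successor `nothing` means that control leaves the command. Inside a larger command, embedded by
-- `ι`, control then passes to `κ`.
exit : ∀ {A B : Set} → (A → B) → Maybe B → Maybe A → Maybe B
exit ι κ (just n) = just (ι n)
exit ι κ nothing  = κ

exit-exit : ∀ {A B C : Set} {ι : A → B} {ι′ : B → C} {κ : Maybe B} {κ′ : Maybe C} x →
  exit ι′ κ′ (exit ι κ x) ≡ exit (ι′ ∘ ι) (exit ι′ κ′ κ) x
exit-exit (just n) = refl
exit-exit nothing  = refl

-- A register is a tape whose head is on the first bit, with only blanks to
-- the left and at most one blank to the right of the word.
data Holds (B : ℕ) : Tape 0 → Str → Set where
  holdsNil  : ∀ {a} → a ≤ B → Holds B ⟨ replicate a blank , blank , [] ⟩ []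
  holdsCons : ∀ {a b w e} → a + suc (length w) ≤ B → e ≤ 1 →
              Holds B ⟨ replicate a blank , bit b , map bit w ++ replicate e blank ⟩ (b ∷ w)

module _ {B : ℕ} where

  holds-cells : ∀ {t w} → Holds B t w → cells t ≤ suc B
  holds-cells (holdsNil {a} p) = ≤-trans (≤-reflexive (trans (cong (_+ 1) (length-replicate a)) (+-comm a 1))) (s≤s p)
  holds-cells (holdsCons {a} {b} {w} {e} p q) = begin
    length (replicate a (blank {0})) + suc (length (map bit w ++ replicate e blank))
      ≡⟨ cong₂ (λ m n → m + suc n) (length-replicate a) (trans (length-++ (map bit w)) (cong₂ _+_ (length-map bit w) (length-replicate e))) ⟩
    a + (suc (length w) + e)   ≡⟨ sym (+-assoc a (suc (length w)) e) ⟩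
    a + suc (length w) + e     ≤⟨ +-mono-≤ p q ⟩
    B + 1                      ≡⟨ +-comm B 1 ⟩
    suc B                      ∎
    where open ≤-Reasoning

  holds-word : ∀ {t w} → Holds B t w → word t ≡ w
  holds-word (holdsNil _) = refl
  holds-word (holdsCons {b = b} {w} {e} _ _) = cong (b ∷_) (aux w e)
    where
    aux : ∀ w e → bitPrefix (map bit w ++ replicate e (blank {0})) ≡ w
    aux []      zero    = refl
    aux []      (suc e) = refl
    aux (b ∷ w) e       = cong (b ∷_) (aux w e)

  holds-load : ∀ w → length w ≤ B → Holds B (load w) w
  holds-load []      p = holdsNil {a = 0} z≤n
  holds-load (b ∷ w) p = subst (λ rs → Holds B ⟨ [] , bit b , rs ⟩ (b ∷ w)) (++-identityʳ (map bit w)) (holdsCons {a = 0} {e = 0} p z≤n)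

  holds-pop : ∀ {t b w} → Holds B t (b ∷ w) → Holds B (writeMove (blank , goRight) t) w
  holds-pop (holdsCons {a} {w = []} {zero} p q)        = holdsNil {a = suc a} (≤-trans (≤-reflexive (+-comm 1 a)) p)
  holds-pop (holdsCons {a} {w = []} {suc zero} p q)    = holdsNil {a = suc a} (≤-trans (≤-reflexive (+-comm 1 a)) p)
  holds-pop (holdsCons {w = []} {suc (suc e)} p (s≤s ()))
  holds-pop (holdsCons {a} {w = b ∷ w} p q)            = holdsCons {a = suc a} (≤-trans (≤-reflexive (sym (+-suc a _))) p) q

  -- A push takes two steps, to the left and then writing. In between the head stands on a blank
  -- beside the word, so the cell bound for that moment is stated separately.
  holds-push : ∀ {t w} b → Holds B t w → suc (length w) ≤ B →
    cells (writeMove (Tape.head t , goLeft) t) ≤ suc B × Holds B (writeMove (bit b , stay) (writeMove (Tape.head t , goLeft) t)) (b ∷ w)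
  holds-push b h p = holds-cells (moved h p) , moved h p
    where
    moved : ∀ {t w} → Holds B t w → suc (length w) ≤ B → Holds B (writeMove (bit b , stay) (writeMove (Tape.head t , goLeft) t)) (b ∷ w)
    -- Moving left on an empty register leaves its scanned blank to the right of the head: this is
    -- where the one trailing blank comes from.
    moved (holdsNil {zero} q)      p = holdsCons {a = 0} {e = 1} p ≤-refl
    moved (holdsNil {suc a} q)     p = holdsCons {a = a} {e = 1} (≤-trans (≤-reflexive (+-comm a 1)) q) ≤-refl
    moved (holdsCons {zero} q e)   p = holdsCons {a = 0} p e
    moved (holdsCons {suc a} q e)  p = holdsCons {a = a} (≤-trans (≤-reflexive (+-suc a _)) q) e

module _ {k l : ℕ} where

  -- Program points serve as states. As they are indexed by the command, the embedding of a part
  -- into the whole is a constructor, and numbers for states appear only when the machine is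
  -- assembled.
  data Node : Cmd k l → Set where
    atSkip   : Node skip
    pushMove pushWrite : ∀ {r b} → Node (push r b)
    atTest   : ∀ {r c c₀ c₁} → Node (branch r c c₀ c₁)
    onEmpty  : ∀ {r c c₀ c₁} → Node c → Node (branch r c c₀ c₁)
    onBit    : ∀ {r c c₀ c₁} b → Node (pick b c₀ c₁) → Node (branch r c c₀ c₁)
    atLoop   : ∀ {r c} → Node (while r c)
    inLoop   : ∀ {r c} → Node c → Node (while r c)
    atOracle : ∀ {j} → Node (oracle j)
    inFirst  : ∀ {c c′} → Node c → Node (c ⨾ c′)
    inSecond : ∀ {c c′} → Node c′ → Node (c ⨾ c′)

  nodes : ∀ c → List (Node c)
  nodes skip               = atSkip ∷ []
  nodes (push r b)         = pushMove ∷ pushWrite ∷ []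
  nodes (branch r c c₀ c₁) = atTest ∷ map onEmpty (nodes c) ++ map (onBit false) (nodes c₀) ++ map (onBit true) (nodes c₁)
  nodes (while r c)        = atLoop ∷ map inLoop (nodes c)
  nodes (oracle j)         = atOracle ∷ []
  nodes (c ⨾ c′)           = map inFirst (nodes c) ++ map inSecond (nodes c′)

  ∈-nodes : ∀ {c} (n : Node c) → n ∈ nodes c
  ∈-nodes atSkip       = here refl
  ∈-nodes pushMove     = here refl
  ∈-nodes pushWrite    = there (here refl)
  ∈-nodes atTest       = here refl
  ∈-nodes (onEmpty n)  = there (∈-++⁺ˡ (∈-map⁺ onEmpty (∈-nodes n)))
  ∈-nodes {branch r c c₀ c₁} (onBit false n) = there (∈-++⁺ʳ (map onEmpty (nodes c)) (∈-++⁺ˡ (∈-map⁺ (onBit false) (∈-nodes n))))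
  ∈-nodes {branch r c c₀ c₁} (onBit true n) = there (∈-++⁺ʳ (map onEmpty (nodes c)) (∈-++⁺ʳ (map (onBit false) (nodes c₀)) (∈-map⁺ (onBit true) (∈-nodes n))))
  ∈-nodes atLoop       = here refl
  ∈-nodes (inLoop n)   = there (∈-map⁺ inLoop (∈-nodes n))
  ∈-nodes atOracle     = here refl
  ∈-nodes (inFirst n)  = ∈-++⁺ˡ (∈-map⁺ inFirst (∈-nodes n))
  ∈-nodes {c ⨾ c′} (inSecond n) = ∈-++⁺ʳ (map inFirst (nodes c)) (∈-map⁺ inSecond (∈-nodes n))

  entry : ∀ c → Node c
  entry skip              = atSkip
  entry (push r b)        = pushMove
  entry (branch r c c₀ c₁) = atTest
  entry (while r c)       = atLoop
  entry (oracle j)        = atOracle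
  entry (c ⨾ c′)          = inFirst (entry c)

  data Instr : Set where
    noop   : Instr
    onTape : Reg k l → Symbol 0 × Move → Instr
    answer : Fin k → Instr

  within : ∀ {A B : Set} → (A → B) → Maybe B → Instr × Maybe A → Instr × Maybe B
  within ι κ (a , x) = a , exit ι κ x

  δ : ∀ {c} → Node c → (Reg k l → Symbol 0) → Instr × Maybe (Node c)
  δ atSkip h                   = noop , nothing
  δ {push r b} pushMove h      = onTape r (h r , goLeft) , just pushWrite
  δ {push r b} pushWrite h     = onTape r (bit b , stay) , nothing
  δ {branch r c c₀ c₁} atTest h with h r
  ... | bit b                  = onTape r (blank , goRight) , just (onBit b (entry (pick b c₀ c₁)))
  ... | _                      = noop , just (onEmpty (entry c))
  δ (onEmpty n) h              = within onEmpty nothing (δ n h)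
  δ (onBit b n) h              = within (onBit b) nothing (δ n h)
  δ {while r c} atLoop h with h r
  ... | bit _                  = noop , just (inLoop (entry c))
  ... | _                      = noop , nothing
  δ (inLoop n) h               = within inLoop (just atLoop) (δ n h)
  δ {oracle j} atOracle h      = answer j , nothing
  δ {c ⨾ c′} (inFirst n) h     = within inFirst (just (inSecond (entry c′))) (δ n h)
  δ (inSecond n) h             = within inSecond nothing (δ n h)

module Compiled {k l : ℕ} (C : Cmd k l) where

  works : ℕ
  works = suc (top C)

  Id : Set
  Id = TapeId k l works

  tapeOf : Reg k l → Id
  tapeOf (inR j)  = inT j
  tapeOf outR     = outT
  tapeOf (qryR j) = qryT j
  tapeOf (ansR j) = ansT j
  tapeOf (wrk n)  = wrkT (clamp (top C) n)

  regOf : Id → Reg k l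
  regOf (inT j)  = inR j
  regOf outT     = outR
  regOf (qryT j) = qryR j
  regOf (ansT j) = ansR j
  regOf (wrkT j) = wrk (toℕ j)

  regOf-tapeOf : ∀ r → topR r ≤ top C → regOf (tapeOf r) ≡ r
  regOf-tapeOf (inR j)  _ = refl
  regOf-tapeOf outR     _ = refl
  regOf-tapeOf (qryR j) _ = refl
  regOf-tapeOf (ansR j) _ = refl
  regOf-tapeOf (wrk n)  p = cong wrk (toℕ-clamp p)

  tapeOf-regOf : ∀ x → tapeOf (regOf x) ≡ x
  tapeOf-regOf (inT j)  = refl
  tapeOf-regOf outT     = refl
  tapeOf-regOf (qryT j) = refl
  tapeOf-regOf (ansT j) = refl
  tapeOf-regOf (wrkT j) = cong wrkT (toℕ-injective (toℕ-clamp (s≤s⁻¹ (toℕ<n j))))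

  states : ℕ
  states = suc (length (nodes C))

  stateOf : Maybe (Node C) → Fin states
  stateOf nothing  = zero
  stateOf (just n) = suc (Any.index (∈-nodes n))

  nodeOf : Fin states → Maybe (Node C)
  nodeOf zero    = nothing
  nodeOf (suc j) = just (List.lookup (nodes C) j)

  nodeOf-stateOf : ∀ x → nodeOf (stateOf x) ≡ x
  nodeOf-stateOf nothing  = refl
  nodeOf-stateOf (just n) = cong just (sym (lookup-index (∈-nodes n)))

  Heads : Set
  Heads = Tapes k l works (Symbol 0)

  writes : Reg k l → Symbol 0 × Move → Heads → Id → Symbol 0 × Move
  writes r x hs y = decide (regOf y) r (λ _ → x) (λ _ → get hs y , stay)

  toAction : Instr → Fin states → Heads → Action k l works 0 states
  toAction noop         q hs = go q (build λ y → get hs y , stay)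
  toAction (onTape r x) q hs = go q (build (writes r x hs))
  toAction (answer j)   q hs = query j q

  nodeAction : Maybe (Node C) → Heads → Action k l works 0 states
  nodeAction nothing  hs = halt
  nodeAction (just n) hs = let (a , x) = δ n (λ r → get hs (tapeOf r)) in toAction a (stateOf x) hs

  machine : OTM k l
  machine = record { states = states ; works = works ; marks = 0 ; start = stateOf (just (entry C)) ; action = nodeAction ∘ nodeOf }

  TapesOf : Set
  TapesOf = Tapes k l works (Tape 0)

  config : Maybe (Node C) → TapesOf → Config machine
  config x t = stateOf x ▸ t

  decide-yes : ∀ {A : Set} {x r : Reg k l} {a b : A} → x ≡ r → decide x r (λ _ → a) (λ _ → b) ≡ a
  decide-yes {x = x} {r} e with x ≟ᴿ r
  ... | yes _ = refl
  ... | no ¬e = contradiction e ¬e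

  decide-no : ∀ {A : Set} {x r : Reg k l} {a b : A} → x ≢ r → decide x r (λ _ → a) (λ _ → b) ≡ b
  decide-no {x = x} {r} ¬e with x ≟ᴿ r
  ... | yes e = contradiction e ¬e
  ... | no _  = refl

  module _ (fs : Vec StrFun k) (B : ℕ) where

    advance : Config machine → Config machine
    advance c = perform machine fs c (nextAction machine c)

    Good : Config machine → Set
    Good c = ∀ y → cells (get (Config.tapes c) y) ≤ suc B

    data Path : Config machine → Config machine → Set where
      arrived : ∀ {c} → Path c c
      via     : ∀ {c c₁ c₂} → advance c ≡ c₁ → Good c₁ → Path c₁ c₂ → Path c c₂

    path-trans : ∀ {c c₁ c₂} → Path c c₁ → Path c₁ c₂ → Path c c₂
    path-trans arrived     q = q
    path-trans (via e x p) q = via e x (path-trans p q)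

    execute : Instr → TapesOf → TapesOf
    execute a t = Config.tapes (perform machine fs (config nothing t) (toAction a zero (mapTapes Tape.head t)))

    advance-node : ∀ n t → advance (config (just n) t) ≡
      config (proj₂ (δ n (λ r → get (mapTapes Tape.head t) (tapeOf r)))) (execute (proj₁ (δ n (λ r → get (mapTapes Tape.head t) (tapeOf r)))) t)
    advance-node n t = trans (cong (λ x → perform machine fs (config (just n) t) (nodeAction x (mapTapes Tape.head t))) (nodeOf-stateOf (just n)))
      (aux (proj₁ (δ n (λ r → get (mapTapes Tape.head t) (tapeOf r)))))
      where
      aux : ∀ {q} a → perform machine fs (config (just n) t) (toAction a q (mapTapes Tape.head t)) ≡ q ▸ execute a t
      aux noop         = refl
      aux (onTape r x) = refl
      aux (answer j)   = refl

    get-noop : ∀ t y → get (execute noop t) y ≡ get t y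
    get-noop t y = trans (get-zip writeMove (build λ y → get (mapTapes Tape.head t) y , stay) t y)
      (trans (cong (λ x → writeMove x (get t y)) (get-build (λ y → get (mapTapes Tape.head t) y , stay) y)) (cong (λ s → writeMove (s , stay) (get t y)) (get-map Tape.head t y)))

    get-onTape : ∀ r x t y → regOf y ≡ r → get (execute (onTape r x) t) y ≡ writeMove x (get t y)
    get-onTape r x t y e = trans (get-zip writeMove (build (writes r x (mapTapes Tape.head t))) t y)
      (cong (λ x → writeMove x (get t y)) (trans (get-build (writes r x (mapTapes Tape.head t)) y) (decide-yes e)))

    get-onTape-other : ∀ r x t y → regOf y ≢ r → get (execute (onTape r x) t) y ≡ get t y
    get-onTape-other r x t y e = trans (get-zip writeMove (build (writes r x (mapTapes Tape.head t))) t y)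
      (trans (cong (λ x → writeMove x (get t y)) (trans (get-build (writes r x (mapTapes Tape.head t)) y) (decide-no e))) (cong (λ s → writeMove (s , stay) (get t y)) (get-map Tape.head t y)))

    get-answer : ∀ j t → get (execute (answer j) t) (ansT j) ≡ load (lookup fs j (word (get t (qryT j))))
    get-answer j t = Vecₚ.lookup∘update j (Tapes.answers t) _

    get-answer-other : ∀ j t y → regOf y ≢ ansR j → get (execute (answer j) t) y ≡ get t y
    get-answer-other j t (inT _)  p = refl
    get-answer-other j t outT     p = refl
    get-answer-other j t (qryT _) p = refl
    get-answer-other j t (ansT _) p = Vecₚ.lookup∘update′ (λ e → p (cong ansR e)) (Tapes.answers t) _
    get-answer-other j t (wrkT _) p = refl

    record Matches (s : Store) (t : TapesOf) : Set where
      constructor matches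
      field holds : ∀ y → Holds B (get t y) (s (regOf y))

    open Matches

    matches-good : ∀ {s t x} → Matches s t → Good (config x t)
    matches-good m y = holds-cells (holds m y)

    headOf : Str → Symbol 0
    headOf []      = blank
    headOf (b ∷ w) = bit b

    head-holds : ∀ {t w} → Holds B t w → Tape.head t ≡ headOf w
    head-holds (holdsNil _)    = refl
    head-holds (holdsCons _ _) = refl

    head-reg : ∀ {s t} r → topR r ≤ top C → Matches s t → get (mapTapes Tape.head t) (tapeOf r) ≡ headOf (s r)
    head-reg {s} {t} r p m = trans (get-map Tape.head t (tapeOf r)) (trans (head-holds (holds m (tapeOf r))) (cong (headOf ∘ s) (regOf-tapeOf r p)))

    -- The machine belongs to the whole program `C`, while the simulation proceeds by parts. All
    -- that a part needs to know of its surroundings is where its points lie and where control goes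
    -- when it ends.
    Embedded : ∀ {c : Cmd k l} → (Node c → Node C) → Maybe (Node C) → Set
    Embedded {c} ι κ = ∀ n h → δ (ι n) h ≡ within ι κ (δ n h)

    embed : ∀ {c c′ : Cmd k l} {ι : Node c → Node C} {κ} {ι′ : Node c′ → Node c} {κ′} → Embedded ι κ →
      (∀ n h → δ (ι′ n) h ≡ within ι′ κ′ (δ n h)) → Embedded (ι ∘ ι′) (exit ι κ κ′)
    embed {ι = ι} {κ} {ι′} e e′ n h = trans (e (ι′ n) h) (trans (cong (within ι κ) (e′ n h))
      (cong (proj₁ (δ n h) ,_) (exit-exit (proj₂ (δ n h)))))

    single : ∀ {c : Cmd k l} {ι : Node c → Node C} {κ} → Embedded ι κ → ∀ n t {a x} → δ n (λ r → get (mapTapes Tape.head t) (tapeOf r)) ≡ (a , x) →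
      advance (config (just (ι n)) t) ≡ config (exit ι κ x) (execute a t)
    single {ι = ι} em n t e = trans (advance-node (ι n) t)
      (cong (λ d → config (proj₂ d) (execute (proj₁ d) t)) (trans (em n _) (cong (within ι _) e)))

    Simulates : ∀ {c : Cmd k l} → (Node c → Node C) → Maybe (Node C) → Store → Store → Set
    Simulates {c} ι κ s s′ = ∀ t → Matches s t → ∃ λ t′ → Matches s′ t′ × Path (config (just (ι (entry c))) t) (config κ t′)

    noop-matches : ∀ {s t} → Matches s t → Matches s (execute noop t)
    noop-matches {s} {t} m = matches λ y → subst (λ u → Holds B u (s (regOf y))) (sym (get-noop t y)) (holds m y)

    upd-matches : ∀ {s r w t} → (∀ y → regOf y ≡ r → Holds B (get t y) w) → (∀ y → regOf y ≢ r → Holds B (get t y) (s (regOf y))) → Matches (upd s r w) t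
    upd-matches {s} {r} {w} {t} p q = matches λ y → decide (regOf y) r
      (λ e → subst (Holds B (get t y)) (sym (trans (cong (upd s r w) e) (upd-same s r w))) (p y e))
      (λ ¬e → subst (Holds B (get t y)) (sym (upd-other s w ¬e)) (q y ¬e))

    pop-matches : ∀ {s r b w t} → s r ≡ b ∷ w → Matches s t → Matches (upd s r w) (execute (onTape r (blank , goRight)) t)
    pop-matches {s} {r} {t = t} e m = upd-matches
      (λ y p → subst (λ u → Holds B u _) (sym (get-onTape r _ t y p)) (holds-pop (subst (Holds B (get t y)) (trans (cong s p) e) (holds m y))))
      (λ y p → subst (λ u → Holds B u (s (regOf y))) (sym (get-onTape-other r _ t y p)) (holds m y))

    follow : ∀ {c₀ c₁ s s′ t κ} {x : Maybe (Node C)} → advance c₀ ≡ c₁ → c₁ ≡ config x t → Matches s t →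
      (∃ λ t′ → Matches s′ t′ × Path (config x t) (config κ t′)) → ∃ λ t′ → Matches s′ t′ × Path c₀ (config κ t′)
    follow {x = x} e refl m (t′ , m′ , p) = t′ , m′ , via e (matches-good {x = x} m) p

    -- The induction is on the run, not on the command: a repeated loop is the same command at the
    -- same place, but with a shorter run.
    simulate : ∀ {c : Cmd k l} {s s′} → Run fs B c s s′ → top c ≤ top C → ∀ {ι : Node c → Node C} {κ} → Embedded ι κ → Simulates ι κ s s′
    simulate run-skip _ {κ = κ} em t m =
      follow {x = κ} (single em atSkip t refl) refl (noop-matches m) (_ , noop-matches m , arrived)
    simulate {push r b} {s} (run-push room) _ {ι} {κ} em t m =
      t₂ , m₂ , via (single em pushMove t refl) good₁ (via (single em pushWrite t₁ refl) (matches-good {x = κ} m₂) arrived)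
      where
      h₀ = get (mapTapes Tape.head t) (tapeOf r)
      t₁ = execute (onTape r (h₀ , goLeft)) t
      t₂ = execute (onTape r (bit b , stay)) t₁
      -- If `r` is a work register beyond `top C`, no `y` satisfies the premise; otherwise
      -- `tapeOf r` is `y` itself.
      head≡ : ∀ y → regOf y ≡ r → h₀ ≡ Tape.head (get t y)
      head≡ y e = trans (cong (get (mapTapes Tape.head t)) (trans (cong tapeOf (sym e)) (tapeOf-regOf y))) (get-map Tape.head t y)
      get₁ : ∀ y → regOf y ≡ r → get t₁ y ≡ writeMove (Tape.head (get t y) , goLeft) (get t y)
      get₁ y e = trans (get-onTape r _ t y e) (cong (λ h → writeMove (h , goLeft) (get t y)) (head≡ y e))
      pushed : ∀ y → regOf y ≡ r → cells (writeMove (Tape.head (get t y) , goLeft) (get t y)) ≤ suc B ×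
        Holds B (writeMove (bit b , stay) (writeMove (Tape.head (get t y) , goLeft) (get t y))) (b ∷ s r)
      pushed y e = holds-push b (subst (Holds B (get t y)) (cong s e) (holds m y)) room
      good₁ : Good (config (just (ι pushWrite)) t₁)
      good₁ y = decide (regOf y) r
        (λ e → subst (λ u → cells u ≤ suc B) (sym (get₁ y e)) (proj₁ (pushed y e)))
        (λ ¬e → subst (λ u → cells u ≤ suc B) (sym (get-onTape-other r _ t y ¬e)) (holds-cells (holds m y)))
      m₂ : Matches (upd s r (b ∷ s r)) t₂
      m₂ = upd-matches
        (λ y e → subst (λ u → Holds B u (b ∷ s r)) (sym (trans (get-onTape r _ t₁ y e) (cong (writeMove (bit b , stay)) (get₁ y e)))) (proj₂ (pushed y e)))
        (λ y ¬e → subst (λ u → Holds B u (s (regOf y))) (sym (trans (get-onTape-other r _ t₁ y ¬e) (get-onTape-other r _ t y ¬e))) (holds m y))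
    simulate {branch r c c₀ c₁} {s} (run-empty e run) sc {ι} em t m =
      follow {x = just (ι (onEmpty (entry c)))} (single em atTest t δ≡) refl (noop-matches m)
        (simulate run (≤-trans (≤-trans (m≤m⊔n (top c) _) (m≤n⊔m (topR r) _)) sc) (embed {ι = ι} {ι′ = onEmpty} em λ _ _ → refl) _ (noop-matches m))
      where
      δ≡ : δ (atTest {r = r} {c} {c₀} {c₁}) (λ r → get (mapTapes Tape.head t) (tapeOf r)) ≡ (noop , just (onEmpty (entry c)))
      δ≡ with get (mapTapes Tape.head t) (tapeOf r) | trans (head-reg r (≤-trans (m≤m⊔n (topR r) _) sc) m) (cong headOf e)
      ... | _ | refl = refl
    simulate {branch r c c₀ c₁} {s} (run-bit {b = b} e run) sc {ι} em t m =
      follow {x = just (ι (onBit b (entry (pick b c₀ c₁))))} (single em atTest t δ≡) refl (pop-matches e m)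
        (simulate run (≤-trans (top-pick b) sc) (embed {ι = ι} {ι′ = onBit b} em λ _ _ → refl) _ (pop-matches e m))
      where
      top-pick : ∀ b → top (pick b c₀ c₁) ≤ top (branch r c c₀ c₁)
      top-pick false = ≤-trans (≤-trans (m≤m⊔n (top c₀) _) (m≤n⊔m (top c) _)) (m≤n⊔m (topR r) _)
      top-pick true  = ≤-trans (≤-trans (m≤n⊔m (top c₀) _) (m≤n⊔m (top c) _)) (m≤n⊔m (topR r) _)
      δ≡ : δ (atTest {r = r} {c} {c₀} {c₁}) (λ r → get (mapTapes Tape.head t) (tapeOf r)) ≡ (onTape r (blank , goRight) , just (onBit b (entry (pick b c₀ c₁))))
      δ≡ with get (mapTapes Tape.head t) (tapeOf r) | trans (head-reg r (≤-trans (m≤m⊔n (topR r) _) sc) m) (cong headOf e)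
      ... | _ | refl = refl
    simulate {while r c} (run-done e) sc {κ = κ} em t m =
      follow {x = κ} (single em atLoop t δ≡) refl (noop-matches m) (_ , noop-matches m , arrived)
      where
      δ≡ : δ (atLoop {r = r} {c}) (λ r → get (mapTapes Tape.head t) (tapeOf r)) ≡ (noop , nothing)
      δ≡ with get (mapTapes Tape.head t) (tapeOf r) | trans (head-reg r (≤-trans (m≤m⊔n (topR r) _) sc) m) (cong headOf e)
      ... | _ | refl = refl
    simulate {while r c} (run-again {b = b} e run₁ run₂) sc {ι} em t m
      with simulate run₁ (≤-trans (m≤n⊔m (topR r) _) sc) (embed {ι = ι} {ι′ = inLoop} em λ _ _ → refl) _ (noop-matches m)
    ... | t₁ , m₁ , p₁ with simulate run₂ sc em t₁ m₁
    ... | t₂ , m₂ , p₂ = follow {x = just (ι (inLoop (entry c)))} (single em atLoop t δ≡) refl (noop-matches m) (t₂ , m₂ , path-trans p₁ p₂)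
      where
      δ≡ : δ (atLoop {r = r} {c}) (λ r → get (mapTapes Tape.head t) (tapeOf r)) ≡ (noop , just (inLoop (entry c)))
      δ≡ with get (mapTapes Tape.head t) (tapeOf r) | trans (head-reg r (≤-trans (m≤m⊔n (topR r) _) sc) m) (cong headOf e)
      ... | _ | refl = refl
    simulate {oracle j} {s} (run-oracle room) _ {κ = κ} em t m = follow {x = κ} (single em atOracle t refl) refl m′ (_ , m′ , arrived)
      where
      answered : ∀ y → regOf y ≡ ansR j → Holds B (get (execute (answer j) t) y) (lookup fs j (s (qryR j)))
      answered (ansT .j) refl = subst (λ u → Holds B u _) (sym (get-answer j t))
        (subst (λ w → Holds B (load (lookup fs j w)) _) (sym (holds-word (holds m (qryT j)))) (holds-load _ room))
      m′ : Matches (upd s (ansR j) (lookup fs j (s (qryR j)))) (execute (answer j) t)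
      m′ = upd-matches answered λ y ¬e → subst (λ u → Holds B u (s (regOf y))) (sym (get-answer-other j t y ¬e)) (holds m y)
    simulate {c ⨾ c′} (run-seq run₁ run₂) sc {ι} em t m
      with simulate run₁ (≤-trans (m≤m⊔n (top c) _) sc) (embed {ι = ι} {ι′ = inFirst} em λ _ _ → refl) t m
    ... | t₁ , m₁ , p₁ with simulate run₂ (≤-trans (m≤n⊔m (top c) _) sc) (embed {ι = ι} {ι′ = inSecond} em λ _ _ → refl) t₁ m₁
    ... | t₂ , m₂ , p₂ = t₂ , m₂ , path-trans p₁ p₂

-- Correctness and space of compiled programs

module _ {k l : ℕ} (C : Cmd k l) where
  open Compiled C

  -- Space has to be bounded at every time, so the good configurations along a path are collected
  -- together with the time of arrival.
  path-times : ∀ {fs B xs c c′} → Path fs B c c′ → ∀ n → configAt machine fs xs n ≡ c → (∀ m → m ≤ n → Good fs B (configAt machine fs xs m)) →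
    ∃ λ n′ → configAt machine fs xs n′ ≡ c′ × (∀ m → m ≤ n′ → Good fs B (configAt machine fs xs m))
  path-times arrived n e gs = n , e , gs
  path-times {fs} {B} {xs} (via a x p) n e gs = path-times p (suc n) e′ λ m m≤ → aux m (m≤n⇒m<n∨m≡n m≤)
    where
    e′ = trans (cong (advance fs B) e) a
    aux : ∀ m → m < suc n ⊎ m ≡ suc n → Good fs B (configAt machine fs xs m)
    aux m (inj₁ m<)   = gs m (s≤s⁻¹ m<)
    aux m (inj₂ refl) = subst (Good fs B) (sym e′) x

  startStore : Vec Str l → Reg k l → Str
  startStore xs (inR j) = lookup xs j
  startStore xs _       = []

  start-bounded : ∀ xs {B} → Vec.sum (Vec.map length xs) ≤ B → Bounded B (startStore xs)
  start-bounded xs p (inR j)  = ≤-trans (lookup≤sum-map length xs j) p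
  start-bounded xs p outR     = z≤n
  start-bounded xs p (qryR j) = z≤n
  start-bounded xs p (ansR j) = z≤n
  start-bounded xs p (wrk n)  = z≤n

  start-matches : ∀ fs B xs → Bounded B (startStore xs) → Matches fs B (startStore xs) (Config.tapes (initial machine xs))
  start-matches fs B xs b = matches λ
    { (inT j)  → subst (λ t → Holds B t (lookup xs j)) (sym (lookup-map j load xs)) (holds-load (lookup xs j) (b (inR j)))
    ; outT     → holds-load [] z≤n
    ; (qryT j) → subst (λ t → Holds B t []) (sym (lookup-replicate j (load []))) (holds-load [] z≤n)
    ; (ansT j) → subst (λ t → Holds B t []) (sym (lookup-replicate j (load []))) (holds-load [] z≤n)
    ; (wrkT j) → subst (λ t → Holds B t []) (sym (lookup-replicate j (load []))) (holds-load [] z≤n) }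

  program-halts : ∀ fs B xs {s′ w} → Bounded B (startStore xs) → Run fs B C (startStore xs) s′ → s′ outR ≡ w →
    (∃ λ T → HaltsWithin machine T fs xs w) × (∀ n → space machine (configAt machine fs xs n) ≤ tapeCount {k} {l} {works} * suc B)
  program-halts fs B xs {s′} b run v with simulate fs B run ≤-refl {ι = id} {κ = nothing} (λ n h → sym (within-id (δ n h))) _ (start-matches fs B xs b)
    where
    within-id : ∀ {A : Set} (p : Instr {k} {l} × Maybe A) → within id nothing p ≡ p
    within-id (a , just n)  = refl
    within-id (a , nothing) = refl
  ... | t′ , m′ , p with path-times p 0 refl (λ { .0 z≤n → matches-good fs B {x = just (entry C)} (start-matches fs B xs b) })
  ... | n′ , e , gs = (n′ , n′ , ≤-refl , halted , trans (cong (result machine) e) (trans (holds-word (Matches.holds m′ outT)) v)) , λ n →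
        total≤ _ (suc B) λ r → subst (_≤ suc B) (sym (get-map cells (Config.tapes (configAt machine fs xs n)) r)) (good n r)
    where
    halted : Halted machine (configAt machine fs xs n′)
    halted = cong (nextAction machine) e
    good : ∀ n → Good fs B (configAt machine fs xs n)
    good n with ≤-total n n′
    ... | inj₁ n≤ = gs n n≤
    ... | inj₂ n≥ = subst (Good fs B) (sym (trans (cong (configAt machine fs xs) (sym (m∸n+n≡m n≥))) (configAt-halted machine fs xs {n′} halted (n ∸ n′)))) (gs n′ ≤-refl)

Feasible⇒QPS : ∀ {i k l} {F : Functional k l} → Feasible i (fromFunctional F) → QuasiPolySpace i F
Feasible⇒QPS {i} {k} {l} {F} f = Compiled.machine C , P , (λ fs xs → proj₁ (outcome fs xs)) , λ fs xs n → ≤-trans (proj₂ (outcome fs xs) n) (≤-reflexive (sym (P≡ fs xs)))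
  where
  ins : Vec (Reg k l) l
  ins = tabulate inR
  C : Cmd k l
  C = f .impl .compiled ins outR 0
  P : QuasiPoly k l
  -- Every tape stays within B + 1 cells, where B is the polynomial of the program plus the lengths
  -- of the inputs, which the initial store must hold.
  P = const (tapeCount {k} {l} {Compiled.works C}) ⊗ (const 1 ⊕ (f .poly ⊕ sumP var))
  bound : Vec StrFun k → Vec Str l → ℕ
  bound fs xs = qp i fs (f .poly) (Vec.map length xs) + Vec.sum (Vec.map length xs)
  P≡ : ∀ fs xs → qp i fs P (Vec.map length xs) ≡ tapeCount {k} {l} {Compiled.works C} * suc (bound fs xs)
  P≡ fs xs = cong (λ n → tapeCount {k} {l} {Compiled.works C} * suc (qp i fs (f .poly) (Vec.map length xs) + n))
    (trans (eval-sumP i var (Vec.map funLength fs) (Vec.map length xs)) (cong Vec.sum (tabulate∘lookup (Vec.map length xs))))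
  vals≡ : ∀ xs → vals (startStore C xs) ins ≡ Vec.map num xs
  vals≡ xs = trans (tabulate-cong λ j → trans (cong (num ∘ startStore C xs) (lookup∘tabulate inR j)) (sym (lookup-map j num xs))) (tabulate∘lookup (Vec.map num xs))
  lens≡ : ∀ xs → lens (Vec.map num xs) ≡ Vec.map length xs
  lens≡ xs = trans (sym (Vecₚ.map-∘ len num xs)) (Vecₚ.map-cong (λ w → cong length (str-num w)) xs)
  GoodRun : Vec StrFun k → Vec Str l → Set
  GoodRun fs xs = (∃ λ T → HaltsWithin (Compiled.machine C) T fs xs (F fs xs)) ×
    (∀ n → space (Compiled.machine C) (configAt (Compiled.machine C) fs xs n) ≤ tapeCount {k} {l} {Compiled.works C} * suc (bound fs xs))
  outcome : ∀ fs xs → GoodRun fs xs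
  outcome fs xs = finish (f .impl .correct {ins = ins} {outR} {0} (λ j → subst (Old 0) (sym (lookup∘tabulate inR j)) tt) tt {fs} {bound fs xs} (startStore C xs) bd
      (≤-trans (≤-reflexive (cong (qp i fs (f .poly)) (trans (cong lens (vals≡ xs)) (lens≡ xs)))) (m≤m+n _ _)))
    where
    bd : Bounded (bound fs xs) (startStore C xs)
    bd = start-bounded C xs (m≤n+m _ _)
    finish : Reaches fs (bound fs xs) C (startStore C xs) (Outcome 0 outR (str (fromFunctional F fs (vals (startStore C xs) ins))) (startStore C xs)) → GoodRun fs xs
    finish (s′ , r , v , _) = program-halts C fs (bound fs xs) xs bd r
      (trans v (trans (str-num _) (cong (F fs) (trans (cong (Vec.map str) (vals≡ xs)) (map-str-num xs)))))

theorem3 : (i : ℕ) → 1 ≤ i → ∀ {k l} (F : Functional k l) →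
    BasicFeasibleSpace i F ⇔ QuasiPolySpace i F
theorem3 i 1≤i F = mk⇔
  (λ p → Feasible⇒QPS (Core⇒Feasible′ 1≤i (BFSF⇒Core 1≤i p)))
  (λ q → BFSF-ext (λ fs xs → sym (trans (str-num _) (cong (F fs) (map-str-num xs)))) (Core⇒BFSF (QPS⇒Core 1≤i {F = F} q)))
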